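{- Let $(X,d)$ be a geodesic space. Then the following are equivalent: (1) $\operatorname{UBG}(X)=\operatorname{UBG}(S^1)$. (2) $X$ is similar to $S^1$.
   Context: All graphs are finite, simple and undirected. A geodesic from $x$ to $y$ in a metric space $(X,d)$ is a distance-preserving map $\gamma\colon[0,d(x,y)]\to X$ with $\gamma(0)=x$, $\gamma(d(x,y))=y$; $(X,d)$ is a geodesic space if every two points are joined by a geodesic. A graph $G=(V_G,E_G)$ is a unit ball graph on $(X,d)$ if there exist $\delta>0$ and a map $\rho\colon V_G\to X$ such that for distinct $u,v\in V_G$, $\{u,v\}\in E_G$ if and only if $d(\rho(u),\rho(v))\le\delta$. $\operatorname{UBG}(X)$ denotes the collection of all unit ball graphs on $X$. $S^1$ is the unit circle with the great-circle (arc length) metric. Metric spaces $X,Y$ are similar if there exist a bijection $f\colon X\to Y$ and $r>0$ with $d_Y(f(a),f(b))=r\,d_X(a,b)$ for all $a,b\in X$. -}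

module Defs where

open import Level using (Level; 0ℓ; suc; _⊔_)
open import Algebra.Bundles using (CommutativeRing)
import Algebra.Construct.NaturalChoice.Max as Max
import Algebra.Construct.NaturalChoice.Min as Min
open import Axiom.ExcludedMiddle using (ExcludedMiddle)
open import Data.Fin.Base using (Fin)
open import Data.List.Base using (List; []; _∷_; _∷ʳ_)
open import Data.List.Relation.Unary.Linked using (Linked)
open import Data.Nat.Base using (ℕ)
open import Data.Product.Base using (Σ; ∃; _×_; _,_; proj₁; proj₂)
open import Data.Product.Relation.Binary.Pointwise.NonDependent using (×-setoid)
open import Function.Bundles using (_⇔_; _↔_; Bijection)
open import Function.Metric.Structures using (IsGeneralMetric)
open import Relation.Binary.Bundles using (Setoid; TotalOrder)
import Relation.Binary.Construct.NonStrictToStrict as Strict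
import Relation.Binary.Construct.On as On
open import Relation.Binary.Core using (Rel)
open import Relation.Binary.Definitions using (Irreflexive; Symmetric)
open import Relation.Binary.PropositionalEquality.Core using (_≡_; _≢_)
open import Relation.Binary.Structures using (IsTotalOrder)
open import Relation.Nullary using (¬_; yes; no)
open import Relation.Unary using (Pred)

-- The axioms characterise the field of real numbers up to unique
-- isomorphism.  Completeness is asked of Set-valued predicates only;
-- under excluded middle this covers predicates of every level.

record CompleteOrderedField : Set₁ where
  field
    commutativeRing : CommutativeRing 0ℓ 0ℓ

  open CommutativeRing commutativeRing public

  infix 4 _≤_

  field
    _≤_          : Rel Carrier 0ℓ
    isTotalOrder : IsTotalOrder _≈_ _≤_
    +-monoˡ-≤    : ∀ z {x y} → x ≤ y → x + z ≤ y + z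
    *-nonNeg     : ∀ {x y} → 0# ≤ x → 0# ≤ y → 0# ≤ x * y
    1≉0          : ¬ (1# ≈ 0#)
    inverse      : ∀ x → ¬ (x ≈ 0#) → ∃ λ y → x * y ≈ 1#

  UpperBound : Pred Carrier 0ℓ → Carrier → Set
  UpperBound P b = ∀ x → P x → x ≤ b

  LeastUpperBound : Pred Carrier 0ℓ → Carrier → Set
  LeastUpperBound P s = UpperBound P s × (∀ b → UpperBound P b → s ≤ b)

  field
    complete : ∀ P → ∃ P → ∃ (UpperBound P) → ∃ (LeastUpperBound P)

  totalOrder : TotalOrder 0ℓ 0ℓ 0ℓ
  totalOrder = record { isTotalOrder = isTotalOrder }

  open Strict _≈_ _≤_ public using (_<_)
  open Min totalOrder public using () renaming (_⊓_ to min)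
  open Max totalOrder public using () renaming (_⊔_ to max)

  ∣_∣ : Carrier → Carrier
  ∣ x ∣ = max x (- x)

  -- The value 0# is used only if P has no least upper bound.
  sup : ExcludedMiddle 0ℓ → Pred Carrier 0ℓ → Carrier
  sup lem P with lem {∃ (LeastUpperBound P)}
  ... | yes (s , _) = s
  ... | no _        = 0#

record FiniteGraph : Set₁ where
  field
    Vertex      : Set
    finite      : ∃ λ (n : ℕ) → Vertex ↔ Fin n
    Edge        : Rel Vertex 0ℓ
    symmetric   : Symmetric Edge
    irreflexive : Irreflexive _≡_ Edge

module _ (ℝ : CompleteOrderedField) where

  private
    module ℝ = CompleteOrderedField ℝ
  open ℝ using (0#; _+_; _*_; _-_; ∣_∣; _≤_; _<_) renaming (Carrier to R)

  record DistanceSpace (a ℓ : Level) : Set (suc (a ⊔ ℓ)) where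
    field
      setoid : Setoid a ℓ
    open Setoid setoid public using (Carrier; _≈_)
    field
      d : Carrier → Carrier → R

  private
    variable
      a ℓ b ℓ′ : Level

  IsMetricSpace : DistanceSpace a ℓ → Set (a ⊔ ℓ)
  IsMetricSpace X = IsGeneralMetric X._≈_ ℝ._≈_ _≤_ 0# _+_ X.d
    where module X = DistanceSpace X

  record Geodesic (X : DistanceSpace a ℓ) (x y : DistanceSpace.Carrier X)
                  : Set (a ⊔ ℓ) where
    open DistanceSpace X

    Domain : Set
    Domain = Σ R λ t → 0# ≤ t × t ≤ d x y

    field
      γ         : Domain → Carrier
      isometric : ∀ s t → d (γ s) (γ t) ℝ.≈ ∣ proj₁ s - proj₁ t ∣
      start     : ∀ t → proj₁ t ℝ.≈ 0# → γ t ≈ x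
      end       : ∀ t → proj₁ t ℝ.≈ d x y → γ t ≈ y

  IsGeodesicSpace : DistanceSpace a ℓ → Set (a ⊔ ℓ)
  IsGeodesicSpace X = IsMetricSpace X × (∀ x y → Geodesic X x y)

  UBG : DistanceSpace a ℓ → Pred FiniteGraph a
  UBG X G =
    Σ R λ δ → 0# < δ ×
    Σ (Vertex → X.Carrier) λ ρ →
      ∀ u v → u ≢ v → Edge u v ⇔ X.d (ρ u) (ρ v) ≤ δ
    where
    open FiniteGraph G
    module X = DistanceSpace X

  Similar : DistanceSpace a ℓ → DistanceSpace b ℓ′ → Set (a ⊔ ℓ ⊔ b ⊔ ℓ′)
  Similar X Y =
    Σ (Bijection X.setoid Y.setoid) λ f →
    Σ R λ r → 0# < r ×
      (∀ p q → Y.d (Bijection.to f p) (Bijection.to f q) ℝ.≈ r * X.d p q)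
    where
    module X = DistanceSpace X
    module Y = DistanceSpace Y

  module UnitCircle (lem : ExcludedMiddle 0ℓ) where

    infix 8 _²

    _² : R → R
    t ² = t * t

    sqrt : R → R
    sqrt t = ℝ.sup lem λ s → s ² ≤ t

    Plane : Setoid 0ℓ 0ℓ
    Plane = ×-setoid ℝ.setoid ℝ.setoid

    record Point : Set where
      constructor point
      field
        coords   : R × R
        onCircle : proj₁ coords ² + proj₂ coords ² ℝ.≈ ℝ.1#

      x y : R
      x = proj₁ coords
      y = proj₂ coords

    open Point

    chord : Point → Point → R
    chord p q = sqrt ((x p - x q) ² + (y p - y q) ²)

    -- The triangle p q r is positively oriented.  For points of the circle:
    -- p, q, r are distinct and are met in this order going anticlockwise.
    Anticlockwise : Point → Point → Point → Set
    Anticlockwise p q r =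
      0# < (x q - x p) * (y r - y p) - (y q - y p) * (x r - x p)

    polygonLength : Point → List Point → Point → R
    polygonLength p []       q = chord p q
    polygonLength p (v ∷ vs) q = chord p v + polygonLength v vs q

    -- Length of the arc traversed anticlockwise from p to q: the supremum of
    -- the lengths of the polygonal lines inscribed in it.  `Anticlockwise p`
    -- is the linear order in which the circle minus p is traversed starting
    -- from p.  If p and q are equal then vs must be empty, so the length is 0.
    arcLength : Point → Point → R
    arcLength p q = ℝ.sup lem λ t →
      Σ (List Point) λ vs →
        Linked (Anticlockwise p) (vs ∷ʳ q) × t ℝ.≈ polygonLength p vs q

    -- The great-circle metric: the length of the shorter of the two arcs.
    S¹ : DistanceSpace 0ℓ 0ℓ
    S¹ = record
      { setoid = On.setoid Plane coords
      ; d      = λ p q → ℝ.min (arcLength p q) (arcLength q p)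
      }

  open UnitCircle public using (S¹)

{-# OPTIONS --safe #-}

-- On the circle no unit ball graph contains a triangle with a pendant
-- vertex at each corner (a net), and the six vertices of a regular hexagon
-- span a unit ball graph; both facts pass to X along the equality of the two
-- collections.  If a point c inside a geodesic γ of X were the foot on γ of a
-- point y outside γ, then γ and the geodesic from c to y would carry a net.
-- So feet lie at the ends of γ, and every geodesic from a point of γ to a
-- point outside γ leaves γ through one of its ends.  The hexagon yields three
-- points of X all of whose triangle inequalities are strict; the midpoint of
-- the perimeter opposite to one of them is joined to it by two different
-- geodesics.  By the property above these meet only at their ends, together
-- exhaust X, and have the mutual distances of two half circles.

module Submission where

open import Defs
import Algebra.Construct.NaturalChoice.Max as Max
import Algebra.Construct.NaturalChoice.MaxOp as MaxOp
import Algebra.Construct.NaturalChoice.Min as Min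
import Algebra.Construct.NaturalChoice.MinOp as MinOp
import Algebra.Properties.Ring as RingProperties
import Algebra.Properties.Semiring.Mult as Mult
open import Axiom.ExcludedMiddle using (ExcludedMiddle)
open import Data.Bool.Base using (Bool; true; false; T; _∧_; if_then_else_)
open import Data.Bool.ListAction using (any)
open import Data.Bool.Properties using (T-∧)
open import Data.Empty using (⊥; ⊥-elim)
open import Data.Fin.Base using (Fin; zero; suc; toℕ)
import Data.Fin.Properties as Fin
open import Data.Integer.Base as ℤ using (ℤ; +_; -[1+_]; +[1+_])
import Data.Integer.Properties as ℤ
open import Data.List.Base using (List; []; _∷_; _∷ʳ_; _++_; concatMap; map; foldr)
import Data.List.Properties as List
open import Data.List.Relation.Unary.All as All using (All; []; _∷_)
import Data.List.Relation.Unary.All.Properties as All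
open import Data.List.Relation.Unary.Linked using (Linked; [-]; _∷_)
open import Data.Nat.Base as ℕ using (ℕ; zero; suc)
import Data.Nat.Properties as ℕ
open import Data.Product.Base using (Σ; ∃; _×_; _,_; proj₁; proj₂)
open import Data.Sum.Base as Sum using (_⊎_; inj₁; inj₂)
open import Data.Sum.Properties using (inj₁-injective)
open import Data.Unit.Base using (⊤; tt)
open import Data.Vec.Base as Vec using (Vec; lookup)
open import Data.Vec.N-ary using (N-ary; _$ⁿ_; ∀ⁿʰ; curryⁿ)
open import Function.Base using (_∘_; id; case_of_)
open import Function.Bundles using (_⇔_; mk⇔; _↔_; Bijection; module Equivalence)
open import Function.Metric.Structures using (IsGeneralMetric)
open import Function.Properties.Inverse using (↔-sym)
open import Level using (Level; 0ℓ; _⊔_)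
open import Relation.Binary.Bundles using (Setoid)
open import Relation.Binary.PropositionalEquality.Core as ≡ using (_≡_; _≢_)
import Relation.Binary.Reasoning.Setoid as ≈-Reasoning
open import Relation.Binary.Structures using (IsTotalOrder)
open import Relation.Nullary using (¬_; Dec; yes; no)
open import Relation.Nullary.Decidable using (decidable-stable)
open import Relation.Unary using (Pred; _≐_)

-- A unit ball graph records of each distance only whether it exceeds δ, so metric facts about X
-- have to be drawn from finite patterns of such comparisons. The strict triangle inequalities come
-- from the scale: alternate vertices of the hexagon are more than δ apart but share a neighbour, so
-- their three distances lie in (δ, 2δ] and each is below the sum of the other two. Nets appear at
-- arbitrarily small scales, so an interior foot is excluded by looking near it. Nearest points and
-- last meeting points on a geodesic come from completeness of the reals, applied to 1-Lipschitz
-- distance functions.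
--
-- The other half of the work is the circle, whose metric is a supremum of polygon lengths. Arc
-- length becomes a coordinate once arcs are known to be additive and to take all intermediate
-- values. The slope, minus the cotangent of half the angle, serves both: it orders the circle minus
-- a point, and chords are at most twice its increments. X and the circle are then compared through
-- coordinates in [0, c) with the distance min(|s - t|, c - |s - t|).

module LinearArithmetic where

  -- Linear arithmetic over polynomials: hypotheses and negated goal are
  -- normalised to polynomials with integer coefficients, whose monomials are
  -- then eliminated by the method of Fourier and Motzkin.  No products of
  -- hypotheses are formed: those needed are supplied as further hypotheses.

  infixl 6 _:+_ _:-_
  infixl 7 _:*_
  infixr 8 _:×_
  infix  4 _:≤_ _:<_ _:≈_
  infixr 2 _⟹_

  data Expr (n : ℕ) : Set where
    var            : Fin n → Expr n
    :0 :1          : Expr n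
    _:+_ _:-_ _:*_ : Expr n → Expr n → Expr n
    :-_            : Expr n → Expr n
    _:×_           : ℕ → Expr n → Expr n

  data Formula (n : ℕ) : Set where
    _:≤_ _:<_ _:≈_ : Expr n → Expr n → Formula n
    _⟹_            : Formula n → Formula n → Formula n
    :⊥             : Formula n

  Monomial : ℕ → Set
  Monomial n = List (Fin n)

  Polynomial : ℕ → Set
  Polynomial n = List (ℤ × Monomial n)

  data Sign : Set where
    =0 ≥0 >0 : Sign

  -- A row (s , p) asserts p = 0, p ≥ 0 or p > 0 according to s.
  Row : ℕ → Set
  Row n = Sign × Polynomial n

  -- The sign of a sum. Two equations get only `≥0`, which loses nothing: rows are added in this way
  -- only to eliminate a monomial that occurs in no equation.
  _⊔ˢ_ : Sign → Sign → Sign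
  >0 ⊔ˢ _   = >0
  _   ⊔ˢ >0 = >0
  _   ⊔ˢ _   = ≥0

  module _ {n : ℕ} where

    insertVar : Fin n → Monomial n → Monomial n
    insertVar i []      = i ∷ []
    insertVar i (j ∷ m) = if toℕ i ℕ.≤ᵇ toℕ j then i ∷ j ∷ m else j ∷ insertVar i m

    infixl 7 _*ᵐ_

    _*ᵐ_ : Monomial n → Monomial n → Monomial n
    []      *ᵐ m = m
    (i ∷ l) *ᵐ m = insertVar i (l *ᵐ m)

    _≟ᵐ_ : (l m : Monomial n) → Dec (l ≡ m)
    _≟ᵐ_ = List.≡-dec Fin._≟_

    cons : ℤ → Monomial n → Polynomial n → Polynomial n
    cons (+ 0) m p = p
    cons c     m p = (c , m) ∷ p

    addTerm : ℤ → Monomial n → Polynomial n → Polynomial n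
    addTerm c m [] = cons c m []
    addTerm c m ((d , l) ∷ p) with m ≟ᵐ l
    ... | yes _ = cons (c ℤ.+ d) m p
    ... | no  _ = (d , l) ∷ addTerm c m p

    infixl 6 _+ᵖ_
    infixl 7 _*ᵖ_ _·ᵖ_

    _+ᵖ_ : Polynomial n → Polynomial n → Polynomial n
    []            +ᵖ q = q
    ((c , m) ∷ p) +ᵖ q = addTerm c m (p +ᵖ q)

    _·ᵖ_ : ℤ × Monomial n → Polynomial n → Polynomial n
    t       ·ᵖ []            = []
    (c , m) ·ᵖ ((d , l) ∷ p) = (c ℤ.* d , m *ᵐ l) ∷ ((c , m) ·ᵖ p)

    _*ᵖ_ : Polynomial n → Polynomial n → Polynomial n
    []      *ᵖ q = []
    (t ∷ p) *ᵖ q = t ·ᵖ q +ᵖ p *ᵖ q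

    constant : ℤ → Polynomial n
    constant c = cons c [] []

    normalise : Expr n → Polynomial n
    normalise (var i)  = (+ 1 , i ∷ []) ∷ []
    normalise :0       = []
    normalise :1       = constant (+ 1)
    normalise (e :+ f) = normalise e +ᵖ normalise f
    normalise (e :- f) = normalise e +ᵖ constant (-[1+ 0 ]) *ᵖ normalise f
    normalise (e :* f) = normalise e *ᵖ normalise f
    normalise (:- e)   = constant (-[1+ 0 ]) *ᵖ normalise e
    normalise (k :× e) = constant (+ k) *ᵖ normalise e

    coefficient : Monomial n → Polynomial n → ℤ
    coefficient m [] = + 0
    coefficient m ((c , l) ∷ p) with m ≟ᵐ l
    ... | yes _ = c
    ... | no  _ = coefficient m p

    -- The factor of p is j + 1, a positive number, so the sign asserted of p survives the scaling.
    combine : ℕ → ℤ → Polynomial n → Polynomial n → Polynomial n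
    combine j k p q = (+[1+ j ] , []) ·ᵖ p +ᵖ (k , []) ·ᵖ q

    -- Eliminates m by the equation q = 0, in which its coefficient is a.
    substitute : Monomial n → ℤ → Polynomial n → Row n → Row n
    substitute m a q (s , p) with coefficient m p
    ... | + 0 = s , p
    ... | b   with a
    ...   | + 0      = s , p
    ...   | +[1+ i ] = s , combine i (ℤ.- b) p q
    ...   | -[1+ i ] = s , combine i b p q

    findEquation : Monomial n → List (Row n) → List (Polynomial n)
    findEquation m [] = []
    findEquation m ((=0 , p) ∷ rs) with coefficient m p
    ... | + 0 = findEquation m rs
    ... | _   = p ∷ []
    findEquation m (_ ∷ rs) = findEquation m rs

    resolve : Monomial n → Row n → Row n → List (Row n)
    resolve m (s , p) (t , q) with coefficient m p | coefficient m q
    ... | +[1+ i ] | -[1+ j ] = (s ⊔ˢ t , combine j +[1+ i ] p q) ∷ []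
    ... | _        | _        = []

    unaffected : Monomial n → List (Row n) → List (Row n)
    unaffected m [] = []
    unaffected m ((s , p) ∷ rs) with coefficient m p
    ... | + 0 = (s , p) ∷ unaffected m rs
    ... | _   = unaffected m rs

    eliminate : Monomial n → List (Row n) → List (Row n)
    eliminate m rs with findEquation m rs
    ... | q ∷ _ = unaffected m (map (substitute m (coefficient m q) q) rs)
    ... | []    = unaffected m rs ++ concatMap (λ r → concatMap (resolve m r) rs) rs

    refutable : Row n → Bool
    refutable (>0    , [])                = true
    refutable (=0   , (+[1+ _ ] , []) ∷ []) = true
    refutable (_      , (-[1+ _ ] , []) ∷ []) = true
    refutable _                            = false

    -- The empty monomial is left out: once all others are eliminated, only rows of constants remain
    -- for `refutable` to inspect.
    occurring : List (Row n) → List (Monomial n)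
    occurring = foldr (λ r ms → foldr (λ t → add (proj₂ t)) ms (proj₂ r)) []
      where
      add : Monomial n → List (Monomial n) → List (Monomial n)
      add [] ms = ms
      add m  [] = m ∷ []
      add m (l ∷ ms) with m ≟ᵐ l
      ... | yes _ = l ∷ ms
      ... | no  _ = l ∷ add m ms

    inconsistent : List (Row n) → Bool
    inconsistent rs = any refutable (foldr eliminate rs (occurring rs))

    difference : Expr n → Expr n → Polynomial n
    difference e f = normalise (e :- f)

    hypotheses : Formula n → List (Row n)
    hypotheses (e :≤ f) = (≥0 , difference f e) ∷ []
    hypotheses (e :< f) = (>0    , difference f e) ∷ []
    hypotheses (e :≈ f) = (=0   , difference f e) ∷ []
    hypotheses (_ ⟹ _)  = []
    hypotheses :⊥       = []

    -- The negated goal is refuted together with the hypotheses. The negation of an equation is a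
    -- disjunction of two strict inequalities, hence the two refutations.
    provable : List (Row n) → Formula n → Bool
    provable rs (e :≤ f) = inconsistent ((>0    , difference e f) ∷ rs)
    provable rs (e :< f) = inconsistent ((≥0 , difference e f) ∷ rs)
    provable rs (e :≈ f) = inconsistent ((>0    , difference e f) ∷ rs)
                         ∧ inconsistent ((>0    , difference f e) ∷ rs)
    provable rs (φ ⟹ ψ)  = provable (hypotheses φ ++ rs) ψ
    provable rs :⊥       = inconsistent rs

  close : ∀ n → N-ary n (Expr n) (Formula n) → Formula n
  close n φ = φ $ⁿ Vec.map var (Vec.allFin n)

open LinearArithmetic
  using (:0; :1; _:+_; _:-_; _:*_; :-_; _:×_; _:≤_; _:<_; _:≈_; _⟹_; :⊥)

-- Soundness of the linear arithmetic in an ordered field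

module OrderedField (ℝ : CompleteOrderedField) (lem : ExcludedMiddle 0ℓ) where

  open CompleteOrderedField ℝ public hiding (zero)
  open LinearArithmetic
  module ≤ = IsTotalOrder isTotalOrder
  open RingProperties ring
  open Mult semiring public using () renaming (_×_ to _·_)
  open Mult semiring using (×-homo-+; ×1-homo-*; ×-congʳ; ×-assoc-*)

  ≤-resp-≈ : ∀ {a b c d} → a ≈ b → c ≈ d → a ≤ c → b ≤ d
  ≤-resp-≈ a≈b c≈d a≤c = ≤.trans (≤.reflexive (sym a≈b)) (≤.trans a≤c (≤.reflexive c≈d))

  ≰⇒> : ∀ {a b} → ¬ (a ≤ b) → b < a
  ≰⇒> {a} {b} a≰b with ≤.total a b
  ... | inj₁ a≤b = ⊥-elim (a≰b a≤b)
  ... | inj₂ b≤a = b≤a , λ b≈a → a≰b (≤.reflexive (sym b≈a))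

  ≮⇒≥ : ∀ {a b} → ¬ (a < b) → b ≤ a
  ≮⇒≥ {a} {b} a≮b = decidable-stable lem (a≮b ∘ ≰⇒>)

  private
    0<ᵒ0 : ¬ (0# < 0#)
    0<ᵒ0 (_ , 0≉0) = 0≉0 refl

    <-resp-≈ : ∀ {a b} → a ≈ b → 0# < a → 0# < b
    <-resp-≈ a≈b (0≤a , 0≉a) = ≤-resp-≈ refl a≈b 0≤a , λ 0≈b → 0≉a (trans 0≈b (sym a≈b))

    +-nonneg : ∀ {a b} → 0# ≤ a → 0# ≤ b → 0# ≤ a + b
    +-nonneg {a} {b} 0≤a 0≤b =
      ≤.trans 0≤b (≤-resp-≈ (+-identityˡ b) refl (+-monoˡ-≤ b 0≤a))

    +-pos : ∀ {a b} → 0# < a → 0# ≤ b → 0# < a + b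
    +-pos {a} {b} (0≤a , 0≉a) 0≤b = +-nonneg 0≤a 0≤b , λ 0≈a+b →
      0≉a (≤.antisym 0≤a (≤-resp-≈ (+-identityˡ a) (trans (+-comm b a) (sym 0≈a+b)) (+-monoˡ-≤ a 0≤b)))

    0≤1 : 0# ≤ 1#
    0≤1 with ≤.total 0# 1#
    ... | inj₁ 0≤1 = 0≤1
    ... | inj₂ 1≤0 = ≤-resp-≈ refl (trans (-1*x≈-x (- 1#)) (-‿involutive 1#)) (*-nonNeg 0≤-1 0≤-1)
      where
      0≤-1 : 0# ≤ - 1#
      0≤-1 = ≤-resp-≈ (-‿inverseʳ 1#) (+-identityˡ (- 1#)) (+-monoˡ-≤ (- 1#) 1≤0)

    0<1 : 0# < 1#
    0<1 = 0≤1 , λ 0≈1 → 1≉0 (sym 0≈1)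

  *-pos : ∀ {a b} → 0# < a → 0# < b → 0# < a * b
  *-pos {a} {b} (0≤a , 0≉a) (0≤b , 0≉b) = *-nonNeg 0≤a 0≤b , λ 0≈ab →
    let (b⁻¹ , bb⁻¹≈1) = inverse b (0≉b ∘ sym) in
    0≉a (sym (begin
      a              ≈⟨ *-identityʳ a ⟨
      a * 1#         ≈⟨ *-congˡ bb⁻¹≈1 ⟨
      a * (b * b⁻¹)  ≈⟨ *-assoc a b b⁻¹ ⟨
      a * b * b⁻¹    ≈⟨ *-congʳ 0≈ab ⟨
      0# * b⁻¹       ≈⟨ zeroˡ b⁻¹ ⟩
      0#             ∎))
    where open ≈-Reasoning setoid

  private
    difference-≤ : ∀ {a b} → a ≤ b → 0# ≤ b - a
    difference-≤ {a} {b} a≤b = ≤-resp-≈ (-‿inverseʳ a) refl (+-monoˡ-≤ (- a) a≤b)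

    difference-< : ∀ {a b} → a < b → 0# < b - a
    difference-< {a} {b} (a≤b , a≉b) =
      difference-≤ a≤b , λ 0≈b-a → a≉b (sym (x∙y⁻¹≈ε⇒x≈y b a (sym 0≈b-a)))

    ι : ℤ → Carrier
    ι (+ n)    = n · 1#
    ι -[1+ n ] = - (suc n · 1#)

    open ≈-Reasoning setoid

    ι-⊖ : ∀ m n → ι (m ℤ.⊖ n) ≈ m · 1# - n · 1#
    ι-⊖ m       zero    = sym (trans (+-congˡ -0#≈0#) (+-identityʳ _))
    ι-⊖ zero    (suc n) = sym (+-identityˡ _)
    ι-⊖ (suc m) (suc n) = begin
      ι (suc m ℤ.⊖ suc n)                ≡⟨ ≡.cong ι (ℤ.[1+m]⊖[1+n]≡m⊖n m n) ⟩
      ι (m ℤ.⊖ n)                        ≈⟨ ι-⊖ m n ⟩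
      m · 1# - n · 1#                    ≈⟨ +-congˡ (+-identityˡ _) ⟨
      m · 1# + (0# - n · 1#)             ≈⟨ +-congˡ (+-congʳ (-‿inverseʳ 1#)) ⟨
      m · 1# + (1# - 1# - n · 1#)        ≈⟨ +-congˡ (trans (+-assoc _ _ _) (+-congˡ (-‿+-comm 1# _))) ⟩
      m · 1# + (1# - suc n · 1#)         ≈⟨ +-assoc _ _ _ ⟨
      m · 1# + 1# - suc n · 1#           ≈⟨ +-congʳ (+-comm _ _) ⟩
      suc m · 1# - suc n · 1#            ∎

    ι-+ : ∀ i j → ι (i ℤ.+ j) ≈ ι i + ι j
    ι-+ (+ m)    (+ n)    = ×-homo-+ 1# m n
    ι-+ (+ m)    -[1+ n ] = ι-⊖ m (suc n)
    ι-+ -[1+ m ] (+ n)    = trans (ι-⊖ n (suc m)) (+-comm _ _)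
    ι-+ -[1+ m ] -[1+ n ] = begin
      - (suc (suc (m ℕ.+ n)) · 1#)      ≡⟨ ≡.cong (λ k → - (suc k · 1#)) (≡.sym (ℕ.+-suc m n)) ⟩
      - ((suc m ℕ.+ suc n) · 1#)        ≈⟨ -‿cong (×-homo-+ 1# (suc m) (suc n)) ⟩
      - (suc m · 1# + suc n · 1#)       ≈⟨ -‿+-comm _ _ ⟨
      - (suc m · 1#) - suc n · 1#       ∎

    ι-neg : ∀ i → ι (ℤ.- i) ≈ - ι i
    ι-neg (+ zero)  = sym -0#≈0#
    ι-neg +[1+ n ]  = refl
    ι-neg -[1+ n ]  = sym (-‿involutive _)

    +ι-* : ∀ m j → ι (+ m ℤ.* j) ≈ ι (+ m) * ι j
    +ι-* m (+ n) = trans (reflexive (≡.cong ι (≡.sym (ℤ.pos-* m n)))) (×1-homo-* m n)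
    +ι-* m -[1+ n ] = begin
      ι (+ m ℤ.* ℤ.- +[1+ n ])          ≡⟨ ≡.cong ι (≡.sym (ℤ.neg-distribʳ-* (+ m) +[1+ n ])) ⟩
      ι (ℤ.- (+ m ℤ.* +[1+ n ]))        ≈⟨ ι-neg (+ m ℤ.* +[1+ n ]) ⟩
      - ι (+ m ℤ.* +[1+ n ])            ≈⟨ -‿cong
        (trans (reflexive (≡.cong ι (≡.sym (ℤ.pos-* m (suc n))))) (×1-homo-* m (suc n))) ⟩
      - (m · 1# * suc n · 1#)           ≈⟨ -‿distribʳ-* _ _ ⟩
      m · 1# * - (suc n · 1#)           ∎

    ι-* : ∀ i j → ι (i ℤ.* j) ≈ ι i * ι j
    ι-* (+ m)    j = +ι-* m j
    ι-* -[1+ m ] j = begin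
      ι (ℤ.- +[1+ m ] ℤ.* j)            ≡⟨ ≡.cong ι (≡.sym (ℤ.neg-distribˡ-* +[1+ m ] j)) ⟩
      ι (ℤ.- (+[1+ m ] ℤ.* j))          ≈⟨ ι-neg (+[1+ m ] ℤ.* j) ⟩
      - ι (+[1+ m ] ℤ.* j)              ≈⟨ -‿cong (+ι-* (suc m) j) ⟩
      - (suc m · 1# * ι j)              ≈⟨ -‿distribˡ-* _ _ ⟩
      - (suc m · 1#) * ι j              ∎

    0≤ι : ∀ n → 0# ≤ n · 1#
    0≤ι zero    = ≤.refl
    0≤ι (suc n) = +-nonneg 0≤1 (0≤ι n)

    0<ι : ∀ n → 0# < suc n · 1#
    0<ι n = +-pos 0<1 (0≤ι n)

  ⟦_⟧ᵉ : ∀ {n} → Expr n → Vec Carrier n → Carrier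
  ⟦ var i  ⟧ᵉ ρ = lookup ρ i
  ⟦ :0     ⟧ᵉ ρ = 0#
  ⟦ :1     ⟧ᵉ ρ = 1#
  ⟦ e :+ f ⟧ᵉ ρ = ⟦ e ⟧ᵉ ρ + ⟦ f ⟧ᵉ ρ
  ⟦ e :- f ⟧ᵉ ρ = ⟦ e ⟧ᵉ ρ - ⟦ f ⟧ᵉ ρ
  ⟦ e :* f ⟧ᵉ ρ = ⟦ e ⟧ᵉ ρ * ⟦ f ⟧ᵉ ρ
  ⟦ :- e   ⟧ᵉ ρ = - ⟦ e ⟧ᵉ ρ
  ⟦ k :× e ⟧ᵉ ρ = k · ⟦ e ⟧ᵉ ρ

  ⟦_⟧ᶠ : ∀ {n} → Formula n → Vec Carrier n → Set
  ⟦ e :≤ f ⟧ᶠ ρ = ⟦ e ⟧ᵉ ρ ≤ ⟦ f ⟧ᵉ ρ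
  ⟦ e :< f ⟧ᶠ ρ = ⟦ e ⟧ᵉ ρ < ⟦ f ⟧ᵉ ρ
  ⟦ e :≈ f ⟧ᶠ ρ = ⟦ e ⟧ᵉ ρ ≈ ⟦ f ⟧ᵉ ρ
  ⟦ φ ⟹ ψ  ⟧ᶠ ρ = ⟦ φ ⟧ᶠ ρ → ⟦ ψ ⟧ᶠ ρ
  ⟦ :⊥     ⟧ᶠ ρ = ⊥

  private
    module Soundness {n} (ρ : Vec Carrier n) where

      ⟦_⟧ᵐ : Monomial n → Carrier
      ⟦ []    ⟧ᵐ = 1#
      ⟦ i ∷ m ⟧ᵐ = lookup ρ i * ⟦ m ⟧ᵐ

      ⟦_⟧ᵖ : Polynomial n → Carrier
      ⟦ []          ⟧ᵖ = 0#
      ⟦ (c , m) ∷ p ⟧ᵖ = ι c * ⟦ m ⟧ᵐ + ⟦ p ⟧ᵖ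

      insertVar-sound : ∀ i m → ⟦ insertVar i m ⟧ᵐ ≈ lookup ρ i * ⟦ m ⟧ᵐ
      insertVar-sound i []      = refl
      insertVar-sound i (j ∷ m) with toℕ i ℕ.≤ᵇ toℕ j
      ... | true  = refl
      ... | false = begin
        lookup ρ j * ⟦ insertVar i m ⟧ᵐ        ≈⟨ *-congˡ (insertVar-sound i m) ⟩
        lookup ρ j * (lookup ρ i * ⟦ m ⟧ᵐ)     ≈⟨ *-assoc _ _ _ ⟨
        lookup ρ j * lookup ρ i * ⟦ m ⟧ᵐ       ≈⟨ *-congʳ (*-comm _ _) ⟩
        lookup ρ i * lookup ρ j * ⟦ m ⟧ᵐ       ≈⟨ *-assoc _ _ _ ⟩
        lookup ρ i * (lookup ρ j * ⟦ m ⟧ᵐ)     ∎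

      *ᵐ-sound : ∀ l m → ⟦ l *ᵐ m ⟧ᵐ ≈ ⟦ l ⟧ᵐ * ⟦ m ⟧ᵐ
      *ᵐ-sound []      m = sym (*-identityˡ _)
      *ᵐ-sound (i ∷ l) m = trans (insertVar-sound i (l *ᵐ m))
        (trans (*-congˡ (*ᵐ-sound l m)) (sym (*-assoc _ _ _)))

      cons-sound : ∀ c m p → ⟦ cons c m p ⟧ᵖ ≈ ι c * ⟦ m ⟧ᵐ + ⟦ p ⟧ᵖ
      cons-sound (+ zero) m p = sym (trans (+-congʳ (zeroˡ _)) (+-identityˡ _))
      cons-sound +[1+ n ] m p = refl
      cons-sound -[1+ n ] m p = refl

      addTerm-sound : ∀ c m p → ⟦ addTerm c m p ⟧ᵖ ≈ ι c * ⟦ m ⟧ᵐ + ⟦ p ⟧ᵖ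
      addTerm-sound c m [] = cons-sound c m []
      addTerm-sound c m ((d , l) ∷ p) with m ≟ᵐ l
      ... | yes ≡.refl = begin
        ⟦ cons (c ℤ.+ d) m p ⟧ᵖ                       ≈⟨ cons-sound (c ℤ.+ d) m p ⟩
        ι (c ℤ.+ d) * ⟦ m ⟧ᵐ + ⟦ p ⟧ᵖ                 ≈⟨ +-congʳ
          (trans (*-congʳ (ι-+ c d)) (distribʳ _ _ _)) ⟩
        ι c * ⟦ m ⟧ᵐ + ι d * ⟦ m ⟧ᵐ + ⟦ p ⟧ᵖ          ≈⟨ +-assoc _ _ _ ⟩
        ι c * ⟦ m ⟧ᵐ + (ι d * ⟦ m ⟧ᵐ + ⟦ p ⟧ᵖ)        ∎
      ... | no _ = begin
        ι d * ⟦ l ⟧ᵐ + ⟦ addTerm c m p ⟧ᵖ             ≈⟨ +-congˡ (addTerm-sound c m p) ⟩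
        ι d * ⟦ l ⟧ᵐ + (ι c * ⟦ m ⟧ᵐ + ⟦ p ⟧ᵖ)        ≈⟨ +-assoc _ _ _ ⟨
        ι d * ⟦ l ⟧ᵐ + ι c * ⟦ m ⟧ᵐ + ⟦ p ⟧ᵖ          ≈⟨ +-congʳ (+-comm _ _) ⟩
        ι c * ⟦ m ⟧ᵐ + ι d * ⟦ l ⟧ᵐ + ⟦ p ⟧ᵖ          ≈⟨ +-assoc _ _ _ ⟩
        ι c * ⟦ m ⟧ᵐ + (ι d * ⟦ l ⟧ᵐ + ⟦ p ⟧ᵖ)        ∎

      +ᵖ-sound : ∀ p q → ⟦ p +ᵖ q ⟧ᵖ ≈ ⟦ p ⟧ᵖ + ⟦ q ⟧ᵖ
      +ᵖ-sound []            q = sym (+-identityˡ _)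
      +ᵖ-sound ((c , m) ∷ p) q = trans (addTerm-sound c m (p +ᵖ q))
        (trans (+-congˡ (+ᵖ-sound p q)) (sym (+-assoc _ _ _)))

      *-interchange : ∀ a b c d → (a * b) * (c * d) ≈ (a * c) * (b * d)
      *-interchange a b c d = begin
        (a * b) * (c * d)  ≈⟨ *-assoc _ _ _ ⟩
        a * (b * (c * d))  ≈⟨ *-congˡ
          (trans (sym (*-assoc _ _ _)) (trans (*-congʳ (*-comm b c)) (*-assoc _ _ _))) ⟩
        a * (c * (b * d))  ≈⟨ *-assoc _ _ _ ⟨
        (a * c) * (b * d)  ∎

      ·ᵖ-sound : ∀ c m p → ⟦ (c , m) ·ᵖ p ⟧ᵖ ≈ ι c * ⟦ m ⟧ᵐ * ⟦ p ⟧ᵖ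
      ·ᵖ-sound c m []            = sym (zeroʳ _)
      ·ᵖ-sound c m ((d , l) ∷ p) = begin
        ι (c ℤ.* d) * ⟦ m *ᵐ l ⟧ᵐ + ⟦ (c , m) ·ᵖ p ⟧ᵖ
          ≈⟨ +-cong (*-cong (ι-* c d) (*ᵐ-sound m l)) (·ᵖ-sound c m p) ⟩
        (ι c * ι d) * (⟦ m ⟧ᵐ * ⟦ l ⟧ᵐ) + ι c * ⟦ m ⟧ᵐ * ⟦ p ⟧ᵖ
          ≈⟨ +-congʳ (*-interchange _ _ _ _) ⟩
        (ι c * ⟦ m ⟧ᵐ) * (ι d * ⟦ l ⟧ᵐ) + ι c * ⟦ m ⟧ᵐ * ⟦ p ⟧ᵖ
          ≈⟨ distribˡ _ _ _ ⟨
        ι c * ⟦ m ⟧ᵐ * (ι d * ⟦ l ⟧ᵐ + ⟦ p ⟧ᵖ) ∎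

      *ᵖ-sound : ∀ p q → ⟦ p *ᵖ q ⟧ᵖ ≈ ⟦ p ⟧ᵖ * ⟦ q ⟧ᵖ
      *ᵖ-sound []            q = sym (zeroˡ _)
      *ᵖ-sound ((c , m) ∷ p) q = trans (+ᵖ-sound ((c , m) ·ᵖ q) (p *ᵖ q))
        (trans (+-cong (·ᵖ-sound c m q) (*ᵖ-sound p q)) (sym (distribʳ _ _ _)))

      constant-sound : ∀ c → ⟦ constant c ⟧ᵖ ≈ ι c
      constant-sound c = trans (cons-sound c [] []) (trans (+-identityʳ _) (*-identityʳ _))

      constant-*ᵖ-sound : ∀ c q → ⟦ constant c *ᵖ q ⟧ᵖ ≈ ι c * ⟦ q ⟧ᵖ
      constant-*ᵖ-sound c q = trans (*ᵖ-sound (constant c) q) (*-congʳ (constant-sound c))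

      neg-sound : ∀ q → ⟦ constant -[1+ 0 ] *ᵖ q ⟧ᵖ ≈ - ⟦ q ⟧ᵖ
      neg-sound q = trans (constant-*ᵖ-sound -[1+ 0 ] q)
        (trans (*-congʳ (-‿cong (+-identityʳ 1#))) (-1*x≈-x _))

      normalise-sound : ∀ e → ⟦ normalise e ⟧ᵖ ≈ ⟦ e ⟧ᵉ ρ
      normalise-sound (var i)  =
        trans (+-identityʳ _) (trans (*-cong (+-identityʳ 1#) (*-identityʳ _)) (*-identityˡ _))
      normalise-sound :0       = refl
      normalise-sound :1       = trans (constant-sound (+ 1)) (+-identityʳ 1#)
      normalise-sound (e :+ f) = trans (+ᵖ-sound (normalise e) (normalise f))
        (+-cong (normalise-sound e) (normalise-sound f))
      normalise-sound (e :- f) = trans (+ᵖ-sound (normalise e) _)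
        (+-cong (normalise-sound e) (trans (neg-sound (normalise f)) (-‿cong (normalise-sound f))))
      normalise-sound (e :* f) = trans (*ᵖ-sound (normalise e) (normalise f))
        (*-cong (normalise-sound e) (normalise-sound f))
      normalise-sound (:- e)   = trans (neg-sound (normalise e)) (-‿cong (normalise-sound e))
      normalise-sound (k :× e) = begin
        ⟦ constant (+ k) *ᵖ normalise e ⟧ᵖ  ≈⟨ constant-*ᵖ-sound (+ k) (normalise e) ⟩
        k · 1# * ⟦ normalise e ⟧ᵖ           ≈⟨ *-congˡ (normalise-sound e) ⟩
        k · 1# * ⟦ e ⟧ᵉ ρ                   ≈⟨ ×-assoc-* k _ _ ⟩
        k · (1# * ⟦ e ⟧ᵉ ρ)                 ≈⟨ ×-congʳ k (*-identityˡ _) ⟩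
        k · ⟦ e ⟧ᵉ ρ                        ∎

      HasSign : Sign → Carrier → Set
      HasSign =0   a = 0# ≈ a
      HasSign ≥0 a = 0# ≤ a
      HasSign >0    a = 0# < a

      Holds : Row n → Set
      Holds (s , p) = HasSign s ⟦ p ⟧ᵖ

      HasSign-resp : ∀ s {a b} → a ≈ b → HasSign s a → HasSign s b
      HasSign-resp =0   a≈b h = trans h a≈b
      HasSign-resp ≥0 a≈b h = ≤-resp-≈ refl a≈b h
      HasSign-resp >0    a≈b h = <-resp-≈ a≈b h

      combine-sound : ∀ i k p q → ⟦ combine i k p q ⟧ᵖ ≈ suc i · 1# * ⟦ p ⟧ᵖ + ι k * ⟦ q ⟧ᵖ
      combine-sound i k p q = trans (+ᵖ-sound ((+[1+ i ] , []) ·ᵖ p) ((k , []) ·ᵖ q))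
        (+-cong (trans (·ᵖ-sound +[1+ i ] [] p) (*-congʳ (*-identityʳ _)))
                (trans (·ᵖ-sound k [] q) (*-congʳ (*-identityʳ _))))

      scale : ∀ s i {a} → HasSign s a → HasSign s (suc i · 1# * a)
      scale =0   i h = trans (sym (zeroʳ _)) (*-congˡ h)
      scale ≥0 i h = *-nonNeg (0≤ι (suc i)) h
      scale >0    i h = *-pos (0<ι i) h

      nonneg-weaken : ∀ s {a} → HasSign s a → 0# ≤ a
      nonneg-weaken =0   h = ≤.reflexive h
      nonneg-weaken ≥0 h = h
      nonneg-weaken >0    h = proj₁ h

      ⊔ˢ-sound : ∀ s t {a b} → HasSign s a → HasSign t b → HasSign (s ⊔ˢ t) (a + b)
      ⊔ˢ-sound >0    t      h h′ = +-pos h (nonneg-weaken t h′)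
      ⊔ˢ-sound =0   >0    h h′ = <-resp-≈ (+-comm _ _) (+-pos h′ (≤.reflexive h))
      ⊔ˢ-sound ≥0 >0    h h′ = <-resp-≈ (+-comm _ _) (+-pos h′ h)
      ⊔ˢ-sound =0   =0   h h′ = +-nonneg (≤.reflexive h) (≤.reflexive h′)
      ⊔ˢ-sound =0   ≥0 h h′ = +-nonneg (≤.reflexive h) h′
      ⊔ˢ-sound ≥0 =0   h h′ = +-nonneg h (≤.reflexive h′)
      ⊔ˢ-sound ≥0 ≥0 h h′ = +-nonneg h h′

      add-equation : ∀ s i k p q → HasSign s ⟦ p ⟧ᵖ → 0# ≈ ⟦ q ⟧ᵖ → Holds (s , combine i k p q)
      add-equation s i k p q h 0≈q = HasSign-resp s (sym (begin
        ⟦ combine i k p q ⟧ᵖ                     ≈⟨ combine-sound i k p q ⟩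
        suc i · 1# * ⟦ p ⟧ᵖ + ι k * ⟦ q ⟧ᵖ       ≈⟨ +-congˡ (trans (*-congˡ (sym 0≈q)) (zeroʳ _)) ⟩
        suc i · 1# * ⟦ p ⟧ᵖ + 0#                 ≈⟨ +-identityʳ _ ⟩
        suc i · 1# * ⟦ p ⟧ᵖ                      ∎)) (scale s i h)

      substitute-sound : ∀ m a q → 0# ≈ ⟦ q ⟧ᵖ → ∀ r → Holds r → Holds (substitute m a q r)
      substitute-sound m a q 0≈q (s , p) h with coefficient m p
      ... | + zero = h
      ... | b@(+[1+ _ ]) with a
      ...   | + zero    = h
      ...   | +[1+ i ] = add-equation s i (ℤ.- b) p q h 0≈q
      ...   | -[1+ i ] = add-equation s i b p q h 0≈q
      substitute-sound m a q 0≈q (s , p) h | b@(-[1+ _ ]) with a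
      ...   | + zero    = h
      ...   | +[1+ i ] = add-equation s i (ℤ.- b) p q h 0≈q
      ...   | -[1+ i ] = add-equation s i b p q h 0≈q

      findEquation-sound : ∀ m {rs} → All Holds rs → All (λ q → 0# ≈ ⟦ q ⟧ᵖ) (findEquation m rs)
      findEquation-sound m {[]} [] = []
      findEquation-sound m {(=0 , p) ∷ rs} (h ∷ hs) with coefficient m p
      ... | + zero   = findEquation-sound m hs
      ... | +[1+ _ ] = h ∷ []
      ... | -[1+ _ ] = h ∷ []
      findEquation-sound m {(≥0 , p) ∷ rs} (h ∷ hs) = findEquation-sound m hs
      findEquation-sound m {(>0 , p) ∷ rs}    (h ∷ hs) = findEquation-sound m hs

      resolve-sound : ∀ m r r′ → Holds r → Holds r′ → All Holds (resolve m r r′)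
      resolve-sound m (s , p) (t , q) h h′ with coefficient m p | coefficient m q
      ... | + zero   | _        = []
      ... | -[1+ _ ] | _        = []
      ... | +[1+ i ] | + _      = []
      ... | +[1+ i ] | -[1+ j ] = HasSign-resp (s ⊔ˢ t) (sym (combine-sound j +[1+ i ] p q))
        (⊔ˢ-sound s t (scale s j h) (scale t i h′)) ∷ []

      unaffected-sound : ∀ m {rs} → All Holds rs → All Holds (unaffected m rs)
      unaffected-sound m {[]} [] = []
      unaffected-sound m {(s , p) ∷ rs} (h ∷ hs) with coefficient m p
      ... | + zero   = h ∷ unaffected-sound m hs
      ... | +[1+ _ ] = unaffected-sound m hs
      ... | -[1+ _ ] = unaffected-sound m hs

      eliminate-sound : ∀ m {rs} → All Holds rs → All Holds (eliminate m rs)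
      eliminate-sound m {rs} hs with findEquation m rs | findEquation-sound m hs
      ... | q ∷ _ | 0≈q ∷ _ =
        unaffected-sound m (All.map⁺
        (All.map (λ {r} → substitute-sound m (coefficient m q) q 0≈q r) hs))
      ... | []    | []      = All.++⁺ (unaffected-sound m hs)
        (All.concat⁺ (All.map⁺
          (All.map (λ {r} h → All.concat⁺ (All.map⁺ (All.map (λ {r′} → resolve-sound m r r′ h) hs)))
          hs)))

      refutable-sound : ∀ r → T (refutable r) → ¬ Holds r
      refutable-sound (>0 , []) _ h = 0<ᵒ0 h
      refutable-sound (=0 , (+[1+ i ] , []) ∷ []) _ h =
        proj₂ (0<ι i) (trans h (trans (+-identityʳ _) (*-identityʳ _)))
      refutable-sound (s , (-[1+ i ] , []) ∷ []) t h = 0<ᵒ0 (<-resp-≈ (-‿inverseʳ _) (+-pos (0<ι i)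
        (≤-resp-≈ refl (trans (+-identityʳ _) (*-identityʳ _)) (nonneg-weaken s h))))
      refutable-sound (>0 , (+ zero , []) ∷ []) ()
      refutable-sound (≥0 , []) ()

      any-sound : ∀ rs → T (any refutable rs) → ¬ All Holds rs
      any-sound (r ∷ rs) t (h ∷ hs) with refutable r in eq
      ... | true  = refutable-sound r (≡.subst T (≡.sym eq) tt) h
      ... | false = any-sound rs t hs

      inconsistent-sound : ∀ rs → T (inconsistent rs) → ¬ All Holds rs
      inconsistent-sound rs t hs = any-sound _ t (go (occurring rs))
        where
        go : ∀ ms → All Holds (foldr eliminate rs ms)
        go []       = hs
        go (m ∷ ms) = eliminate-sound m (go ms)

      difference-sound : ∀ e f → ⟦ e ⟧ᵉ ρ - ⟦ f ⟧ᵉ ρ ≈ ⟦ difference e f ⟧ᵖ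
      difference-sound e f = sym (normalise-sound (e :- f))

      hypotheses-sound : ∀ φ → ⟦ φ ⟧ᶠ ρ → All Holds (hypotheses φ)
      hypotheses-sound (e :≤ f) h = ≤-resp-≈ refl (difference-sound f e) (difference-≤ h) ∷ []
      hypotheses-sound (e :< f) h = <-resp-≈ (difference-sound f e) (difference-< h) ∷ []
      hypotheses-sound (e :≈ f) h =
        trans (sym (-‿inverseʳ _)) (trans (+-congʳ h) (difference-sound f e)) ∷ []
      hypotheses-sound (_ ⟹ _)  _ = []
      hypotheses-sound :⊥       _ = []

      refute-> : ∀ e f rs → T (inconsistent ((>0 , difference e f) ∷ rs)) → All Holds rs →
        ⟦ e ⟧ᵉ ρ ≤ ⟦ f ⟧ᵉ ρ
      refute-> e f rs t hs = ≮⇒≥ λ f<e →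
        inconsistent-sound ((>0 , difference e f) ∷ rs) t
          (<-resp-≈ (difference-sound e f) (difference-< f<e) ∷ hs)

      provable-sound : ∀ rs φ → T (provable rs φ) → All Holds rs → ⟦ φ ⟧ᶠ ρ
      provable-sound rs (e :≤ f) t hs = refute-> e f rs t hs
      provable-sound rs (e :< f) t hs = ≰⇒> λ f≤e →
        inconsistent-sound ((≥0 , difference e f) ∷ rs) t
          (≤-resp-≈ refl (difference-sound e f) (difference-≤ f≤e) ∷ hs)
      provable-sound rs (e :≈ f) t hs = case (Equivalence.to T-∧ t) of λ (t₁ , t₂) →
        ≤.antisym (refute-> e f rs t₁ hs) (refute-> f e rs t₂ hs)
      provable-sound rs (φ ⟹ ψ) t hs = λ h →
        provable-sound _ ψ t (All.++⁺ (hypotheses-sound φ h) hs)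
      provable-sound rs :⊥ t hs = inconsistent-sound rs t hs

  -- Proof by reflection. When the search succeeds, the implicit argument is of the unit type and
  -- fills itself in; the values of the variables are hidden too and are read off from the premises
  -- and the goal.
  linarith : ∀ n (φ : N-ary n (Expr n) (Formula n)) → {T (provable [] (close n φ))} →
             ∀ⁿʰ n (curryⁿ ⟦ close n φ ⟧ᶠ)
  linarith n φ {t} = curryʰ n λ ρ → Soundness.provable-sound ρ [] (close n φ) t []
    where
    curryʰ : ∀ m {P : Vec Carrier m → Set} → (∀ ρ → P ρ) → ∀ⁿʰ m (curryⁿ P)
    curryʰ zero    f = f Vec.[]
    curryʰ (suc m) f = curryʰ m (λ ρ → f (_ Vec.∷ ρ))

-- Consequences of completeness: suprema, intermediate values, minima

module Analysis (ℝ : CompleteOrderedField) (lem : ExcludedMiddle 0ℓ) where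

  open OrderedField ℝ lem public

  min-cases : ∀ a b → (a ≤ b × min a b ≈ a) ⊎ (b ≤ a × min a b ≈ b)
  min-cases a b = Sum.map
    (λ a≤b → a≤b , Min.x≤y⇒x⊓y≈x totalOrder a≤b)
    (λ b≤a → b≤a , Min.x≤y⇒y⊓x≈x totalOrder b≤a)
    (≤.total a b)

  max-cases : ∀ a b → (a ≤ b × max a b ≈ b) ⊎ (b ≤ a × max a b ≈ a)
  max-cases a b = Sum.map
    (λ a≤b → a≤b , Max.x≤y⇒x⊔y≈y totalOrder a≤b)
    (λ b≤a → b≤a , Max.x≤y⇒y⊔x≈y totalOrder b≤a)
    (≤.total a b)

  <⇒≤ : ∀ {a b} → a < b → a ≤ b
  <⇒≤ = proj₁

  ≤-or-> : ∀ a b → a ≤ b ⊎ b < a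
  ≤-or-> a b with lem {a ≤ b}
  ... | yes a≤b = inj₁ a≤b
  ... | no  a≰b = inj₂ (≰⇒> a≰b)

  ∣∣-nonneg : ∀ {a} → 0# ≤ a → ∣ a ∣ ≈ a
  ∣∣-nonneg {a} 0≤a with max-cases a (- a)
  ... | inj₁ (a≤-a , ∣a∣≈-a) =
    linarith 2 (λ a m → :0 :≤ a ⟹ a :≤ :- a ⟹ m :≈ :- a ⟹ m :≈ a) 0≤a a≤-a ∣a∣≈-a
  ... | inj₂ (_ , ∣a∣≈a)     = ∣a∣≈a

  ∣∣-nonpos : ∀ {a} → a ≤ 0# → ∣ a ∣ ≈ - a
  ∣∣-nonpos {a} a≤0 with max-cases a (- a)
  ... | inj₁ (_ , ∣a∣≈-a)    = ∣a∣≈-a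
  ... | inj₂ (-a≤a , ∣a∣≈a) =
    linarith 2 (λ a m → a :≤ :0 ⟹ :- a :≤ a ⟹ m :≈ a ⟹ m :≈ :- a) a≤0 -a≤a ∣a∣≈a

  square-nonneg : ∀ a → 0# ≤ a * a
  square-nonneg a with ≤.total 0# a
  ... | inj₁ 0≤a = *-nonNeg 0≤a 0≤a
  ... | inj₂ a≤0 = linarith 1 (λ a → :0 :≤ (:- a) :* (:- a) ⟹ :0 :≤ a :* a)
    (*-nonNeg 0≤-a 0≤-a)
    where
    0≤-a : 0# ≤ - a
    0≤-a = linarith 1 (λ a → a :≤ :0 ⟹ :0 :≤ :- a) a≤0

  square-reflects-≤ : ∀ {a b} → 0# ≤ b → a * a ≤ b * b → a ≤ b
  square-reflects-≤ {a} {b} 0≤b a²≤b² with ≤-or-> a b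
  ... | inj₁ a≤b = a≤b
  -- If b < a then a² - b² = (a - b)² + 2b (a - b) is positive.
  ... | inj₂ b<a = ⊥-elim (linarith 2 (λ a b → :0 :≤ b ⟹ b :< a ⟹ a :* a :≤ b :* b ⟹
      :0 :< (a :- b) :* (a :- b) ⟹ :0 :≤ b :* (a :- b) ⟹ :⊥)
    0≤b b<a a²≤b² (*-pos 0<a-b 0<a-b) (*-nonNeg 0≤b (<⇒≤ 0<a-b)))
    where
    0<a-b : 0# < a - b
    0<a-b = linarith 2 (λ a b → b :< a ⟹ :0 :< a :- b) b<a

  *-cancel-pos-≤ : ∀ {a b c} → 0# < c → a * c ≤ b * c → a ≤ b
  *-cancel-pos-≤ {a} {b} {c} 0<c ac≤bc with ≤-or-> a b
  ... | inj₁ a≤b = a≤b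
  ... | inj₂ b<a = ⊥-elim (linarith 3 (λ a b c → :0 :< (a :- b) :* c ⟹ a :* c :≤ b :* c ⟹ :⊥)
    (*-pos (linarith 2 (λ a b → b :< a ⟹ :0 :< a :- b) b<a) 0<c) ac≤bc)

  quotient : ∀ a {b} → 0# < b → ∃ λ q → q * b ≈ a
  quotient a {b} (_ , 0≉b) = let (b⁻¹ , bb⁻¹≈1) = inverse b (0≉b ∘ sym) in
    a * b⁻¹ , trans (*-assoc a b⁻¹ b) (trans (*-congˡ (trans (*-comm b⁻¹ b) bb⁻¹≈1)) (*-identityʳ a))

  quotient-pos : ∀ {q a b} → 0# < b → 0# < a → q * b ≈ a → 0# < q
  quotient-pos {q} {a} {b} 0<b 0<a qb≈a = ≰⇒> λ q≤0 →
    linarith 3 (λ q a b → :0 :≤ (:- q) :* b ⟹ :0 :< a ⟹ q :* b :≈ a ⟹ :⊥)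
      (*-nonNeg (linarith 1 (λ q → q :≤ :0 ⟹ :0 :≤ :- q) q≤0) (<⇒≤ 0<b)) 0<a qb≈a

  -- Indexed by the predecessor of the denominator: `fraction 1` halves and `fraction 5` divides by
  -- six.
  fraction : ∀ n a → ∃ λ q → suc n · q ≈ a
  fraction n a = let (q , q*n≈a) = quotient a (positive n) in
    q , trans (sym (times n q)) q*n≈a
    where
    positive : ∀ n → 0# < suc n · 1#
    positive zero    = linarith 0 (:0 :< 1 :× :1)
    positive (suc n) = linarith 1 (λ k → :0 :< k ⟹ :0 :< :1 :+ k) (positive n)

    times : ∀ n q → q * (suc n · 1#) ≈ suc n · q
    times n q = trans (Mult.×-comm-* semiring (suc n) q 1#)
      (Mult.×-congʳ semiring (suc n) (*-identityʳ q))

  smaller : ∀ {a b} → 0# < a → 0# < b → ∃ λ ε → 0# < ε × ε ≤ a × ε ≤ b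
  smaller {a} {b} 0<a 0<b with ≤.total a b
  ... | inj₁ a≤b = a , 0<a , ≤.refl , a≤b
  ... | inj₂ b≤a = b , 0<b , b≤a , ≤.refl

  lub-approximation : ∀ {P s ε} → LeastUpperBound P s → 0# < ε → ∃ λ x → P x × s - ε < x
  lub-approximation {P} {s} {ε} (_ , least) 0<ε with lem {∃ λ x → P x × s - ε < x}
  ... | yes found = found
  ... | no  none  = ⊥-elim (linarith 2 (λ s ε → s :≤ s :- ε ⟹ :0 :< ε ⟹ :⊥)
    (least (s - ε) λ x Px → ≮⇒≥ λ s-ε<x → none (x , Px , s-ε<x)) 0<ε)

  sup-lub : ∀ {P} → ∃ P → ∃ (UpperBound P) → LeastUpperBound P (sup lem P)
  sup-lub {P} inhabited bounded with lem {∃ (LeastUpperBound P)}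
  ... | yes (_ , lub) = lub
  ... | no  none      = ⊥-elim (none (complete P inhabited bounded))

  -- Here k is the supremum of the points where f is at most τ. The bound on the growth of f serves
  -- on both sides: f cannot have jumped above τ from the points just before k, and if it were still
  -- below τ at k it would remain so a little further on. The rate 2 is that of `arc-slope`.
  intermediateValue : ∀ (f : Carrier → Carrier) {α β τ} → α ≤ β →
    (∀ {k l} → α ≤ k → k ≤ l → l ≤ β → f l - f k ≤ 2 · (l - k)) →
    f α ≤ τ → τ ≤ f β → ∃ λ k → α ≤ k × k ≤ β × f k ≈ τ
  intermediateValue f {α} {β} {τ} α≤β lipschitz fα≤τ τ≤fβ =
    k , α≤k , k≤β , ≤.antisym (≮⇒≥ not-above) (≮⇒≥ not-below)
    where
    P : Pred Carrier 0ℓ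
    P k = α ≤ k × k ≤ β × f k ≤ τ

    lub : ∃ (LeastUpperBound P)
    lub = complete P (α , ≤.refl , α≤β , fα≤τ) (β , λ _ (_ , k≤β , _) → k≤β)

    k : Carrier
    k = proj₁ lub

    α≤k : α ≤ k
    α≤k = proj₁ (proj₂ lub) α (≤.refl , α≤β , fα≤τ)

    k≤β : k ≤ β
    k≤β = proj₂ (proj₂ lub) β λ _ (_ , k≤β , _) → k≤β

    not-above : ¬ (τ < f k)
    not-above τ<fk = let
      (ε , 2ε≈fk-τ)                 = fraction 1 (f k - τ)
      (x , (α≤x , x≤β , fx≤τ) , k-ε<x) = lub-approximation (proj₂ lub)
        (linarith 3 (λ ε f t → 2 :× ε :≈ f :- t ⟹ t :< f ⟹ :0 :< ε) 2ε≈fk-τ τ<fk)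
      in linarith 6 (λ fk fx t ε k x → 2 :× ε :≈ fk :- t ⟹ k :- ε :< x ⟹ fx :≤ t ⟹
           fk :- fx :≤ 2 :× (k :- x) ⟹ :⊥)
         2ε≈fk-τ k-ε<x fx≤τ (lipschitz α≤x (proj₁ (proj₂ lub) x (α≤x , x≤β , fx≤τ)) k≤β)

    not-below : ¬ (f k < τ)
    not-below fk<τ with ≤-or-> β k
    ... | inj₁ β≤k = linarith 5 (λ fk fb t b k → fk :< t ⟹ t :≤ fb ⟹ b :≤ k ⟹
        fb :- fk :≤ 2 :× (b :- k) ⟹ :⊥) fk<τ τ≤fβ β≤k (lipschitz α≤k k≤β ≤.refl)
    ... | inj₂ k<β = let
      (η , 2η≈τ-fk)         = fraction 1 (τ - f k)
      (ε , 0<ε , ε≤η , ε≤β-k) = smaller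
        (linarith 3 (λ ε f t → 2 :× ε :≈ t :- f ⟹ f :< t ⟹ :0 :< ε) 2η≈τ-fk fk<τ)
        (linarith 2 (λ k b → k :< b ⟹ :0 :< b :- k) k<β)
      k≤k+ε = linarith 2 (λ k e → :0 :< e ⟹ k :≤ k :+ e) 0<ε
      k+ε≤β = linarith 3 (λ k e b → e :≤ b :- k ⟹ k :+ e :≤ b) ε≤β-k
      fk+ε≤τ = linarith 6 (λ k e h fk fe t → fe :- fk :≤ 2 :× (k :+ e :- k) ⟹ e :≤ h ⟹
          2 :× h :≈ t :- fk ⟹ fe :≤ t) (lipschitz α≤k k≤k+ε k+ε≤β) ε≤η 2η≈τ-fk
      in linarith 2 (λ k e → k :+ e :≤ k ⟹ :0 :< e ⟹ :⊥)
           (proj₁ (proj₂ lub) (k + ε) (≤.trans α≤k k≤k+ε , k+ε≤β , fk+ε≤τ)) 0<ε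

  -- Completeness stands in for compactness: k is the supremum of the u such that f still comes
  -- arbitrarily close to its infimum m on [u, l]. Nearly minimal values are then taken arbitrarily
  -- close to k, and the Lipschitz bound carries them to k itself.
  minimumAttained : ∀ (f : Carrier → Carrier) {l} → 0# ≤ l →
    (∀ {u v} → 0# ≤ u → u ≤ v → v ≤ l → f u ≤ f v + (v - u) × f v ≤ f u + (v - u)) →
    (∀ {v} → 0# ≤ v → v ≤ l → 0# ≤ f v) →
    ∃ λ k → 0# ≤ k × k ≤ l × (∀ {v} → 0# ≤ v → v ≤ l → f k ≤ f v)
  minimumAttained f {l} 0≤l lipschitz 0≤f =
    k , 0≤k , k≤l , λ 0≤v v≤l → ≤.trans (≮⇒≥ not-above) (m≤f 0≤v v≤l)
    where
    LowerBound : Pred Carrier 0ℓ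
    LowerBound r = ∀ {v} → 0# ≤ v → v ≤ l → r ≤ f v

    infimum : ∃ (LeastUpperBound LowerBound)
    infimum = complete LowerBound (0# , 0≤f) (f 0# , λ r r≤ → r≤ ≤.refl 0≤l)

    m : Carrier
    m = proj₁ infimum

    m≤f : LowerBound m
    m≤f 0≤v v≤l = proj₂ (proj₂ infimum) _ λ r r≤ → r≤ 0≤v v≤l

    approached : ∀ {ε} → 0# < ε → ∃ λ v → 0# ≤ v × v ≤ l × f v ≤ m + ε
    approached {ε} 0<ε with lem {∃ λ v → 0# ≤ v × v ≤ l × f v ≤ m + ε}
    ... | yes found = found
    ... | no  none  = ⊥-elim (linarith 2 (λ m e → m :+ e :≤ m ⟹ :0 :< e ⟹ :⊥)
      (proj₁ (proj₂ infimum) (m + ε) λ 0≤v v≤l → <⇒≤ (≰⇒> λ fv≤ → none (_ , 0≤v , v≤l , fv≤))) 0<ε)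

    ApproachedAfter : Pred Carrier 0ℓ
    ApproachedAfter u = 0# ≤ u × u ≤ l × (∀ {ε} → 0# < ε → ∃ λ v → u ≤ v × v ≤ l × f v ≤ m + ε)

    lub : ∃ (LeastUpperBound ApproachedAfter)
    lub = complete ApproachedAfter (0# , ≤.refl , 0≤l , approached) (l , λ _ (_ , u≤l , _) → u≤l)

    k : Carrier
    k = proj₁ lub

    0≤k : 0# ≤ k
    0≤k = proj₁ (proj₂ lub) 0# (≤.refl , 0≤l , approached)

    k≤l : k ≤ l
    k≤l = proj₂ (proj₂ lub) l λ _ (_ , u≤l , _) → u≤l

    not-above : ¬ (m < f k)
    not-above m<fk = let
      -- One third of the gap bounds the distance from v to k, one third the excess of f v over m;
      -- the remaining third gives the contradiction.
      (ε , 3ε≈fk-m)             = fraction 2 (f k - m)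
      0<ε                       =
        linarith 3 (λ e f m → 3 :× e :≈ f :- m ⟹ m :< f ⟹ :0 :< e) 3ε≈fk-m m<fk
      (ε₁ , 0<ε₁ , beyond)      = missed 0<ε
      (ε₂ , 0<ε₂ , ε₂≤ε , ε₂≤ε₁) = smaller 0<ε 0<ε₁
      (u , (0≤u , u≤l , after) , k-ε<u) = lub-approximation (proj₂ lub) 0<ε
      (v , u≤v , v≤l , fv≤m+ε₂) = after 0<ε₂
      0≤v                       = ≤.trans 0≤u u≤v
      v<k+ε                     = ≰⇒> λ k+ε≤v → beyond (v , k+ε≤v , v≤l ,
        linarith 4 (λ fv m a b → fv :≤ m :+ a ⟹ a :≤ b ⟹ fv :≤ m :+ b) fv≤m+ε₂ ε₂≤ε₁)
      fk≤fv+ε                   = case ≤.total k v of λ where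
        (inj₁ k≤v) → linarith 5 (λ fk fv v k e → fk :≤ fv :+ (v :- k) ⟹ v :< k :+ e ⟹ fk :≤ fv :+ e)
          (proj₁ (lipschitz 0≤k k≤v v≤l)) v<k+ε
        (inj₂ v≤k) → linarith 6
          (λ fk fv v k e u → fk :≤ fv :+ (k :- v) ⟹ k :- e :< u ⟹ u :≤ v ⟹ fk :≤ fv :+ e)
          (proj₂ (lipschitz 0≤v v≤k k≤l)) k-ε<u u≤v
      in linarith 5 (λ fk fv m e d → 3 :× e :≈ fk :- m ⟹ fk :≤ fv :+ e ⟹ fv :≤ m :+ d ⟹ d :≤ e ⟹
        :0 :< e ⟹ :⊥)
           3ε≈fk-m fk≤fv+ε fv≤m+ε₂ ε₂≤ε 0<ε
      where
      Reached : Carrier → Carrier → Set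
      Reached ε ε₁ = ∃ λ v → k + ε ≤ v × v ≤ l × f v ≤ m + ε₁

      missed : ∀ {ε} → 0# < ε → ∃ λ ε₁ → 0# < ε₁ × ¬ Reached ε ε₁
      missed {ε} 0<ε with lem {∃ λ ε₁ → 0# < ε₁ × ¬ Reached ε ε₁}
      ... | yes found = found
      ... | no  none  = ⊥-elim (linarith 2 (λ k e → k :+ e :≤ k ⟹ :0 :< e ⟹ :⊥)
        (proj₁ (proj₂ lub) (k + ε) (0≤k+ε , k+ε≤l , reached)) 0<ε)
        where
        reached : ∀ {ε₁} → 0# < ε₁ → Reached ε ε₁
        reached 0<ε₁ = decidable-stable lem λ ¬r → none (_ , 0<ε₁ , ¬r)

        0≤k+ε : 0# ≤ k + ε
        0≤k+ε = linarith 2 (λ k e → :0 :≤ k ⟹ :0 :< e ⟹ :0 :≤ k :+ e) 0≤k 0<ε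

        k+ε≤l : k + ε ≤ l
        k+ε≤l = let (v , k+ε≤v , v≤l , _) = reached 0<ε in ≤.trans k+ε≤v v≤l

-- The cyclic order of the points of the circle

module CyclicOrder (ℝ : CompleteOrderedField) (lem : ExcludedMiddle 0ℓ) where

  open Analysis ℝ lem public
  open UnitCircle ℝ lem public hiding (S¹)
  open Point public using (onCircle; x; y)

  infix 4 _≈ₚ_ _≉ₚ_

  _≈ₚ_ _≉ₚ_ : Point → Point → Set
  p ≈ₚ q = x p ≈ x q × y p ≈ y q
  p ≉ₚ q = ¬ (p ≈ₚ q)

  ≈ₚ-refl : ∀ {p} → p ≈ₚ p
  ≈ₚ-refl = refl , refl

  ≈ₚ-sym : ∀ {p q} → p ≈ₚ q → q ≈ₚ p
  ≈ₚ-sym (e , f) = sym e , sym f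

  -- Up to rotation, p is (1, 0) and a point q at the angle θ from p has
  -- versine p q = 1 - cos θ and sine p q = sin θ.
  versine sine : Point → Point → Carrier
  versine p q = 1# - (x p * x q + y p * y q)
  sine    p q = x p * y q - y p * x q

  area : Point → Point → Point → Carrier
  area p q r = (x q - x p) * (y r - y p) - (y q - y p) * (x r - x p)

  distance² : Point → Point → Carrier
  distance² p q = (x p - x q) ² + (y p - y q) ²

  private
    -- `linarith` multiplies no hypotheses, so an equation is multiplied by its cofactor here and
    -- then supplied to it.
    vanish : ∀ {a b} c → a ≈ b → (a - b) * c ≈ 0#
    vanish {a} {b} c a≈b = trans (*-congʳ (linarith 2 (λ a b → a :≈ b ⟹ a :- b :≈ :0) a≈b)) (zeroˡ c)

    circle* : ∀ p e → (x p * x p + y p * y p - 1#) * e ≈ 0#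
    circle* p e = vanish e (onCircle p)

  distance²-versine : ∀ p q → distance² p q ≈ 2 · versine p q
  distance²-versine p q = linarith 4 (λ a b c d → a :* a :+ b :* b :≈ :1 ⟹ c :* c :+ d :* d :≈ :1 ⟹
      (a :- c) :* (a :- c) :+ (b :- d) :* (b :- d) :≈ 2 :× (:1 :- (a :* c :+ b :* d)))
    (onCircle p) (onCircle q)

  sine² : ∀ p q → sine p q * sine p q ≈ 2 · versine p q - versine p q * versine p q
  sine² p q = linarith 4 (λ a b c d →
      (a :* a :+ b :* b :- :1) :* (c :* c :+ d :* d) :≈ :0 ⟹ c :* c :+ d :* d :≈ :1 ⟹
      (a :* d :- b :* c) :* (a :* d :- b :* c) :≈
        2 :× (:1 :- (a :* c :+ b :* d)) :- (:1 :- (a :* c :+ b :* d)) :* (:1 :- (a :* c :+ b :* d)))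
    (circle* p (x q * x q + y q * y q)) (onCircle q)

  -- In the frame where p is (1, 0), the points q and r are (1 - v, s) and (1 - w, t) with v, w the
  -- versines and s, t the sines; the right side is the determinant of their differences from p.
  area-versine : ∀ p q r → area p q r ≈ versine p r * sine p q - versine p q * sine p r
  area-versine p q r = linarith 6 (λ a b c d e f →
      (a :* a :+ b :* b :- :1) :* (c :* f :- d :* e) :≈ :0 ⟹
      (c :- a) :* (f :- b) :- (d :- b) :* (e :- a) :≈
        (:1 :- (a :* e :+ b :* f)) :* (a :* d :- b :* c) :- (:1 :- (a :* c :+ b :* d)) :* (a :* f :- b :* e))
    (circle* p (x q * y r - y q * x r))

  versine-addition : ∀ p q r → versine q r ≈
    versine p q + versine p r - versine p q * versine p r - sine p q * sine p r
  versine-addition p q r = linarith 6 (λ a b c d e f →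
      (a :* a :+ b :* b :- :1) :* (c :* e :+ d :* f) :≈ :0 ⟹
      :1 :- (c :* e :+ d :* f) :≈ (:1 :- (a :* c :+ b :* d)) :+ (:1 :- (a :* e :+ b :* f))
        :- (:1 :- (a :* c :+ b :* d)) :* (:1 :- (a :* e :+ b :* f)) :- (a :* d :- b :* c) :* (a :* f :- b :* e))
    (circle* p (x q * x r + y q * y r))

  versine-nonneg : ∀ p q → 0# ≤ versine p q
  versine-nonneg p q = linarith 3 (λ v s t → :0 :≤ s ⟹ :0 :≤ t ⟹ s :+ t :≈ 2 :× v ⟹ :0 :≤ v)
    (square-nonneg (x p - x q)) (square-nonneg (y p - y q)) (distance²-versine p q)

  versine-pos : ∀ p q → p ≉ₚ q → 0# < versine p q
  versine-pos p q p≉q = versine-nonneg p q , λ 0≈v → p≉q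
    ( square-zero (linarith 3 (λ v s t → :0 :≤ t ⟹ s :+ t :≈ 2 :× v ⟹ :0 :≈ v ⟹ s :≤ :0)
        (square-nonneg (y p - y q)) (distance²-versine p q) 0≈v)
    , square-zero (linarith 3 (λ v s t → :0 :≤ s ⟹ s :+ t :≈ 2 :× v ⟹ :0 :≈ v ⟹ t :≤ :0)
        (square-nonneg (x p - x q)) (distance²-versine p q) 0≈v))
    where
    square-zero : ∀ {a b} → (a - b) * (a - b) ≤ 0# → a ≈ b
    square-zero {a} {b} h = ≤.antisym
      (linarith 2 (λ a b → a :- b :≤ :0 ⟹ a :≤ b) (square-reflects-≤ ≤.refl
        (linarith 2 (λ a b → (a :- b) :* (a :- b) :≤ :0 ⟹ (a :- b) :* (a :- b) :≤ :0 :* :0) h)))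
      (linarith 2 (λ a b → b :- a :≤ :0 ⟹ b :≤ a) (square-reflects-≤ ≤.refl
        (linarith 2 (λ a b → (a :- b) :* (a :- b) :≤ :0 ⟹ (b :- a) :* (b :- a) :≤ :0 :* :0) h)))

  versine⇒≉ : ∀ {p q} → 0# < versine p q → p ≉ₚ q
  versine⇒≉ {p} {q} (_ , 0≉v) (xp≈xq , yp≈yq) = 0≉v (sym (trans (versine-cong xp≈xq yp≈yq)
    (linarith 2 (λ c d → c :* c :+ d :* d :≈ :1 ⟹ :1 :- (c :* c :+ d :* d) :≈ :0) (onCircle q))))
    where
    versine-cong : x p ≈ x q → y p ≈ y q → versine p q ≈ versine q q
    versine-cong e f = +-congˡ (-‿cong (+-cong (*-congʳ e) (*-congʳ f)))

  versine-≤2 : ∀ p q → versine p q ≤ 2 · 1#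
  versine-≤2 p q with lem {p ≈ₚ q}
  ... | no p≉q = *-cancel-pos-≤ (versine-pos p q p≉q)
    (linarith 2 (λ s v → :0 :≤ s :* s ⟹ s :* s :≈ 2 :× v :- v :* v ⟹ v :* v :≤ (2 :× :1) :* v)
      (square-nonneg (sine p q)) (sine² p q))
  ... | yes p≈q with ≤-or-> (versine p q) 0#
  ...   | inj₁ v≤0 = linarith 1 (λ v → v :≤ :0 ⟹ v :≤ 2 :× :1) v≤0
  ...   | inj₂ 0<v = ⊥-elim (versine⇒≉ {p} {q} 0<v p≈q)

  abstract
    -- Minus the cotangent of half the angle from p to q, which increases from
    -- -∞ to ∞ as q runs anticlockwise along the circle minus p.
    slope : Point → Point → Carrier
    slope p q with lem {p ≈ₚ q}
    ... | yes _   = 0#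
    ... | no  p≉q = proj₁ (quotient (- sine p q) (versine-pos p q p≉q))

    slope-versine : ∀ {p q} → p ≉ₚ q → slope p q * versine p q ≈ - sine p q
    slope-versine {p} {q} p≉q with lem {p ≈ₚ q}
    ... | yes p≈q  = ⊥-elim (p≉q p≈q)
    ... | no  p≉q′ = proj₂ (quotient (- sine p q) (versine-pos p q p≉q′))

  -- Versines are positive away from p, so the orientation of p, q, r is the order of the slopes of
  -- q and r. Transitivity and totality of `Anticlockwise p` on the circle minus p are inherited
  -- from the order of the reals.
  area-slope : ∀ {p q r} → p ≉ₚ q → p ≉ₚ r →
    area p q r ≈ (slope p r - slope p q) * (versine p q * versine p r)
  area-slope {p} {q} {r} p≉q p≉r = trans (area-versine p q r)
    (linarith 6 (λ s t v w k l → (k :* v :- (:- s)) :* w :≈ :0 ⟹ (l :* w :- (:- t)) :* v :≈ :0 ⟹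
        w :* s :- v :* t :≈ (l :- k) :* (v :* w))
      (vanish _ (slope-versine p≉q)) (vanish _ (slope-versine p≉r)))

  Acw⇒≉ : ∀ {p q r} → Anticlockwise p q r → p ≉ₚ q × p ≉ₚ r × q ≉ₚ r
  Acw⇒≉ {p} {q} {r} 0<T = ≉pq , ≉pr , ≉qr
    where
    ≉pq : p ≉ₚ q
    ≉pq (e , f) = linarith 2 (λ s t → s :≈ :0 ⟹ t :≈ :0 ⟹ :0 :< s :- t ⟹ :⊥) (vanish _ (sym e))
      (vanish _ (sym f)) 0<T
    ≉pr : p ≉ₚ r
    ≉pr (e , f) = linarith 4 (λ a b c d → b :* a :≈ :0 ⟹ d :* c :≈ :0 ⟹ :0 :< a :* b :- c :* d ⟹ :⊥)
      (vanish _ (sym f)) (vanish _ (sym e)) 0<T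
    ≉qr : q ≉ₚ r
    ≉qr (e , f) = linarith 6 (λ a b c d g h → (g :- c) :* (d :- b) :≈ :0 ⟹ (h :- d) :* (c :- a) :≈ :0 ⟹
        :0 :< (c :- a) :* (h :- b) :- (d :- b) :* (g :- a) ⟹ :⊥)
      (vanish (y q - y p) (sym e)) (vanish (x q - x p) (sym f)) 0<T

  Acw⇒slope< : ∀ {p q r} → Anticlockwise p q r → slope p q < slope p r
  Acw⇒slope< {p} {q} {r} 0<T = let (p≉q , p≉r , _) = Acw⇒≉ {p} {q} {r} 0<T in ≰⇒> λ l≤k →
    linarith 4 (λ t k l v → :0 :< t ⟹ t :≈ (l :- k) :* v ⟹ :0 :≤ (k :- l) :* v ⟹ :⊥)
      0<T (area-slope p≉q p≉r) (*-nonNeg (linarith 2 (λ k l → l :≤ k ⟹ :0 :≤ k :- l) l≤k)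
        (*-nonNeg (versine-nonneg p q) (versine-nonneg p r)))

  slope<⇒Acw : ∀ {p q r} → p ≉ₚ q → p ≉ₚ r → slope p q < slope p r → Anticlockwise p q r
  slope<⇒Acw {p} {q} {r} p≉q p≉r k<l =
    linarith 2 (λ a b → a :≈ b ⟹ :0 :< b ⟹ :0 :< a) (area-slope p≉q p≉r)
    (*-pos (linarith 2 (λ k l → k :< l ⟹ :0 :< l :- k) k<l)
      (*-pos (versine-pos p q p≉q) (versine-pos p r p≉r)))

  Acw-cyclic : ∀ {p q r} → Anticlockwise p q r → Anticlockwise q r p
  Acw-cyclic 0<T = linarith 6 (λ a b c d e f →
      :0 :< (c :- a) :* (f :- b) :- (d :- b) :* (e :- a) ⟹
      :0 :< (e :- c) :* (b :- d) :- (f :- d) :* (a :- c)) 0<T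

  Acw-trans : ∀ {p q r s} → Anticlockwise p q r → Anticlockwise p r s → Anticlockwise p q s
  Acw-trans {p} {q} {r} {s} pqr prs =
    slope<⇒Acw (proj₁ (Acw⇒≉ {p} {q} {r} pqr)) (proj₁ (proj₂ (Acw⇒≉ {p} {r} {s} prs)))
    (linarith 3 (λ k l m → k :< l ⟹ l :< m ⟹ k :< m) (Acw⇒slope< {p} {q} {r} pqr)
      (Acw⇒slope< {p} {r} {s} prs))

  -- Moves the base from p to q: with both triangles rotated to begin at r, this is `Acw-trans`.
  Acw-drop : ∀ {p q r s} → Anticlockwise p q r → Anticlockwise p r s → Anticlockwise q r s
  Acw-drop {p} {q} {r} {s} pqr prs =
    Acw-cyclic {s} {q} {r}
    (Acw-cyclic {r} {s} {q}
    (Acw-trans {r} {s} {p} {q} (Acw-cyclic {p} {r} {s} prs)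
    (Acw-cyclic {q} {r} {p} (Acw-cyclic {p} {q} {r} pqr))))

  -- The formula K = abc / 4R for a triangle of circumradius R = 1: `area` is 2K up to sign, and the
  -- squared sides at p are twice the versines.
  area² : ∀ p q r → distance² q r * (versine p q * versine p r) ≈ area p q r * area p q r
  area² p q r = linarith 7 (λ v w s t d u a →
      (s :* s :- (2 :× v :- v :* v)) :* (w :* w) :≈ :0 ⟹
      (t :* t :- (2 :× w :- w :* w)) :* (v :* v) :≈ :0 ⟹
      (u :- (v :+ w :- v :* w :- s :* t)) :* (v :* w) :≈ :0 ⟹
      (d :- 2 :× u) :* (v :* w) :≈ :0 ⟹
      (a :- (w :* s :- v :* t)) :* (a :+ (w :* s :- v :* t)) :≈ :0 ⟹
      d :* (v :* w) :≈ a :* a)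
    (vanish _ (sine² p q)) (vanish _ (sine² p r)) (vanish _ (versine-addition p q r))
    (vanish _ (distance²-versine q r)) (vanish _ (area-versine p q r))

  -- By `area²` and `area-slope` the squared distance is the squared difference of the slopes times
  -- two versines, each at most 2. The slope bounds on arc length rest on this estimate.
  distance²-slope : ∀ {p q r} → p ≉ₚ q → p ≉ₚ r →
    distance² q r ≤ (2 · (slope p r - slope p q)) * (2 · (slope p r - slope p q))
  distance²-slope {p} {q} {r} p≉q p≉r = linarith 4 (λ d k v w →
      d :≤ (k :* k) :* (v :* w) ⟹ :0 :≤ (k :* k) :* ((2 :× :1 :- v) :* w) ⟹
      :0 :≤ (k :* k) :* (2 :× :1 :- w) ⟹ d :≤ (2 :× k) :* (2 :× k))
    (*-cancel-pos-≤ (*-pos 0<v 0<w) (linarith 4 (λ d a k u →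
        d :* u :≈ a :* a ⟹ (a :- k :* u) :* (a :+ k :* u) :≈ :0 ⟹ d :* u :≤ (k :* k) :* u :* u)
      (area² p q r) (vanish _ (area-slope p≉q p≉r))))
    (*-nonNeg 0≤k² (*-nonNeg (2- (versine-≤2 p q)) (<⇒≤ 0<w))) (*-nonNeg 0≤k² (2- (versine-≤2 p r)))
    where
    0<v = versine-pos p q p≉q
    0<w = versine-pos p r p≉r
    0≤k² = square-nonneg (slope p r - slope p q)
    2- : ∀ {a} → a ≤ 2 · 1# → 0# ≤ 2 · 1# - a
    2- = linarith 1 λ a → a :≤ 2 :× :1 ⟹ :0 :≤ 2 :× :1 :- a

  Acw-total : ∀ p q r → p ≉ₚ q → p ≉ₚ r → Anticlockwise p q r ⊎ q ≈ₚ r ⊎ Anticlockwise p r q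
  Acw-total p q r p≉q p≉r with ≤-or-> (slope p q) (slope p r) | ≤-or-> (slope p r) (slope p q)
  ... | inj₂ l<k | _ = inj₂ (inj₂ (slope<⇒Acw {p} {r} {q} p≉r p≉q l<k))
  ... | _ | inj₂ k<l = inj₁ (slope<⇒Acw {p} {q} {r} p≉q p≉r k<l)
  ... | inj₁ k≤l | inj₁ l≤k = inj₂ (inj₁ (decidable-stable lem λ q≉r →
    linarith 4 (λ v d k l → d :≤ (2 :× (l :- k)) :* (2 :× (l :- k)) ⟹
      (l :- k) :* (4 :× (l :- k)) :≈ :0 ⟹
        d :≈ 2 :× v ⟹ :0 :< v ⟹ :⊥)
      (distance²-slope p≉q p≉r) (vanish _ (≤.antisym l≤k k≤l)) (distance²-versine q r)
        (versine-pos q r q≉r)))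

  abstract
    -- Stereographic projection from p: the point has versine 2 / (1 + k²).
    pointAt : ∀ p k → ∃ λ q → p ≉ₚ q × slope p q ≈ k
    pointAt p k = q , p≉q , *-cancel p≉q
      where
      0<1+k² : 0# < 1# + k * k
      0<1+k² = linarith 1 (λ k → :0 :≤ k :* k ⟹ :0 :< :1 :+ k :* k) (square-nonneg k)

      v : Carrier
      v = proj₁ (quotient (2 · 1#) 0<1+k²)

      v-spec : v * (1# + k * k) ≈ 2 · 1#
      v-spec = proj₂ (quotient (2 · 1#) 0<1+k²)

      q : Point
      q = point (x p * (1# - v) + y p * (k * v) , y p * (1# - v) - x p * (k * v))
        (linarith 4 (λ a b k v → a :* a :+ b :* b :≈ :1 ⟹
            (a :* a :+ b :* b :- :1) :* ((:1 :- v) :* (:1 :- v) :+ (k :* v) :* (k :* v)) :≈ :0 ⟹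
            (v :* (:1 :+ k :* k) :- 2 :× :1) :* v :≈ :0 ⟹
            (a :* (:1 :- v) :+ b :* (k :* v)) :* (a :* (:1 :- v) :+ b :* (k :* v))
            :+ (b :* (:1 :- v) :- a :* (k :* v)) :* (b :* (:1 :- v) :- a :* (k :* v)) :≈ :1)
          (onCircle p) (circle* p _) (vanish _ v-spec))

      versine≈v : versine p q ≈ v
      versine≈v = linarith 4 (λ a b k v → (a :* a :+ b :* b :- :1) :* (:1 :- v) :≈ :0 ⟹
          :1 :- (a :* (a :* (:1 :- v) :+ b :* (k :* v)) :+ b :* (b :* (:1 :- v) :- a :* (k :* v))) :≈ v)
        (circle* p _)

      sine≈-kv : sine p q ≈ - (k * v)
      sine≈-kv = linarith 4 (λ a b k v → (a :* a :+ b :* b :- :1) :* (k :* v) :≈ :0 ⟹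
          a :* (b :* (:1 :- v) :- a :* (k :* v)) :- b :* (a :* (:1 :- v) :+ b :* (k :* v)) :≈ :- (k :* v))
        (circle* p _)

      0<v : 0# < v
      0<v = quotient-pos 0<1+k² (linarith 0 (:0 :< 2 :× :1)) v-spec

      p≉q : p ≉ₚ q
      p≉q = versine⇒≉ {p} {q} (linarith 2 (λ w v → w :≈ v ⟹ :0 :< v ⟹ :0 :< w) versine≈v 0<v)

      *-cancel : p ≉ₚ q → slope p q ≈ k
      *-cancel p≉q = ≤.antisym
        (*-cancel-pos-≤ 0<v (linarith 5
          (λ l k v w s → l :* w :≈ :- s ⟹ s :≈ :- (k :* v) ⟹ (w :- v) :* l :≈ :0 ⟹
            l :* v :≤ k :* v) (slope-versine p≉q) sine≈-kv (vanish _ versine≈v)))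
        (*-cancel-pos-≤ 0<v (linarith 5
          (λ l k v w s → l :* w :≈ :- s ⟹ s :≈ :- (k :* v) ⟹ (w :- v) :* l :≈ :0 ⟹
            k :* v :≤ l :* v) (slope-versine p≉q) sine≈-kv (vanish _ versine≈v)))

-- Chords, inscribed polygons and the additivity of arc length

module ArcLength (ℝ : CompleteOrderedField) (lem : ExcludedMiddle 0ℓ) where

  open CyclicOrder ℝ lem public

  module _ {t : Carrier} (0≤t : 0# ≤ t) where

    private
      root = sup-lub {λ s → s ² ≤ t} (0# , linarith 1 (λ t → :0 :≤ t ⟹ :0 :* :0 :≤ t) 0≤t)
        (1# + t , λ s s²≤t → square-reflects-≤ (linarith 1 (λ t → :0 :≤ t ⟹ :0 :≤ :1 :+ t) 0≤t)
          (linarith 2 (λ s t → s :* s :≤ t ⟹ :0 :≤ t ⟹ :0 :≤ t :* t ⟹ s :* s :≤ (:1 :+ t) :* (:1 :+ t))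
            s²≤t 0≤t (square-nonneg t)))

    sqrt-nonneg : 0# ≤ sqrt t
    sqrt-nonneg = proj₁ root 0# (linarith 1 (λ t → :0 :≤ t ⟹ :0 :* :0 :≤ t) 0≤t)

    sqrt-least : ∀ {b} → 0# ≤ b → t ≤ b * b → sqrt t ≤ b
    sqrt-least 0≤b t≤b² = proj₂ root _ λ s s²≤t → square-reflects-≤ 0≤b (≤.trans s²≤t t≤b²)

    sqrt-square : t ≤ sqrt t * sqrt t
    sqrt-square = ≮⇒≥ λ s²<t → let
      s                         = sqrt t
      0<2s+1                    = linarith 1 (λ s → :0 :≤ s ⟹ :0 :< 2 :× s :+ :1) sqrt-nonneg
      0<t-s²                    = linarith 2 (λ s t → s :* s :< t ⟹ :0 :< t :- s :* s) s²<t
      (q , q[2s+1]≈t-s²)        = quotient (t - s * s) 0<2s+1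
      0<q                       = quotient-pos 0<2s+1 0<t-s² q[2s+1]≈t-s²
      -- For ε at most 1, (s + ε)² is at most s² + (2s + 1) ε, and q is where this bound reaches t.
      (ε , 0<ε , ε≤1 , ε≤q)     = smaller (linarith 0 (:0 :< :1)) 0<q
      in linarith 2 (λ s e → s :+ e :≤ s ⟹ :0 :< e ⟹ :⊥)
        (proj₁ root (s + ε) (linarith 4 (λ s e q t → q :* (2 :× s :+ :1) :≈ t :- s :* s ⟹
            :0 :≤ (:1 :- e) :* e ⟹ :0 :≤ (q :- e) :* (2 :× s :+ :1) ⟹ (s :+ e) :* (s :+ e) :≤ t)
          q[2s+1]≈t-s² (*-nonNeg (linarith 1 (λ e → e :≤ :1 ⟹ :0 :≤ :1 :- e) ε≤1) (<⇒≤ 0<ε))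
          (*-nonNeg (linarith 2 (λ e q → e :≤ q ⟹ :0 :≤ q :- e) ε≤q) (<⇒≤ 0<2s+1)))) 0<ε

  distance²-nonneg : ∀ p q → 0# ≤ distance² p q
  distance²-nonneg p q = linarith 2 (λ s t → :0 :≤ s ⟹ :0 :≤ t ⟹ :0 :≤ s :+ t)
    (square-nonneg (x p - x q)) (square-nonneg (y p - y q))

  chord-nonneg : ∀ p q → 0# ≤ chord p q
  chord-nonneg p q = sqrt-nonneg (distance²-nonneg p q)

  chord-least : ∀ p q {b} → 0# ≤ b → distance² p q ≤ b * b → chord p q ≤ b
  chord-least p q = sqrt-least (distance²-nonneg p q)

  distance²-≤-chord² : ∀ p q → distance² p q ≤ chord p q * chord p q
  distance²-≤-chord² p q = sqrt-square (distance²-nonneg p q)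

  chord-resp-≤ : ∀ {p p′ q q′} → p ≈ₚ p′ → q ≈ₚ q′ → chord p q ≤ chord p′ q′
  chord-resp-≤ {p} {p′} {q} {q′} (e , f) (g , h) = chord-least p q (chord-nonneg p′ q′)
    (≤-resp-≈ (+-cong (*-cong e-g e-g) (*-cong f-h f-h)) refl (distance²-≤-chord² p′ q′))
    where
    e-g = +-cong (sym e) (-‿cong (sym g))
    f-h = +-cong (sym f) (-‿cong (sym h))

  chord-cong : ∀ {p p′ q q′} → p ≈ₚ p′ → q ≈ₚ q′ → chord p q ≈ chord p′ q′
  chord-cong {p} {p′} {q} {q′} e f = ≤.antisym (chord-resp-≤ {p} {p′} {q} {q′} e f)
    (chord-resp-≤ {p′} {p} {q′} {q} (≈ₚ-sym {p} {p′} e) (≈ₚ-sym {q} {q′} f))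

  chord-zero : ∀ {p q} → p ≈ₚ q → chord p q ≈ 0#
  chord-zero {p} {q} (e , f) = ≤.antisym (chord-least p q ≤.refl
    (linarith 4 (λ a b c d → a :≈ c ⟹ b :≈ d ⟹ (a :- c) :* (a :- c) :≈ :0 ⟹ (b :- d) :* (b :- d) :≈ :0 ⟹
        (a :- c) :* (a :- c) :+ (b :- d) :* (b :- d) :≤ :0 :* :0) e f (square e) (square f)))
    (chord-nonneg p q)
    where
    square : ∀ {a b} → a ≈ b → (a - b) * (a - b) ≈ 0#
    square a≈b = trans (*-congʳ (linarith 2 (λ a b → a :≈ b ⟹ a :- b :≈ :0) a≈b)) (zeroˡ _)

  chord-pos : ∀ p q → p ≉ₚ q → 0# < chord p q
  chord-pos p q p≉q = chord-nonneg p q , λ 0≈c →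
    linarith 3 (λ c d v → d :≤ c :* c ⟹ d :≈ 2 :× v ⟹ :0 :< v ⟹ c :* c :≈ :0 ⟹ :⊥)
    (distance²-≤-chord² p q) (distance²-versine p q) (versine-pos p q p≉q)
      (trans (*-congʳ (sym 0≈c)) (zeroˡ _))

  chord-triangle : ∀ p q r → chord p r ≤ chord p q + chord q r
  chord-triangle p q r = chord-least p r 0≤A+B
    (linarith 8 (λ a b c d e f A B →
        (a :- c) :* (a :- c) :+ (b :- d) :* (b :- d) :≤ A :* A ⟹
        (c :- e) :* (c :- e) :+ (d :- f) :* (d :- f) :≤ B :* B ⟹
        (a :- c) :* (c :- e) :+ (b :- d) :* (d :- f) :≤ A :* B ⟹
        (a :- e) :* (a :- e) :+ (b :- f) :* (b :- f) :≤ (A :+ B) :* (A :+ B))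
      A²≥ B²≥ cauchySchwarz)
    where
    A²≥   = distance²-≤-chord² p q
    B²≥   = distance²-≤-chord² q r
    0≤A   = chord-nonneg p q
    0≤B   = chord-nonneg q r
    0≤A+B = linarith 2 (λ a b → :0 :≤ a ⟹ :0 :≤ b ⟹ :0 :≤ a :+ b) 0≤A 0≤B

    difference-nonneg : ∀ {a b} → a ≤ b → 0# ≤ b - a
    difference-nonneg = linarith 2 λ a b → a :≤ b ⟹ :0 :≤ b :- a

    cauchySchwarz : (x p - x q) * (x q - x r) + (y p - y q) * (y q - y r) ≤ chord p q * chord q r
    -- Lagrange's identity: (ac + bd)² + (ad - bc)² = (a² + b²)(c² + d²).
    cauchySchwarz = square-reflects-≤ (*-nonNeg 0≤A 0≤B)
      (linarith 6 (λ a b c d A B →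
          :0 :≤ (a :* d :- b :* c) :* (a :* d :- b :* c) ⟹
          :0 :≤ (A :* A :- (a :* a :+ b :* b)) :* (c :* c :+ d :* d) ⟹
          :0 :≤ (A :* A) :* (B :* B :- (c :* c :+ d :* d)) ⟹
          (a :* c :+ b :* d) :* (a :* c :+ b :* d) :≤ (A :* B) :* (A :* B))
        (square-nonneg _) (*-nonNeg (difference-nonneg A²≥) (distance²-nonneg q r))
        (*-nonNeg (square-nonneg _) (difference-nonneg B²≥)))

  chord-slope : ∀ {b p q} → Anticlockwise b p q → chord p q ≤ 2 · (slope b q - slope b p)
  chord-slope {b} {p} {q} bpq = let (b≉p , b≉q , _) = Acw⇒≉ {b} {p} {q} bpq in
    chord-least p q (linarith 2 (λ k l → k :< l ⟹ :0 :≤ 2 :× (l :- k)) (Acw⇒slope< {b} {p} {q} bpq))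
      (distance²-slope b≉p b≉q)

  area-cong : ∀ {p p′ q q′ r r′} → p ≈ₚ p′ → q ≈ₚ q′ → r ≈ₚ r′ → area p q r ≈ area p′ q′ r′
  area-cong (a , b) (c , d) (e , f) =
    +-cong (*-cong (minus c a) (minus f b)) (-‿cong (*-cong (minus d b) (minus e a)))
    where
    minus : ∀ {s s′ t t′} → s ≈ s′ → t ≈ t′ → s - t ≈ s′ - t′
    minus e f = +-cong e (-‿cong f)

  Acw-resp : ∀ {p p′ q q′ r r′} → p ≈ₚ p′ → q ≈ₚ q′ → r ≈ₚ r′ → Anticlockwise p q r →
    Anticlockwise p′ q′ r′
  Acw-resp {p} {p′} {q} {q′} {r} {r′} e f g =
    linarith 2 (λ a b → a :≈ b ⟹ :0 :< a ⟹ :0 :< b) (area-cong {p} {p′} {q} {q′} {r} {r′} e f g)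

  Acw-cyclic⁻¹ : ∀ {p q r} → Anticlockwise p q r → Anticlockwise r p q
  Acw-cyclic⁻¹ {p} {q} {r} pqr = Acw-cyclic {q} {r} {p} (Acw-cyclic {p} {q} {r} pqr)

  -- Path p v vs q: the points v, vs, q follow p anticlockwise, in this order.
  Path : Point → Point → List Point → Point → Set
  Path p v []        q = Anticlockwise p v q
  Path p v (v′ ∷ vs) q = Anticlockwise p v v′ × Path p v′ vs q

  Inscribed : Point → List Point → Point → Set
  Inscribed p []       q = ⊤
  Inscribed p (v ∷ vs) q = Path p v vs q

  Linked⇒Inscribed : ∀ {p} vs {q} → Linked (Anticlockwise p) (vs ∷ʳ q) → Inscribed p vs q
  Linked⇒Inscribed []            _            = tt
  Linked⇒Inscribed (v ∷ [])      (pvq ∷ _)    = pvq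
  Linked⇒Inscribed (v ∷ v′ ∷ vs) (pvv′ ∷ ps)  = pvv′ , Linked⇒Inscribed (v′ ∷ vs) ps

  Inscribed⇒Linked : ∀ {p} vs {q} → Inscribed p vs q → Linked (Anticlockwise p) (vs ∷ʳ q)
  Inscribed⇒Linked []            _           = [-]
  Inscribed⇒Linked (v ∷ [])      pvq         = pvq ∷ [-]
  Inscribed⇒Linked (v ∷ v′ ∷ vs) (pvv′ , ps) = pvv′ ∷ Inscribed⇒Linked (v′ ∷ vs) ps

  Path-end : ∀ {p v} vs {q} → Path p v vs q → Anticlockwise p v q
  Path-end         []        pvq         = pvq
  Path-end {p} {v} (v′ ∷ vs) {q} (pvv′ , ps) = Acw-trans {p} {v} {v′} {q} pvv′ (Path-end vs ps)

  Path-resp : ∀ {p p′ v} vs {q q′} → p ≈ₚ p′ → q ≈ₚ q′ → Path p v vs q → Path p′ v vs q′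
  Path-resp {p} {p′} {v} []        {q} {q′} e f pvq =
    Acw-resp {p} {p′} {v} {v} {q} {q′} e (≈ₚ-refl {v}) f pvq
  Path-resp {p} {p′} {v} (v′ ∷ vs) {q} {q′} e f (pvv′ , ps) =
    Acw-resp {p} {p′} {v} {v} {v′} {v′} e (≈ₚ-refl {v}) (≈ₚ-refl {v′}) pvv′ ,
      Path-resp vs {q} {q′} e f ps

  Path-resp-head : ∀ {p v v′} vs {q} → v ≈ₚ v′ → Path p v vs q → Path p v′ vs q
  Path-resp-head {p} {v} {v′} []      {q} e pvq =
    Acw-resp {p} {p} {v} {v′} {q} {q} (≈ₚ-refl {p}) e (≈ₚ-refl {q}) pvq
  Path-resp-head {p} {v} {v′} (w ∷ _) {q} e (pvw , ps) =
    Acw-resp {p} {p} {v} {v′} {w} {w} (≈ₚ-refl {p}) e (≈ₚ-refl {w}) pvw , ps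

  -- For splitting a polygon at q: its second half has to be ordered as seen from q instead of p.
  Path-advance : ∀ {p q v} vs {r} → Anticlockwise p q v → Path p v vs r → Path q v vs r
  Path-advance {p} {q} {v} []        {r} pqv pvr         = Acw-drop {p} {q} {v} {r} pqv pvr
  Path-advance {p} {q} {v} (v′ ∷ vs) {r} pqv (pvv′ , ps) = Acw-drop {p} {q} {v} {v′} pqv pvv′ ,
    Path-advance vs (Acw-trans {p} {q} {v} {v′} pqv pvv′) ps

  Inscribed-advance : ∀ {p q} vs {r} → Path p q vs r → Inscribed q vs r
  Inscribed-advance []       _          = tt
  Inscribed-advance (v ∷ vs) (pqv , ps) = Path-advance vs pqv ps

  -- For joining polygons: p lies beyond r as seen from q, so moving the base from q to p cuts the
  -- circle open outside the polygon and keeps the order of its vertices.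
  Path-retreat : ∀ {p q v} vs {r} → Anticlockwise q r p → Path q v vs r → Path p v vs r
  Path-retreat {p} {q} {v} []        {r} qrp qvr         =
    Acw-cyclic⁻¹ {v} {r} {p} (Acw-drop {q} {v} {r} {p} qvr qrp)
  Path-retreat {p} {q} {v} (v′ ∷ vs) {r} qrp (qvv′ , ps) =
    Acw-cyclic⁻¹ {v} {v′} {p}
      (Acw-drop {q} {v} {v′} {p} qvv′ (Acw-trans {q} {v′} {r} {p} (Path-end vs ps) qrp)) ,
    Path-retreat vs qrp ps

  Inscribed-retreat : ∀ {p q} vs {r} → Anticlockwise p q r → Inscribed q vs r → Path p q vs r
  Inscribed-retreat         []       pqr _  = pqr
  Inscribed-retreat {p} {q} (v ∷ vs) {r} pqr ps =
    Acw-cyclic⁻¹ {q} {v} {p} (Acw-trans {q} {v} {r} {p} (Path-end vs ps) qrp) , Path-retreat vs qrp ps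
    where
    qrp = Acw-cyclic {p} {q} {r} pqr

  Path-++ : ∀ {p v} vs {q} ws {r} → Path p v vs q → Path p q ws r → Path p v (vs ++ q ∷ ws) r
  Path-++ []        ws pvq         qs = pvq , qs
  Path-++ (v′ ∷ vs) ws (pvv′ , ps) qs = pvv′ , Path-++ vs ws ps qs

  polygonLength-++ : ∀ p vs q ws r →
    polygonLength p (vs ++ q ∷ ws) r ≈ polygonLength p vs q + polygonLength q ws r
  polygonLength-++ p []       q ws r = refl
  polygonLength-++ p (v ∷ vs) q ws r =
    trans (+-congˡ (polygonLength-++ v vs q ws r)) (sym (+-assoc _ _ _))

  polygonLength-resp : ∀ {p p′} vs {q q′} → p ≈ₚ p′ → q ≈ₚ q′ →
    polygonLength p vs q ≈ polygonLength p′ vs q′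
  polygonLength-resp {p} {p′} []       {q} {q′} e f = chord-cong {p} {p′} {q} {q′} e f
  polygonLength-resp {p} {p′} (v ∷ vs) {q} {q′} e f =
    +-cong (chord-cong {p} {p′} {v} {v} e (≈ₚ-refl {v}))
      (polygonLength-resp {v} vs {q} {q′} (≈ₚ-refl {v}) f)

  Path-length : ∀ {b p v} vs {q} → Anticlockwise p q b → Path p v vs q →
    polygonLength v vs q ≤ 2 · (slope b q - slope b v)
  Path-length {b} {p} {v} [] {q} pqb pvq =
    chord-slope {b} {v} {q} (Acw-cyclic⁻¹ {v} {q} {b} (Acw-drop {p} {v} {q} {b} pvq pqb))
  Path-length {b} {p} {v} (v′ ∷ vs) {q} pqb (pvv′ , ps) =
    linarith 5 (λ c l j k m → c :≤ 2 :× (k :- j) ⟹ l :≤ 2 :× (m :- k) ⟹ c :+ l :≤ 2 :× (m :- j))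
      (chord-slope {b} {v} {v′} (Acw-cyclic⁻¹ {v} {v′} {b} (Acw-drop {p} {v} {v′} {b} pvv′
        (Acw-trans {p} {v′} {q} {b} (Path-end vs ps) pqb))))
      (Path-length vs pqb ps)

  -- The bounds on the chords telescope. The slopes are taken from a point b outside the arc,
  -- because those seen from p tend to minus infinity near p.
  polygonLength-slope : ∀ {b p} vs {q} → Anticlockwise p q b → Inscribed p vs q →
    polygonLength p vs q ≤ 2 · (slope b q - slope b p)
  polygonLength-slope {b} {p} [] {q} pqb _ = chord-slope {b} {p} {q} (Acw-cyclic⁻¹ {p} {q} {b} pqb)
  polygonLength-slope {b} {p} (v ∷ vs) {q} pqb ps =
    linarith 5 (λ c l j k m → c :≤ 2 :× (k :- j) ⟹ l :≤ 2 :× (m :- k) ⟹ c :+ l :≤ 2 :× (m :- j))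
      (chord-slope {b} {p} {v}
        (Acw-cyclic⁻¹ {p} {v} {b} (Acw-trans {p} {v} {q} {b} (Path-end vs ps) pqb)))
      (Path-length vs pqb ps)

  Length : Point → Point → Pred Carrier 0ℓ
  Length p q t = Σ (List Point) λ vs → Linked (Anticlockwise p) (vs ∷ʳ q) × t ≈ polygonLength p vs q

  -- Supplies the base point outside the arc from p to q from which slopes along it stay bounded.
  beyond : ∀ {p q} → p ≉ₚ q → ∃ λ b → Anticlockwise p q b
  beyond {p} {q} p≉q = let (b , p≉b , k≈) = pointAt p (slope p q + 1#) in
    b , slope<⇒Acw {p} {q} {b} p≉q p≉b (linarith 2 (λ k l → l :≈ k :+ :1 ⟹ k :< l) k≈)

  arcLength-lub : ∀ p q → LeastUpperBound (Length p q) (arcLength p q)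
  arcLength-lub p q = sup-lub (chord p q , [] , [-] , refl) (bound (lem {p ≈ₚ q}))
    where
    bound : Dec (p ≈ₚ q) → ∃ (UpperBound (Length p q))
    bound (no p≉q) = let (b , pqb) = beyond {p} {q} p≉q in
      2 · (slope b q - slope b p) , λ _ (vs , linked , t≈) →
        ≤-resp-≈ (sym t≈) refl (polygonLength-slope vs pqb (Linked⇒Inscribed vs linked))
    bound (yes p≈q) = chord p q , λ where
      _ ([] , _ , t≈)          → ≤.reflexive t≈
      _ (v ∷ vs , linked , _) →
        ⊥-elim (proj₁ (proj₂ (Acw⇒≉ {p} {v} {q}
        (Path-end vs (Linked⇒Inscribed {p} (v ∷ vs) {q} linked)))) p≈q)

  -- Abstract, since case distinctions on lem would unfold the supremum.
  abstract
    arc : Point → Point → Carrier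
    arc = arcLength

    arc≡arcLength : ∀ p q → arc p q ≡ arcLength p q
    arc≡arcLength p q = ≡.refl

    arc-lub : ∀ p q → LeastUpperBound (Length p q) (arc p q)
    arc-lub = arcLength-lub

  polygonLength-≤-arc : ∀ {p} vs {q} → Inscribed p vs q → polygonLength p vs q ≤ arc p q
  polygonLength-≤-arc {p} vs {q} ps = proj₁ (arc-lub p q) _ (vs , Inscribed⇒Linked vs ps , refl)

  arc-least : ∀ {p q b} → (∀ vs → Inscribed p vs q → polygonLength p vs q ≤ b) → arc p q ≤ b
  arc-least {p} {q} h = proj₂ (arc-lub p q) _ λ _ (vs , linked , t≈) →
    ≤-resp-≈ (sym t≈) refl (h vs (Linked⇒Inscribed vs linked))

  arc-slope : ∀ {b p q} → Anticlockwise p q b → arc p q ≤ 2 · (slope b q - slope b p)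
  arc-slope pqb = arc-least λ vs → polygonLength-slope vs pqb

  chord-≤-arc : ∀ p q → chord p q ≤ arc p q
  chord-≤-arc p q = polygonLength-≤-arc [] tt

  arc-nonneg : ∀ p q → 0# ≤ arc p q
  arc-nonneg p q = ≤.trans (chord-nonneg p q) (chord-≤-arc p q)

  arc-pos : ∀ p q → p ≉ₚ q → 0# < arc p q
  arc-pos p q p≉q = linarith 2 (λ c a → :0 :< c ⟹ c :≤ a ⟹ :0 :< a) (chord-pos p q p≉q)
    (chord-≤-arc p q)

  arc-zero : ∀ {p q} → p ≈ₚ q → arc p q ≈ 0#
  arc-zero {p} {q} p≈q = ≤.antisym (arc-least λ where
      []       _  → ≤.reflexive (chord-zero {p} {q} p≈q)
      (v ∷ vs) ps → ⊥-elim (proj₁ (proj₂ (Acw⇒≉ {p} {v} {q} (Path-end vs ps))) p≈q))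
    (arc-nonneg p q)

  arc-cong : ∀ {p p′ q q′} → p ≈ₚ p′ → q ≈ₚ q′ → arc p q ≈ arc p′ q′
  arc-cong {p} {p′} {q} {q′} e f = ≤.antisym (half {p} {p′} {q} {q′} e f)
    (half {p′} {p} {q′} {q} (≈ₚ-sym {p} {p′} e) (≈ₚ-sym {q} {q′} f))
    where
    half : ∀ {p p′ q q′} → p ≈ₚ p′ → q ≈ₚ q′ → arc p q ≤ arc p′ q′
    half {p} {p′} {q} {q′} e f = arc-least λ vs ps →
      ≤-resp-≈ (sym (polygonLength-resp {p} {p′} vs {q} {q′} e f)) refl
        (polygonLength-≤-arc vs (Inscribed-resp vs ps))
      where
      Inscribed-resp : ∀ vs → Inscribed p vs q → Inscribed p′ vs q′
      Inscribed-resp []       _  = tt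
      Inscribed-resp (v ∷ vs) ps = Path-resp {p} {p′} {v} vs {q} {q′} e f ps

  -- Inserting q as a vertex does not shorten a polygon, by `chord-triangle`. The recursion moves
  -- the starting vertex v along the list while the order stays based at p; the component about v₀
  -- is what allows the vertex just passed to be put back in front of us.
  splitAt : ∀ {p q r} → Anticlockwise p q r → ∀ v vs → Inscribed p vs r → ∃ λ us → ∃ λ ws →
    Inscribed p us q × (∀ v₀ → Anticlockwise p v₀ q → Path p v₀ vs r → Path p v₀ us q) ×
      Inscribed q ws r ×
    polygonLength v vs r ≤ polygonLength v us q + polygonLength q ws r
  splitAt {p} {q} {r} pqr v [] _ = [] , [] , tt , (λ _ pvq _ → pvq) , tt , chord-triangle v q r
  splitAt {p} {q} {r} pqr v (v′ ∷ vs) ps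
    with Acw-total p v′ q (proj₁ (Acw⇒≉ {p} {v′} {r} (Path-end vs ps))) (proj₁ (Acw⇒≉ {p} {q} {r} pqr))
  ... | inj₁ pv′q = let (us , ws , us✓ , extend , ws✓ , len) =
                          splitAt {p} {q} {r} pqr v′ vs (tail vs ps) in
    v′ ∷ us , ws , extend v′ pv′q ps , (λ _ _ (a , ps) → a , extend v′ pv′q ps) , ws✓ ,
    linarith 4 (λ c l m n → l :≤ m :+ n ⟹ c :+ l :≤ (c :+ m) :+ n) len
    where
    tail : ∀ vs {v} → Path p v vs r → Inscribed p vs r
    tail []       _        = tt
    tail (w ∷ ws) (_ , ps) = ps
  ... | inj₂ (inj₁ v′≈q) = [] , vs , tt , (λ _ pvq _ → pvq) ,
    Inscribed-advance {p} {q} vs (Path-resp-head {p} {v′} {q} vs v′≈q ps) ,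
    ≤.reflexive (+-cong (chord-cong {v} {v} {v′} {q} (≈ₚ-refl {v}) v′≈q)
      (polygonLength-resp {v′} {q} vs {r} {r} v′≈q (≈ₚ-refl {r})))
  ... | inj₂ (inj₂ pqv′) = [] , v′ ∷ vs , tt , (λ _ pvq _ → pvq) , Path-advance vs pqv′ ps ,
    linarith 4 (λ c l m n → c :≤ m :+ n ⟹ c :+ l :≤ m :+ (n :+ l)) (chord-triangle v q v′)

  -- A polygon from p to r is split at q for one inequality. For the other, polygons on the two
  -- parts are joined, and the two suprema are taken one after the other.
  arc-additive : ∀ {p q r} → Anticlockwise p q r → arc p r ≈ arc p q + arc q r
  arc-additive {p} {q} {r} pqr = ≤.antisym
    (arc-least λ vs ps → let (us , ws , us✓ , _ , ws✓ , len) = splitAt {p} {q} {r} pqr p vs ps in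
      linarith 5 (λ l m n a b → l :≤ m :+ n ⟹ m :≤ a ⟹ n :≤ b ⟹ l :≤ a :+ b) len
        (polygonLength-≤-arc us us✓) (polygonLength-≤-arc ws ws✓))
    (linarith 3 (λ a b c → a :≤ c :- b ⟹ a :+ b :≤ c)
      (arc-least λ vs vs✓ → linarith 3 (λ m b c → b :≤ c :- m ⟹ m :≤ c :- b)
        (arc-least λ ws ws✓ → linarith 4 (λ m n l c → l :≈ m :+ n ⟹ l :≤ c ⟹ n :≤ c :- m)
          (polygonLength-++ p vs q ws r) (polygonLength-≤-arc (vs ++ q ∷ ws) (join vs ws vs✓ ws✓)))))
    where
    join : ∀ vs ws → Inscribed p vs q → Inscribed q ws r → Inscribed p (vs ++ q ∷ ws) r
    join []       ws _  qs = Inscribed-retreat ws pqr qs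
    join (v ∷ vs) ws ps qs = Path-++ vs ws ps (Inscribed-retreat ws pqr qs)

-- Circles of arbitrary circumference, described by one coordinate

module Coordinates (ℝ : CompleteOrderedField) (lem : ExcludedMiddle 0ℓ) where

  open Analysis ℝ lem
  open MinOp (Min.minOperator totalOrder) using (⊓-cong; ⊓-comm) public
  open MaxOp (Max.maxOperator totalOrder) using (⊔-cong) public

  -- The distance on a circle of length c between the points with coordinates s and t in [0, c).
  circular : Carrier → Carrier → Carrier → Carrier
  circular c s t = min ∣ s - t ∣ (c - ∣ s - t ∣)

  -- The meeting ground of X and `S¹`: both are brought to this form, and any two spaces that have
  -- it are similar.
  record CircularCoordinates {a ℓ} (Y : DistanceSpace ℝ a ℓ) : Set (a ⊔ ℓ) where
    private
      module Y = DistanceSpace Y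
    field
      circumference : Carrier
      0<c           : 0# < circumference
      coord         : Y.Carrier → Carrier
      0≤coord       : ∀ p → 0# ≤ coord p
      coord<c       : ∀ p → coord p < circumference
      coord-cong    : ∀ {p q} → p Y.≈ q → coord p ≈ coord q
      coord-injective : ∀ {p q} → coord p ≈ coord q → p Y.≈ q
      coord-surjective : ∀ {t} → 0# ≤ t → t < circumference → ∃ λ p → coord p ≈ t
      d-coord       : ∀ p q → Y.d p q ≈ circular circumference (coord p) (coord q)

  circular-cases : ∀ {c s t} → 0# ≤ s → s ≤ t → t < c →
    (2 · (t - s) ≤ c × circular c s t ≈ t - s) ⊎ (c ≤ 2 · (t - s) × circular c s t ≈ c - (t - s))
  circular-cases {c} {s} {t} 0≤s s≤t t<c = Sum.map
    (λ (a≤ , m≈) → linarith 4 (λ a s t c → a :≤ c :- a ⟹ a :≈ :- (s :- t) ⟹ 2 :× (t :- s) :≤ c) a≤ a≈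
      , trans m≈ (trans a≈ (linarith 2 (λ s t → :- (s :- t) :≈ t :- s))))
    (λ (a≥ , m≈) → linarith 4 (λ a s t c → c :- a :≤ a ⟹ a :≈ :- (s :- t) ⟹ c :≤ 2 :× (t :- s)) a≥ a≈
      , trans m≈ (linarith 4 (λ a s t c → a :≈ :- (s :- t) ⟹ c :- a :≈ c :- (t :- s)) a≈))
    (min-cases ∣ s - t ∣ (c - ∣ s - t ∣))
    where
    a≈ = ∣∣-nonpos {s - t} (linarith 2 (λ s t → s :≤ t ⟹ s :- t :≤ :0) s≤t)

  ∣∣-sym : ∀ a b → ∣ a - b ∣ ≈ ∣ b - a ∣
  ∣∣-sym a b = Sum.[_,_]′
    (λ a≤b → trans (∣∣-nonpos (linarith 2 (λ a b → a :≤ b ⟹ a :- b :≤ :0) a≤b))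
        (trans (linarith 2 (λ a b → :- (a :- b) :≈ b :- a))
          (sym (∣∣-nonneg (linarith 2 (λ a b → a :≤ b ⟹ :0 :≤ b :- a) a≤b)))))
    (λ b≤a → trans (∣∣-nonneg (linarith 2 (λ a b → b :≤ a ⟹ :0 :≤ a :- b) b≤a))
        (trans (linarith 2 (λ a b → a :- b :≈ :- (b :- a)))
          (sym (∣∣-nonpos (linarith 2 (λ a b → b :≤ a ⟹ b :- a :≤ :0) b≤a)))))
    (≤.total a b)

  circular-sym : ∀ c s t → circular c s t ≈ circular c t s
  circular-sym c s t = ⊓-cong (∣∣-sym s t) (+-congˡ (-‿cong (∣∣-sym s t)))

-- The unit circle parametrised by arc length

module CircleCoordinates (ℝ : CompleteOrderedField) (lem : ExcludedMiddle 0ℓ) where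

  open ArcLength ℝ lem
  open Coordinates ℝ lem

  perimeter : Point → Point → Carrier
  perimeter p q = arc p q + arc q p

  -- Both sides are the sum of the three arcs from p to q, from q to r and from r to p.
  perimeter-step : ∀ {p q r} → Anticlockwise p q r → perimeter p q ≈ perimeter p r
  perimeter-step {p} {q} {r} pqr = linarith 5 (λ pq qr rp pr qp →
      pr :≈ pq :+ qr ⟹ qp :≈ qr :+ rp ⟹ pq :+ qp :≈ pr :+ rp)
    (arc-additive {p} {q} {r} pqr) (arc-additive {q} {r} {p} (Acw-cyclic {p} {q} {r} pqr))

  perimeter-cong : ∀ {p p′ q q′} → p ≈ₚ p′ → q ≈ₚ q′ → perimeter p q ≈ perimeter p′ q′
  perimeter-cong {p} {p′} {q} {q′} e f =
    +-cong (arc-cong {p} {p′} {q} {q′} e f) (arc-cong {q} {q′} {p} {p′} f e)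

  perimeter-const₁ : ∀ p q r → p ≉ₚ q → p ≉ₚ r → perimeter p q ≈ perimeter p r
  perimeter-const₁ p q r p≉q p≉r with Acw-total p q r p≉q p≉r
  ... | inj₁ pqr        = perimeter-step {p} {q} {r} pqr
  ... | inj₂ (inj₁ q≈r) = perimeter-cong {p} {p} {q} {r} (≈ₚ-refl {p}) q≈r
  ... | inj₂ (inj₂ prq) = sym (perimeter-step {p} {r} {q} prq)

  abstract
    right left : Point
    right = point (1# , 0#) (linarith 0 (:1 :* :1 :+ :0 :* :0 :≈ :1))
    left  = point (- 1# , 0#) (linarith 0 ((:- :1) :* (:- :1) :+ :0 :* :0 :≈ :1))

    right≉left : right ≉ₚ left
    right≉left (1≈-1 , _) = linarith 0 (:1 :≈ :- :1 ⟹ :⊥) 1≈-1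

  2π : Carrier
  2π = perimeter right left

  perimeter-2π : ∀ p q → p ≉ₚ q → perimeter p q ≈ 2π
  perimeter-2π p q p≉q with lem {p ≈ₚ right}
  ... | yes p≈right = trans (perimeter-cong {p} {right} {q} {q} p≈right (≈ₚ-refl {q}))
    (perimeter-const₁ right q left
      (λ (e , f) → p≉q (trans (proj₁ p≈right) e , trans (proj₂ p≈right) f)) right≉left)
  ... | no p≉right = trans (perimeter-const₁ p q right p≉q p≉right)
    (trans (+-comm _ _) (perimeter-const₁ right p left
      (λ e → p≉right (≈ₚ-sym {right} {p} e)) right≉left))

  0<2π : 0# < 2π
  0<2π = linarith 2 (λ a b → :0 :< a ⟹ :0 :≤ b ⟹ :0 :< a :+ b) (arc-pos right left right≉left)
    (arc-nonneg left right)

  arc-order : ∀ p q r → arc p r ≈ arc p q + arc q r ⊎ arc p q ≈ arc p r + arc r q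
  arc-order p q r with lem {p ≈ₚ q} | lem {p ≈ₚ r}
  ... | yes p≈q | _ = inj₁ (linarith 3 (λ pr pq qr → pr :≈ qr ⟹ pq :≈ :0 ⟹ pr :≈ pq :+ qr)
    (arc-cong {p} {q} {r} {r} p≈q (≈ₚ-refl {r})) (arc-zero {p} {q} p≈q))
  ... | no _ | yes p≈r = inj₂ (linarith 3 (λ pq pr rq → pq :≈ rq ⟹ pr :≈ :0 ⟹ pq :≈ pr :+ rq)
    (arc-cong {p} {r} {q} {q} p≈r (≈ₚ-refl {q})) (arc-zero {p} {r} p≈r))
  ... | no p≉q | no p≉r with Acw-total p q r p≉q p≉r
  ...   | inj₁ pqr        = inj₁ (arc-additive {p} {q} {r} pqr)
  ...   | inj₂ (inj₁ q≈r) = inj₁ (linarith 3 (λ pr pq qr → pr :≈ pq ⟹ qr :≈ :0 ⟹ pr :≈ pq :+ qr)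
    (arc-cong {p} {p} {r} {q} (≈ₚ-refl {p}) (≈ₚ-sym {q} {r} q≈r)) (arc-zero {q} {r} q≈r))
  ...   | inj₂ (inj₂ prq) = inj₂ (arc-additive {p} {r} {q} prq)

  module _ {b p q} (bpq : Anticlockwise b p q) where

    private
      b≉p = proj₁ (Acw⇒≉ {b} {p} {q} bpq)
      b≉q = proj₁ (proj₂ (Acw⇒≉ {b} {p} {q} bpq))

      slope-injective : ∀ {s t} → b ≉ₚ s → b ≉ₚ t → slope b s ≈ slope b t → s ≈ₚ t
      slope-injective {s} {t} b≉s b≉t e with Acw-total b s t b≉s b≉t
      ... | inj₁ bst        = ⊥-elim (proj₂ (Acw⇒slope< {b} {s} {t} bst) e)
      ... | inj₂ (inj₁ s≈t) = s≈t
      ... | inj₂ (inj₂ bts) = ⊥-elim (proj₂ (Acw⇒slope< {b} {t} {s} bts) (sym e))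

      at : Carrier → Point
      at k = proj₁ (pointAt b k)

      b≉at : ∀ k → b ≉ₚ at k
      b≉at k = proj₁ (proj₂ (pointAt b k))

      slope-at : ∀ k → slope b (at k) ≈ k
      slope-at k = proj₂ (proj₂ (pointAt b k))

      at-≤ : ∀ {s t} → b ≉ₚ s → b ≉ₚ t → slope b s ≤ slope b t → s ≈ₚ t ⊎ Anticlockwise b s t
      at-≤ {s} {t} b≉s b≉t s≤t with Acw-total b s t b≉s b≉t
      ... | inj₁ bst        = inj₂ bst
      ... | inj₂ (inj₁ s≈t) = inj₁ s≈t
      ... | inj₂ (inj₂ bts) =
        ⊥-elim (linarith 2 (λ s t → s :≤ t ⟹ t :< s ⟹ :⊥) s≤t (Acw⇒slope< {b} {t} {s} bts))

      short : ∀ {s t} → b ≉ₚ s → b ≉ₚ t → slope b s ≤ slope b t → arc s t ≤ 2 · (slope b t - slope b s)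
      short {s} {t} b≉s b≉t s≤t with at-≤ {s} {t} b≉s b≉t s≤t
      ... | inj₁ s≈t = linarith 3 (λ a k l → a :≈ :0 ⟹ k :≤ l ⟹ a :≤ 2 :× (l :- k))
        (arc-zero {s} {t} s≈t) s≤t
      ... | inj₂ bst = arc-slope {b} {s} {t} (Acw-cyclic {b} {s} {t} bst)

      additive : ∀ {s t} → b ≉ₚ s → b ≉ₚ t → slope b p ≤ slope b s → slope b s ≤ slope b t →
        arc p t ≈ arc p s + arc s t
      additive {s} {t} b≉s b≉t p≤s s≤t with at-≤ {p} {s} b≉p b≉s p≤s | at-≤ {s} {t} b≉s b≉t s≤t
      ... | inj₁ p≈s | _ = linarith 3 (λ pt ps st → pt :≈ st ⟹ ps :≈ :0 ⟹ pt :≈ ps :+ st)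
        (arc-cong {p} {s} {t} {t} p≈s (≈ₚ-refl {t})) (arc-zero {p} {s} p≈s)
      ... | _ | inj₁ s≈t = linarith 3 (λ pt ps st → pt :≈ ps ⟹ st :≈ :0 ⟹ pt :≈ ps :+ st)
        (arc-cong {p} {p} {t} {s} (≈ₚ-refl {p}) (≈ₚ-sym {s} {t} s≈t)) (arc-zero {s} {t} s≈t)
      ... | inj₂ bps | inj₂ bst = arc-additive {p} {s} {t} (Acw-drop {b} {p} {s} {t} bps bst)

    -- With b outside the arc, `at` parametrises the circle minus b by the slope. In this parameter
    -- the arc length from p grows at rate at most 2, so the intermediate value theorem applies.
    arc-surjective′ : ∀ {τ} → 0# ≤ τ → τ ≤ arc p q →
      ∃ λ s → arc p s ≈ τ × arc p q ≈ arc p s + arc s q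
    arc-surjective′ {τ} 0≤τ τ≤pq = let
      (k , p≤k , k≤q , fk≈τ) = intermediateValue (λ k → arc p (at k)) {slope b p} {slope b q} {τ}
        (<⇒≤ (Acw⇒slope< {b} {p} {q} bpq)) lipschitz
        (≤-resp-≈ (sym (arc-zero {p} {at (slope b p)}
          (≈ₚ-sym {at (slope b p)} {p}
          (slope-injective {at (slope b p)} {p} (b≉at _) b≉p (slope-at _))))) refl 0≤τ)
        (≤-resp-≈ refl (arc-cong {p} {p} {q} {at (slope b q)} (≈ₚ-refl {p})
          (≈ₚ-sym {at (slope b q)} {q}
          (slope-injective {at (slope b q)} {q} (b≉at _) b≉q (slope-at _)))) τ≤pq)
      in at k , fk≈τ , additive {at k} {q} (b≉at k) b≉q (≤-resp-≈ refl (sym (slope-at k)) p≤k)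
        (≤-resp-≈ (sym (slope-at k)) refl k≤q)
      where
      lipschitz : ∀ {k l} → slope b p ≤ k → k ≤ l → l ≤ slope b q →
        arc p (at l) - arc p (at k) ≤ 2 · (l - k)
      lipschitz {k} {l} p≤k k≤l _ =
        linarith 7 (λ pl pk kl k l k′ l′ → pl :≈ pk :+ kl ⟹ kl :≤ 2 :× (l′ :- k′) ⟹
          l′ :≈ l ⟹ k′ :≈ k ⟹ pl :- pk :≤ 2 :× (l :- k))
        (additive {at k} {at l} (b≉at k) (b≉at l) (≤-resp-≈ refl (sym (slope-at k)) p≤k) k′≤l′)
        (short {at k} {at l} (b≉at k) (b≉at l) k′≤l′) (slope-at l) (slope-at k)
        where
        k′≤l′ = ≤-resp-≈ (sym (slope-at k)) (sym (slope-at l)) k≤l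

  arc-surjective : ∀ {p q τ} → p ≉ₚ q → 0# ≤ τ → τ ≤ arc p q →
    ∃ λ s → arc p s ≈ τ × arc p q ≈ arc p s + arc s q
  arc-surjective {p} {q} p≉q = let (b , pqb) = beyond {p} {q} p≉q in
    arc-surjective′ {b} {p} {q} (Acw-cyclic⁻¹ {p} {q} {b} pqb)

  circleCoordinates : CircularCoordinates (S¹ ℝ lem)
  circleCoordinates = record
    { circumference = 2π
    ; 0<c = 0<2π
    ; coord = arc right
    ; 0≤coord = arc-nonneg right
    ; coord<c = below
    ; coord-cong = λ {p} {q} → arc-cong {right} {right} {p} {q} (≈ₚ-refl {right})
    ; coord-injective = injective
    ; coord-surjective = surjective
    ; d-coord = λ p q → ≡.subst₂ (λ u v → min u v ≈ circular 2π (arc right p) (arc right q))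
      (arc≡arcLength p q) (arc≡arcLength q p) (distance p q)
    }
    where
    below : ∀ p → arc right p < 2π
    below p with lem {right ≈ₚ p}
    ... | yes r≈p = linarith 2 (λ a c → a :≈ :0 ⟹ :0 :< c ⟹ a :< c) (arc-zero {right} {p} r≈p) 0<2π
    ... | no  r≉p = linarith 3 (λ a b c → a :+ b :≈ c ⟹ :0 :< b ⟹ a :< c) (perimeter-2π right p r≉p)
      (arc-pos p right λ e → r≉p (≈ₚ-sym {p} {right} e))

    injective : ∀ {p q} → arc right p ≈ arc right q → p ≈ₚ q
    injective {p} {q} e = decidable-stable lem λ p≉q → case arc-order right p q of λ where
      (inj₁ f) → linarith 3 (λ a b c → a :≈ b ⟹ b :≈ a :+ c ⟹ :0 :< c ⟹ :⊥) e f (arc-pos p q p≉q)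
      (inj₂ f) → linarith 3 (λ a b c → a :≈ b ⟹ a :≈ b :+ c ⟹ :0 :< c ⟹ :⊥) e f
        (arc-pos q p λ e → p≉q (≈ₚ-sym {q} {p} e))

    -- `arc-surjective` asks for an arc with distinct ends, so the circle is covered by its two
    -- halves between `right` and `left`.
    surjective : ∀ {t} → 0# ≤ t → t < 2π → ∃ λ p → arc right p ≈ t
    surjective {t} 0≤t t<2π with ≤-or-> t (arc right left)
    ... | inj₁ t≤π = let (s , e , _) = arc-surjective {right} {left} right≉left 0≤t t≤π in s , e
    ... | inj₂ π<t = let
        (s , e , f) = arc-surjective {left} {right} {t - arc right left}
          (λ e → right≉left (≈ₚ-sym {left} {right} e))
          (linarith 2 (λ a t → a :< t ⟹ :0 :≤ t :- a) π<t)
          (linarith 3 (λ a b t → t :< a :+ b ⟹ t :- a :≤ b) t<2π)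
      in s , (case arc-order right left s of λ where
        (inj₁ g) → linarith 4 (λ rs rl ls t → rs :≈ rl :+ ls ⟹ ls :≈ t :- rl ⟹ rs :≈ t) g e
        -- Here s would lie on both halves. Adding up the arcs leaves no room between s and `right`,
        -- so t would be the whole perimeter.
        (inj₂ g) → ⊥-elim (linarith 7 (λ rl lr rs sr ls sl t →
            ls :≈ t :- rl ⟹ rl :≈ rs :+ sl ⟹ lr :≈ ls :+ sr ⟹ ls :+ sl :≈ rl :+ lr ⟹
            :0 :≤ rs ⟹ :0 :≤ sr ⟹ t :< rl :+ lr ⟹ :⊥)
          e g f (perimeter-2π left s λ l≈s →
            linarith 3 (λ rl ls t → ls :≈ t :- rl ⟹ ls :≈ :0 ⟹ rl :< t ⟹ :⊥)
            e (arc-zero {left} {s} l≈s) π<t)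
          (arc-nonneg right s) (arc-nonneg s right) t<2π))

    -- The arc from p to q is the difference of the coordinates and the arc back is its complement
    -- in 2π. Coinciding points are treated apart, as both arcs between them are 0.
    forward : ∀ p q → arc right q ≈ arc right p + arc p q →
      min (arc p q) (arc q p) ≈ circular 2π (arc right p) (arc right q)
    forward p q e = shorter (circular-cases (arc-nonneg right p) s≤t (below q))
      (min-cases (arc p q) (arc q p)) (lem {p ≈ₚ q})
      where
      s≤t : arc right p ≤ arc right q
      s≤t = linarith 3 (λ s t u → t :≈ s :+ u ⟹ :0 :≤ u ⟹ s :≤ t) e (arc-nonneg p q)

      shorter : ∀ {m g} →
        (2 · (arc right q - arc right p) ≤ 2π × g ≈ arc right q - arc right p) ⊎
        (2π ≤ 2 · (arc right q - arc right p) × g ≈ 2π - (arc right q - arc right p)) →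
        (arc p q ≤ arc q p × m ≈ arc p q) ⊎ (arc q p ≤ arc p q × m ≈ arc q p) → Dec (p ≈ₚ q) → m ≈ g
      shorter (inj₁ (_ , g≈)) m (yes p≈q) =
        linarith 5 (λ s t u m g → g :≈ t :- s ⟹ t :≈ s :+ u ⟹ u :≈ :0 ⟹ m :≈ :0 ⟹ m :≈ g)
        g≈ e (arc-zero {p} {q} p≈q) (m≈0 m)
        where
        m≈0 = Sum.[ (λ (_ , m≈) → trans m≈ (arc-zero {p} {q} p≈q)) ,
          (λ (_ , m≈) → trans m≈ (arc-zero {q} {p} (≈ₚ-sym {p} {q} p≈q))) ]′
      shorter (inj₂ (c≤ , _)) _ (yes p≈q) =
        ⊥-elim (linarith 4 (λ s t u c → c :≤ 2 :× (t :- s) ⟹ t :≈ s :+ u ⟹ u :≈ :0 ⟹ :0 :< c ⟹ :⊥)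
        c≤ e (arc-zero {p} {q} p≈q) 0<2π)
      shorter (inj₁ (_ , g≈)) (inj₁ (_ , m≈)) (no _) =
        linarith 5 (λ s t u m g → g :≈ t :- s ⟹ m :≈ u ⟹ t :≈ s :+ u ⟹ m :≈ g) g≈ m≈ e
      shorter (inj₁ (h , g≈)) (inj₂ (l , m≈)) (no p≉q) = linarith 7 (λ s t u v m g c →
          2 :× (t :- s) :≤ c ⟹ v :≤ u ⟹ g :≈ t :- s ⟹ m :≈ v ⟹ t :≈ s :+ u ⟹ u :+ v :≈ c ⟹ m :≈ g)
        h l g≈ m≈ e (perimeter-2π p q p≉q)
      shorter (inj₂ (h , g≈)) (inj₁ (l , m≈)) (no p≉q) = linarith 7 (λ s t u v m g c →
          c :≤ 2 :× (t :- s) ⟹ u :≤ v ⟹ g :≈ c :- (t :- s) ⟹ m :≈ u ⟹ t :≈ s :+ u ⟹ u :+ v :≈ c ⟹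
            m :≈ g)
        h l g≈ m≈ e (perimeter-2π p q p≉q)
      shorter (inj₂ (_ , g≈)) (inj₂ (_ , m≈)) (no p≉q) = linarith 7 (λ s t u v m g c →
          g :≈ c :- (t :- s) ⟹ m :≈ v ⟹ t :≈ s :+ u ⟹ u :+ v :≈ c ⟹ m :≈ g)
        g≈ m≈ e (perimeter-2π p q p≉q)

    distance : ∀ p q → min (arc p q) (arc q p) ≈ circular 2π (arc right p) (arc right q)
    distance p q with arc-order right p q
    ... | inj₁ e = forward p q e
    ... | inj₂ e = trans (⊓-comm _ _) (trans (forward q p e) (circular-sym 2π _ _))

-- Nets

module Net (ℝ : CompleteOrderedField) {a ℓ : Level} (X : DistanceSpace ℝ a ℓ) where

  open CompleteOrderedField ℝ using (0#; _≤_; _<_) renaming (Carrier to R)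
  open DistanceSpace X

  -- A triangle a with a pendant vertex at each corner, as far as it can be
  -- seen in a unit ball graph; the pendant vertices b may be adjacent.
  IsNet : R → (Fin 3 → Carrier) → (Fin 3 → Carrier) → Set
  IsNet δ a b = (∀ i j → i ≢ j → d (a i) (a j) ≤ δ) × (∀ i → d (a i) (b i) ≤ δ) ×
    (∀ i j → i ≢ j → ¬ (d (b i) (a j) ≤ δ))

  NetFree : Set a
  NetFree = ∀ {δ} a b → 0# < δ → ¬ IsNet δ a b

-- Geodesic spaces: segments, concatenation, coordinates from a parametrisation

module GeodesicSpace
  (ℝ : CompleteOrderedField) (lem : ExcludedMiddle 0ℓ)
  {a ℓ : Level} (X : DistanceSpace ℝ a ℓ) (isGeodesic : IsGeodesicSpace ℝ X) where

  open Analysis ℝ lem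
  open Coordinates ℝ lem
  open Net ℝ X
  private
    module X = DistanceSpace X
    module M = IsGeneralMetric (proj₁ isGeodesic)
    open X using (d)

  d-resp : ∀ {p p′ q q′} → p X.≈ p′ → q X.≈ q′ → d p q ≈ d p′ q′
  d-resp e f = M.cong e f

  -- A geodesic as a total function, constrained on [0, l] alone, so that points can be named
  -- without proofs of their parameter bounds and segments can be cut, reversed and glued by
  -- arithmetic on parameters.
  record Segment (l : Carrier) : Set a where
    field
      pt        : Carrier → X.Carrier
      0≤l       : 0# ≤ l
      isometric : ∀ {s t} → 0# ≤ s → s ≤ t → t ≤ l → d (pt s) (pt t) ≈ t - s

    isometric-sym : ∀ {s t} → 0# ≤ s → s ≤ t → t ≤ l → d (pt t) (pt s) ≈ t - s
    isometric-sym 0≤s s≤t t≤l = trans (M.sym _ _) (isometric 0≤s s≤t t≤l)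

    pt-cong : ∀ {s t} → 0# ≤ s → s ≈ t → t ≤ l → pt s X.≈ pt t
    pt-cong 0≤s s≈t t≤l = M.0⇒≈ (trans (isometric 0≤s (≤.reflexive s≈t) t≤l)
      (linarith 2 (λ s t → s :≈ t ⟹ t :- s :≈ :0) s≈t))

    from-start : ∀ {t} → 0# ≤ t → t ≤ l → d (pt 0#) (pt t) ≈ t
    from-start 0≤t t≤l = trans (isometric ≤.refl 0≤t t≤l) (linarith 1 (λ t → t :- :0 :≈ t))

  open Segment

  infix 4 _∈_ _∉_

  _∈_ _∉_ : X.Carrier → ∀ {l} → Segment l → Set ℓ
  _∈_ p {l} γ = ∃ λ t → 0# ≤ t × t ≤ l × pt γ t X.≈ p
  p ∉ γ       = ¬ (p ∈ γ)

  geodesic : ∀ x y → ∃ λ (γ : Segment (d x y)) → pt γ 0# X.≈ x × pt γ (d x y) X.≈ y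
  geodesic x y = segment , at-start , at-end
    where
    open Geodesic (proj₂ isGeodesic x y)

    extended : Carrier → X.Carrier
    extended t with lem {0# ≤ t × t ≤ d x y}
    ... | yes inside = γ (t , inside)
    -- A default value outside the domain of the geodesic.
    ... | no  _      = x

    extended-≈ : ∀ t (inside : 0# ≤ t × t ≤ d x y) → extended t X.≈ γ (t , inside)
    extended-≈ t inside with lem {0# ≤ t × t ≤ d x y}
    ... | no  outside = ⊥-elim (outside inside)
    ... | yes inside′ = M.0⇒≈ (trans (Geodesic.isometric (proj₂ isGeodesic x y) _ _)
      (trans (∣∣-nonneg (linarith 1 (λ t → :0 :≤ t :- t))) (linarith 1 (λ t → t :- t :≈ :0))))

    segment : Segment (d x y)
    segment = record
      { pt  = extended
      ; 0≤l = M.nonNegative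
      ; isometric = λ {s} {t} 0≤s s≤t t≤l →
          trans (d-resp (extended-≈ s (0≤s , ≤.trans s≤t t≤l)) (extended-≈ t (≤.trans 0≤s s≤t , t≤l)))
          (trans (Geodesic.isometric (proj₂ isGeodesic x y) _ _)
          (trans (∣∣-nonpos (linarith 2 (λ s t → s :≤ t ⟹ s :- t :≤ :0) s≤t))
            (linarith 2 (λ s t → :- (s :- t) :≈ t :- s))))
      }

    at-start = M.EqC.trans (extended-≈ 0# (≤.refl , M.nonNegative)) (start _ refl)
    at-end   = M.EqC.trans (extended-≈ (d x y) (M.nonNegative , ≤.refl)) (end _ refl)

  module _ {l : Carrier} (γ : Segment l) where

    prefix : ∀ {k} → 0# ≤ k → k ≤ l → Segment k
    prefix 0≤k k≤l = record
      { pt  = pt γ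
      ; 0≤l = 0≤k
      ; isometric = λ 0≤s s≤t t≤k → isometric γ 0≤s s≤t (≤.trans t≤k k≤l)
      }

    forwardFrom : ∀ {u} → 0# ≤ u → u ≤ l → Segment (l - u)
    forwardFrom {u} 0≤u u≤l = record
      { pt  = λ t → pt γ (u + t)
      ; 0≤l = linarith 2 (λ u l → u :≤ l ⟹ :0 :≤ l :- u) u≤l
      ; isometric = λ 0≤s s≤t t≤ → trans
          (isometric γ (linarith 2 (λ u s → :0 :≤ u ⟹ :0 :≤ s ⟹ :0 :≤ u :+ s) 0≤u 0≤s)
            (linarith 3 (λ u s t → s :≤ t ⟹ u :+ s :≤ u :+ t) s≤t)
            (linarith 3 (λ u t l → t :≤ l :- u ⟹ u :+ t :≤ l) t≤))
          (linarith 3 (λ u s t → (u :+ t) :- (u :+ s) :≈ t :- s))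
      }

    backwardFrom : ∀ {u} → 0# ≤ u → u ≤ l → Segment u
    backwardFrom {u} 0≤u u≤l = record
      { pt  = λ t → pt γ (u - t)
      ; 0≤l = 0≤u
      ; isometric = λ 0≤s s≤t t≤u → trans
          (isometric-sym γ (linarith 2 (λ u t → t :≤ u ⟹ :0 :≤ u :- t) t≤u)
            (linarith 3 (λ u s t → s :≤ t ⟹ u :- t :≤ u :- s) s≤t)
            (linarith 3 (λ u s l → u :≤ l ⟹ :0 :≤ s ⟹ u :- s :≤ l) u≤l 0≤s))
          (linarith 3 (λ u s t → (u :- s) :- (u :- t) :≈ t :- s))
      }

  Concatenation : ∀ {l m n} → Segment l → Segment m → Segment n → Set ℓ
  Concatenation {l} {m} γ δ σ =
    (∀ {t} → 0# ≤ t → t ≤ l → pt σ t X.≈ pt γ t) × (∀ {t} → 0# ≤ t → t ≤ m → pt σ (l + t) X.≈ pt δ t)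

  abstract
    -- A path of length n between points at distance at least n has no shortcuts: if a point of γ
    -- and a point of δ were closer than along the path, so would be its ends.
    concatenate : ∀ {l m n} (γ : Segment l) (δ : Segment m) → l + m ≈ n →
      pt γ l X.≈ pt δ 0# → n ≤ d (pt γ 0#) (pt δ m) → ∃ λ (σ : Segment n) → Concatenation γ δ σ
    concatenate {l} {m} {n} γ δ l+m≈n γl≈δ0 n≤d = σ , (λ 0≤t t≤l → joined-left 0≤t t≤l) , right
      where
      joined : Carrier → X.Carrier
      joined t with lem {t ≤ l}
      ... | yes _ = pt γ t
      ... | no  _ = pt δ (t - l)

      joined-left : ∀ {t} → 0# ≤ t → t ≤ l → joined t X.≈ pt γ t
      joined-left {t} 0≤t t≤l with lem {t ≤ l}
      ... | yes _   = M.EqC.refl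
      ... | no  t≰l = ⊥-elim (t≰l t≤l)

      joined-right : ∀ {t} → l ≤ t → t ≤ n → joined t X.≈ pt δ (t - l)
      joined-right {t} l≤t t≤n with lem {t ≤ l}
      ... | no  _   = M.EqC.refl
      ... | yes t≤l = M.EqC.trans (pt-cong γ (≤.trans (0≤l γ) l≤t) (≤.antisym t≤l l≤t) ≤.refl)
        (M.EqC.trans γl≈δ0
        (pt-cong δ ≤.refl (linarith 2 (λ t l → t :≤ l ⟹ l :≤ t ⟹ :0 :≈ t :- l) t≤l l≤t)
          (linarith 4 (λ t l m n → t :≤ n ⟹ l :+ m :≈ n ⟹ t :- l :≤ m) t≤n l+m≈n)))

      right : ∀ {t} → 0# ≤ t → t ≤ m → joined (l + t) X.≈ pt δ t
      right {t} 0≤t t≤m = M.EqC.trans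
        (joined-right (linarith 2 (λ l t → :0 :≤ t ⟹ l :≤ l :+ t) 0≤t)
          (linarith 4 (λ l m n t → t :≤ m ⟹ l :+ m :≈ n ⟹ l :+ t :≤ n) t≤m l+m≈n))
        (pt-cong δ (linarith 2 (λ l t → :0 :≤ t ⟹ :0 :≤ l :+ t :- l) 0≤t)
          (linarith 2 (λ l t → l :+ t :- l :≈ t)) t≤m)

      across : ∀ {s t} → 0# ≤ s → s ≤ l → l ≤ t → t ≤ n → d (pt γ s) (pt δ (t - l)) ≈ t - s
      across {s} {t} 0≤s s≤l l≤t t≤n = ≤.antisym
        (linarith 6 (λ st sl lt s t l → st :≤ sl :+ lt ⟹ sl :≈ l :- s ⟹ lt :≈ t :- l :- :0 ⟹
          st :≤ t :- s)
          (M.triangle _ (pt γ l) _) (isometric γ 0≤s s≤l ≤.refl)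
            (trans (d-resp γl≈δ0 M.EqC.refl) (isometric δ ≤.refl 0≤t-l t-l≤m)))
        (linarith 10 (λ st 0s tn sn 0n s t l m n → n :≤ 0n ⟹ 0n :≤ 0s :+ sn ⟹ sn :≤ st :+ tn ⟹
          0s :≈ s :- :0 ⟹
            tn :≈ m :- (t :- l) ⟹ l :+ m :≈ n ⟹ t :- s :≤ st)
          n≤d (M.triangle _ (pt γ s) _) (M.triangle _ (pt δ (t - l)) _) (isometric γ ≤.refl 0≤s s≤l)
          (isometric δ 0≤t-l t-l≤m ≤.refl) l+m≈n)
        where
        0≤t-l : 0# ≤ t - l
        0≤t-l = linarith 2 (λ t l → l :≤ t ⟹ :0 :≤ t :- l) l≤t

        t-l≤m : t - l ≤ m
        t-l≤m = linarith 4 (λ t l m n → t :≤ n ⟹ l :+ m :≈ n ⟹ t :- l :≤ m) t≤n l+m≈n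

      joined-isometric : ∀ {s t} → 0# ≤ s → s ≤ t → t ≤ n → d (joined s) (joined t) ≈ t - s
      joined-isometric {s} {t} 0≤s s≤t t≤n = case (≤.total t l , ≤.total s l) of λ where
        (inj₁ t≤l , _) → trans
          (d-resp (joined-left 0≤s (≤.trans s≤t t≤l)) (joined-left (≤.trans 0≤s s≤t) t≤l))
          (isometric γ 0≤s s≤t t≤l)
        (inj₂ l≤t , inj₁ s≤l) →
          trans (d-resp (joined-left 0≤s s≤l) (joined-right l≤t t≤n)) (across 0≤s s≤l l≤t t≤n)
        (inj₂ l≤t , inj₂ l≤s) →
          trans (d-resp (joined-right l≤s (≤.trans s≤t t≤n)) (joined-right l≤t t≤n))
          (trans (isometric δ (linarith 2 (λ t l → l :≤ t ⟹ :0 :≤ t :- l) l≤s)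
              (linarith 3 (λ s t l → s :≤ t ⟹ s :- l :≤ t :- l) s≤t)
              (linarith 4 (λ t l m n → t :≤ n ⟹ l :+ m :≈ n ⟹ t :- l :≤ m) t≤n l+m≈n))
            (linarith 3 (λ s t l → (t :- l) :- (s :- l) :≈ t :- s)))

      σ : Segment n
      σ = record
        { pt  = joined
        ; 0≤l = linarith 3 (λ l m n → :0 :≤ l ⟹ :0 :≤ m ⟹ l :+ m :≈ n ⟹ :0 :≤ n) (0≤l γ) (0≤l δ) l+m≈n
        ; isometric = joined-isometric
        }

  ∈-concatenation : ∀ {l m n w} (γ : Segment l) (δ : Segment m) (σ : Segment n) → l + m ≈ n →
    Concatenation γ δ σ → w ∈ σ → w ∈ γ ⊎ w ∈ δ
  ∈-concatenation {l} {m} {n} {w} γ δ σ l+m≈n (on-γ , on-δ) (t , 0≤t , t≤n , σt≈w) =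
    Sum.map before after (≤.total t l)
    where
    before : t ≤ l → w ∈ γ
    before t≤l = t , 0≤t , t≤l , M.EqC.trans (M.EqC.sym (on-γ 0≤t t≤l)) σt≈w

    after : l ≤ t → w ∈ δ
    after l≤t = t - l , 0≤t-l , t-l≤m ,
      M.EqC.trans (M.EqC.sym (on-δ 0≤t-l t-l≤m)) (M.EqC.trans (pt-cong σ 0≤l+[t-l] l+[t-l]≈t t≤n) σt≈w)
      where
      0≤t-l : 0# ≤ t - l
      0≤t-l = linarith 2 (λ t l → l :≤ t ⟹ :0 :≤ t :- l) l≤t

      t-l≤m : t - l ≤ m
      t-l≤m = linarith 4 (λ t l m n → t :≤ n ⟹ l :+ m :≈ n ⟹ t :- l :≤ m) t≤n l+m≈n

      l+[t-l]≈t : l + (t - l) ≈ t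
      l+[t-l]≈t = linarith 2 λ t l → l :+ (t :- l) :≈ t

      0≤l+[t-l] : 0# ≤ l + (t - l)
      0≤l+[t-l] = ≤-resp-≈ refl (sym l+[t-l]≈t) 0≤t

  -- Membership lives at level ℓ but excluded middle is given at level 0, so the decision is made on
  -- a real distance being 0.
  ∈-or-∉ : ∀ {l} w (γ : Segment l) → w ∈ γ ⊎ w ∉ γ
  ∈-or-∉ {l} w γ with lem {∃ λ t → 0# ≤ t × t ≤ l × d (pt γ t) w ≈ 0#}
  ... | yes (t , 0≤t , t≤l , d≈0) = inj₁ (t , 0≤t , t≤l , M.0⇒≈ d≈0)
  ... | no  none                  = inj₂ λ (t , 0≤t , t≤l , γt≈w) → none (t , 0≤t , t≤l , M.≈⇒0 γt≈w)

  circular-zero : ∀ {c s t} → 0# ≤ s → s ≤ t → t < c → circular c s t ≈ 0# → s ≈ t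
  circular-zero 0≤s s≤t t<c e = case circular-cases 0≤s s≤t t<c of λ where
    (inj₁ (_ , f)) → linarith 3 (λ s t g → g :≈ :0 ⟹ g :≈ t :- s ⟹ s :≈ t) e f
    (inj₂ (_ , f)) → ⊥-elim
      (linarith 4 (λ s t g c → g :≈ :0 ⟹ g :≈ c :- (t :- s) ⟹ :0 :≤ s ⟹ t :< c ⟹ :⊥) e f 0≤s t<c)

  -- The coordinate of a point is the parameter chosen by the covering. The choice respects equality
  -- of points because `circular` vanishes on [0, c) only at equal parameters.
  parametrised : ∀ {c} → 0# < c → (e : Carrier → X.Carrier) →
    (∀ {s t} → 0# ≤ s → s ≤ t → t < c → d (e s) (e t) ≈ circular c s t) →
    (∀ p → ∃ λ t → 0# ≤ t × t < c × e t X.≈ p) → CircularCoordinates X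
  parametrised {c} 0<c e isometry cover = record
    { circumference    = c
    ; 0<c              = 0<c
    ; coord            = coord
    ; 0≤coord          = 0≤coord
    ; coord<c          = coord<c
    ; coord-cong       = λ {p} {q} p≈q → unique p q (trans (sym (distance p q)) (M.≈⇒0 p≈q))
    ; coord-injective  = λ {p} {q} f → M.0⇒≈ (trans (distance p q) (vanishes (0≤coord p) f (coord<c q)))
    ; coord-surjective = λ {t} 0≤t t<c → e t , distinct (0≤coord _) (coord<c _) 0≤t t<c
        (M.≈⇒0 (e-coord (e t)))
    ; d-coord          = distance
    }
    where
    coord : X.Carrier → Carrier
    coord p = proj₁ (cover p)

    0≤coord : ∀ p → 0# ≤ coord p
    0≤coord p = proj₁ (proj₂ (cover p))

    coord<c : ∀ p → coord p < c
    coord<c p = proj₁ (proj₂ (proj₂ (cover p)))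

    e-coord : ∀ p → e (coord p) X.≈ p
    e-coord p = proj₂ (proj₂ (proj₂ (cover p)))

    e-distance : ∀ {s t} → 0# ≤ s → s < c → 0# ≤ t → t < c → d (e s) (e t) ≈ circular c s t
    e-distance {s} {t} 0≤s s<c 0≤t t<c = case ≤.total s t of λ where
      (inj₁ s≤t) → isometry 0≤s s≤t t<c
      (inj₂ t≤s) → trans (M.sym _ _) (trans (isometry 0≤t t≤s s<c) (circular-sym c t s))

    distance : ∀ p q → d p q ≈ circular c (coord p) (coord q)
    distance p q = trans (d-resp (M.EqC.sym (e-coord p)) (M.EqC.sym (e-coord q)))
      (e-distance (0≤coord p) (coord<c p) (0≤coord q) (coord<c q))

    circular-zero′ : ∀ {s t} → 0# ≤ s → s < c → 0# ≤ t → t < c → circular c s t ≈ 0# → s ≈ t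
    circular-zero′ {s} {t} 0≤s s<c 0≤t t<c f = case ≤.total s t of λ where
      (inj₁ s≤t) → circular-zero 0≤s s≤t t<c f
      (inj₂ t≤s) → sym (circular-zero 0≤t t≤s s<c (trans (circular-sym c t s) f))

    unique : ∀ p q → circular c (coord p) (coord q) ≈ 0# → coord p ≈ coord q
    unique p q = circular-zero′ (0≤coord p) (coord<c p) (0≤coord q) (coord<c q)

    distinct : ∀ {s t} → 0# ≤ s → s < c → 0# ≤ t → t < c → d (e s) (e t) ≈ 0# → s ≈ t
    distinct 0≤s s<c 0≤t t<c f =
      circular-zero′ 0≤s s<c 0≤t t<c (trans (sym (e-distance 0≤s s<c 0≤t t<c)) f)

    vanishes : ∀ {s t} → 0# ≤ s → s ≈ t → t < c → circular c s t ≈ 0#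
    vanishes 0≤s s≈t t<c = case circular-cases 0≤s (≤.reflexive s≈t) t<c of λ where
      (inj₁ (_ , f)) → linarith 3 (λ s t g → g :≈ t :- s ⟹ s :≈ t ⟹ g :≈ :0) f s≈t
      (inj₂ (h , f)) → ⊥-elim
        (linarith 3 (λ s t c → c :≤ 2 :× (t :- s) ⟹ s :≈ t ⟹ :0 :< c ⟹ :⊥) h s≈t 0<c)

  private
    <⇒≱ : ∀ {b c : Carrier} → b < c → ¬ (c ≤ b)
    <⇒≱ b<c c≤b = linarith 2 (λ b c → b :< c ⟹ c :≤ b ⟹ :⊥) b<c c≤b

  -- Geodesics in a space without nets

  module _ (netFree : NetFree) where

    -- A point of the leg from γ k to y is as far from γ as from γ k, so six
    -- points at distances s, 2s, 5s and 6s from γ k form a net at scale 4s.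
    no-interior-foot : ∀ {l k y} (γ : Segment l) → 0# < k → k < l → 0# < d (pt γ k) y →
      ¬ (∀ {v} → 0# ≤ v → v ≤ l → d (pt γ k) y ≤ d (pt γ v) y)
    no-interior-foot {l} {k} {y} γ 0<k k<l 0<D minimal =
      netFree corner pendant 0<4s (triangle , pendant-near , pendant-far)
      where
      D = d (pt γ k) y
      leg = geodesic (pt γ k) y
      σ = proj₁ leg

      -- The pendant points on γ lie 6s before and after the foot and the one on the leg 5s from it;
      -- all have to fit.
      bounds : ∃ λ s → 0# < s × 6 · s ≤ k × 6 · s ≤ l - k × 6 · s ≤ D
      bounds = let
        (e , 0<e , e≤k , e≤l-k) = smaller 0<k (linarith 2 (λ k l → k :< l ⟹ :0 :< l :- k) k<l)
        (f , 0<f , f≤e , f≤D)   = smaller 0<e 0<D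
        (s , 6s≈f)              = fraction 5 f
        in s , linarith 2 (λ s f → 6 :× s :≈ f ⟹ :0 :< f ⟹ :0 :< s) 6s≈f 0<f ,
           ≤.trans (≤.reflexive 6s≈f) (≤.trans f≤e e≤k) ,
             ≤.trans (≤.reflexive 6s≈f) (≤.trans f≤e e≤l-k) ,
           ≤.trans (≤.reflexive 6s≈f) f≤D

      s      = proj₁ bounds
      0<s    = proj₁ (proj₂ bounds)
      6s≤k   = proj₁ (proj₂ (proj₂ bounds))
      6s≤l-k = proj₁ (proj₂ (proj₂ (proj₂ bounds)))
      6s≤D   = proj₂ (proj₂ (proj₂ (proj₂ bounds)))

      0<4s : 0# < 4 · s
      0<4s = linarith 1 (λ s → :0 :< s ⟹ :0 :< 4 :× s) 0<s

      corner pendant : Fin 3 → X.Carrier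
      corner zero             = pt γ (k - 2 · s)
      corner (suc zero)       = pt γ (k + 2 · s)
      corner (suc (suc zero)) = pt σ s
      pendant zero             = pt γ (k - 6 · s)
      pendant (suc zero)       = pt γ (k + 6 · s)
      pendant (suc (suc zero)) = pt σ (5 · s)

      on-γ : ∀ {u v} → 0# ≤ u → u ≤ v → v ≤ l → d (pt γ u) (pt γ v) ≈ v - u
      on-γ = isometric γ

      γk≈σ0 : pt γ k X.≈ pt σ 0#
      γk≈σ0 = M.EqC.sym (proj₁ (proj₂ leg))

      -- The point of γ is at least D away from y by minimality, while σ r is only D - r away from
      -- y.
      clearance : ∀ {r v} → 0# ≤ r → r ≤ D → 0# ≤ v → v ≤ l → r ≤ d (pt γ v) (pt σ r)
      clearance {r} {v} 0≤r r≤D 0≤v v≤l =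
        linarith 5 (λ D vy vr ry r → D :≤ vy ⟹ vy :≤ vr :+ ry ⟹ ry :≈ D :- r ⟹ r :≤ vr)
        (minimal 0≤v v≤l) (M.triangle _ (pt σ r) _)
        (trans (d-resp M.EqC.refl (M.EqC.sym (proj₂ (proj₂ leg)))) (isometric σ 0≤r r≤D ≤.refl))

      to-leg : ∀ {r v} → 0# ≤ r → r ≤ D → d (pt γ v) (pt σ r) ≤ d (pt γ v) (pt γ k) + r
      to-leg {r} {v} 0≤r r≤D = linarith 4 (λ vr vk kr r → vr :≤ vk :+ kr ⟹ kr :≈ r ⟹ vr :≤ vk :+ r)
        (M.triangle _ (pt γ k) _) (trans (d-resp γk≈σ0 M.EqC.refl) (from-start σ 0≤r r≤D))

      0≤s    = <⇒≤ 0<s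
      s≤D    = linarith 2 (λ s D → 6 :× s :≤ D ⟹ :0 :< s ⟹ s :≤ D) 6s≤D 0<s
      0≤5s   = linarith 1 (λ s → :0 :< s ⟹ :0 :≤ 5 :× s) 0<s
      5s≤D   = linarith 2 (λ s D → 6 :× s :≤ D ⟹ :0 :< s ⟹ 5 :× s :≤ D) 6s≤D 0<s
      0≤k-2s = linarith 2 (λ s k → 6 :× s :≤ k ⟹ :0 :< s ⟹ :0 :≤ k :- 2 :× s) 6s≤k 0<s
      0≤k-6s = linarith 2 (λ s k → 6 :× s :≤ k ⟹ :0 :≤ k :- 6 :× s) 6s≤k
      0≤k+2s = linarith 2 (λ s k → :0 :< k ⟹ :0 :< s ⟹ :0 :≤ k :+ 2 :× s) 0<k 0<s
      k-2s≤l = linarith 3 (λ s k l → k :< l ⟹ :0 :< s ⟹ k :- 2 :× s :≤ l) k<l 0<s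
      k+2s≤l = linarith 3 (λ s k l → 6 :× s :≤ l :- k ⟹ :0 :< s ⟹ k :+ 2 :× s :≤ l) 6s≤l-k 0<s
      k+6s≤l = linarith 3 (λ s k l → 6 :× s :≤ l :- k ⟹ k :+ 6 :× s :≤ l) 6s≤l-k
      k-2s≤k = linarith 2 (λ s k → :0 :< s ⟹ k :- 2 :× s :≤ k) 0<s
      k≤k+2s = linarith 2 (λ s k → :0 :< s ⟹ k :≤ k :+ 2 :× s) 0<s

      k-2s≤k+2s = ≤.trans k-2s≤k k≤k+2s
      k-6s≤k-2s = linarith 2 (λ s k → :0 :< s ⟹ k :- 6 :× s :≤ k :- 2 :× s) 0<s
      k+2s≤k+6s = linarith 2 (λ s k → :0 :< s ⟹ k :+ 2 :× s :≤ k :+ 6 :× s) 0<s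

      c₀c₁ : d (corner zero) (corner (suc zero)) ≤ 4 · s
      c₀c₁ = linarith 3 (λ e s k → e :≈ (k :+ 2 :× s) :- (k :- 2 :× s) ⟹ e :≤ 4 :× s)
        (on-γ 0≤k-2s k-2s≤k+2s k+2s≤l)

      c₀c₂ : d (corner zero) (corner (suc (suc zero))) ≤ 4 · s
      c₀c₂ = linarith 4 (λ e f s k → e :≤ f :+ s ⟹ f :≈ k :- (k :- 2 :× s) ⟹ :0 :< s ⟹ e :≤ 4 :× s)
        (to-leg 0≤s s≤D) (on-γ 0≤k-2s k-2s≤k (<⇒≤ k<l)) 0<s

      c₁c₂ : d (corner (suc zero)) (corner (suc (suc zero))) ≤ 4 · s
      c₁c₂ = linarith 4 (λ e f s k → e :≤ f :+ s ⟹ f :≈ (k :+ 2 :× s) :- k ⟹ :0 :< s ⟹ e :≤ 4 :× s)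
        (to-leg 0≤s s≤D) (isometric-sym γ (<⇒≤ 0<k) k≤k+2s k+2s≤l) 0<s

      swap : ∀ {p q b} → d p q ≤ b → d q p ≤ b
      swap = ≤-resp-≈ (M.sym _ _) refl

      triangle : ∀ i j → i ≢ j → d (corner i) (corner j) ≤ 4 · s
      triangle zero             zero             0≢0 = ⊥-elim (0≢0 ≡.refl)
      triangle zero             (suc zero)       _   = c₀c₁
      triangle zero             (suc (suc zero)) _   = c₀c₂
      triangle (suc zero)       zero             _   = swap c₀c₁
      triangle (suc zero)       (suc zero)       1≢1 = ⊥-elim (1≢1 ≡.refl)
      triangle (suc zero)       (suc (suc zero)) _   = c₁c₂
      triangle (suc (suc zero)) zero             _   = swap c₀c₂
      triangle (suc (suc zero)) (suc zero)       _   = swap c₁c₂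
      triangle (suc (suc zero)) (suc (suc zero)) 2≢2 = ⊥-elim (2≢2 ≡.refl)

      pendant-near : ∀ i → d (corner i) (pendant i) ≤ 4 · s
      pendant-near zero             =
        linarith 3 (λ e s k → e :≈ (k :- 2 :× s) :- (k :- 6 :× s) ⟹ e :≤ 4 :× s)
        (isometric-sym γ 0≤k-6s k-6s≤k-2s k-2s≤l)
      pendant-near (suc zero)       =
        linarith 3 (λ e s k → e :≈ (k :+ 6 :× s) :- (k :+ 2 :× s) ⟹ e :≤ 4 :× s)
        (on-γ 0≤k+2s k+2s≤k+6s k+6s≤l)
      pendant-near (suc (suc zero)) = linarith 2 (λ e s → e :≈ 5 :× s :- s ⟹ e :≤ 4 :× s)
        (isometric σ 0≤s (linarith 1 (λ s → :0 :< s ⟹ s :≤ 5 :× s) 0<s) 5s≤D)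

      far-leg : ∀ {v} → 0# ≤ v → v ≤ l → 4 · s < d (pt σ (5 · s)) (pt γ v)
      far-leg 0≤v v≤l = linarith 3 (λ s e f → 5 :× s :≤ f ⟹ e :≈ f ⟹ :0 :< s ⟹ 4 :× s :< e)
        (clearance 0≤5s 5s≤D 0≤v v≤l) (M.sym _ _) 0<s

      -- The corner on the leg is s from the foot, so a point 6s from the foot is at least 5s from
      -- that corner.
      far-corner : ∀ {v} → d (pt γ v) (pt γ k) ≈ 6 · s → 4 · s < d (pt γ v) (pt σ s)
      far-corner e = linarith 4
        (λ s vk vs sk → vk :≈ 6 :× s ⟹ vk :≤ vs :+ sk ⟹ sk :≈ s :- :0 ⟹ :0 :< s ⟹ 4 :× s :< vs)
        e (M.triangle _ (pt σ s) _)
          (trans (d-resp M.EqC.refl γk≈σ0) (isometric-sym σ ≤.refl 0≤s s≤D)) 0<s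

      pendant-far : ∀ i j → i ≢ j → ¬ (d (pendant i) (corner j) ≤ 4 · s)
      pendant-far zero             zero             0≢0 = ⊥-elim (0≢0 ≡.refl)
      pendant-far (suc zero)       (suc zero)       1≢1 = ⊥-elim (1≢1 ≡.refl)
      pendant-far (suc (suc zero)) (suc (suc zero)) 2≢2 = ⊥-elim (2≢2 ≡.refl)
      pendant-far zero (suc zero) _ =
        linarith 3 (λ e s k → e :≈ (k :+ 2 :× s) :- (k :- 6 :× s) ⟹ :0 :< s ⟹ e :≤ 4 :× s ⟹ :⊥)
        (on-γ 0≤k-6s (≤.trans k-6s≤k-2s k-2s≤k+2s) k+2s≤l) 0<s
      pendant-far (suc zero) zero _ =
        linarith 3 (λ e s k → e :≈ (k :+ 6 :× s) :- (k :- 2 :× s) ⟹ :0 :< s ⟹ e :≤ 4 :× s ⟹ :⊥)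
        (isometric-sym γ 0≤k-2s (≤.trans k-2s≤k+2s k+2s≤k+6s) k+6s≤l) 0<s
      pendant-far zero (suc (suc zero)) _ = <⇒≱ (far-corner (trans
        (on-γ 0≤k-6s (≤.trans k-6s≤k-2s k-2s≤k) (<⇒≤ k<l))
          (linarith 2 (λ s k → k :- (k :- 6 :× s) :≈ 6 :× s))))
      pendant-far (suc zero) (suc (suc zero)) _ = <⇒≱ (far-corner (trans
        (isometric-sym γ (<⇒≤ 0<k) (≤.trans k≤k+2s k+2s≤k+6s) k+6s≤l)
          (linarith 2 (λ s k → (k :+ 6 :× s) :- k :≈ 6 :× s))))
      pendant-far (suc (suc zero)) zero _ = <⇒≱ (far-leg 0≤k-2s k-2s≤l)
      pendant-far (suc (suc zero)) (suc zero) _ = <⇒≱ (far-leg 0≤k+2s k+2s≤l)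

    Foot : ∀ {l} → Segment l → Carrier → X.Carrier → Set
    Foot {l} γ k y = ∀ {v} → 0# ≤ v → v ≤ l → d (pt γ k) y ≤ d (pt γ v) y

    -- The distance to y is 1-Lipschitz along γ, so a nearest point exists by `minimumAttained`. At
    -- positive distance it cannot be interior, by `no-interior-foot`.
    foot-at-end : ∀ {l} (γ : Segment l) y → y ∈ γ ⊎ Foot γ 0# y ⊎ Foot γ l y
    foot-at-end {l} γ y = distinguish (lem {d (pt γ k) y ≤ 0#}) (≤-or-> k 0#) (≤-or-> l k)
      where
      minimum = minimumAttained (λ v → d (pt γ v) y) (0≤l γ)
        (λ {u} {v} 0≤u u≤v v≤l →
          linarith 5 (λ uy uv vy u v → uy :≤ uv :+ vy ⟹ uv :≈ v :- u ⟹ uy :≤ vy :+ (v :- u))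
            (M.triangle _ (pt γ v) _) (isometric γ 0≤u u≤v v≤l) ,
          linarith 5 (λ uy uv vy u v → vy :≤ uv :+ uy ⟹ uv :≈ v :- u ⟹ vy :≤ uy :+ (v :- u))
            (M.triangle _ (pt γ u) _) (isometric-sym γ 0≤u u≤v v≤l))
        (λ _ _ → M.nonNegative)
      k       = proj₁ minimum
      0≤k     = proj₁ (proj₂ minimum)
      k≤l     = proj₁ (proj₂ (proj₂ minimum))

      least : Foot γ k y
      least = proj₂ (proj₂ (proj₂ minimum))

      distinguish : Dec (d (pt γ k) y ≤ 0#) → k ≤ 0# ⊎ 0# < k → l ≤ k ⊎ k < l → y ∈ γ ⊎ Foot γ 0# y ⊎
        Foot γ l y
      distinguish (yes d≤0) _ _ = inj₁ (k , 0≤k , k≤l , M.0⇒≈ (≤.antisym d≤0 M.nonNegative))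
      distinguish (no _) (inj₁ k≤0) _ = inj₂ (inj₁ λ 0≤v v≤l → ≤.trans
        (≤.reflexive (d-resp (pt-cong γ ≤.refl (≤.antisym 0≤k k≤0) k≤l) M.EqC.refl)) (least 0≤v v≤l))
      distinguish (no _) (inj₂ _) (inj₁ l≤k) = inj₂ (inj₂ λ 0≤v v≤l → ≤.trans
        (≤.reflexive (d-resp (pt-cong γ (0≤l γ) (≤.antisym l≤k k≤l) k≤l) M.EqC.refl)) (least 0≤v v≤l))
      distinguish (no d≰0) (inj₂ 0<k) (inj₂ k<l) = ⊥-elim (no-interior-foot γ 0<k k<l (≰⇒> d≰0) least)

    -- The last point of γ on a geodesic from γ u to y must be an end of γ.
    through-end : ∀ {l u y} (γ : Segment l) → y ∉ γ → 0# ≤ u → u ≤ l →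
      u + d (pt γ 0#) y ≤ d (pt γ u) y ⊎ (l - u) + d (pt γ l) y ≤ d (pt γ u) y
    through-end {l} {u} {y} γ y∉γ 0≤u u≤l = distinguish (≤-or-> v 0#) (≤-or-> l v)
      where
      D = d (pt γ u) y
      leg = geodesic (pt γ u) y
      σ = proj₁ leg
      σ-end = proj₂ (proj₂ leg)

      -- Meeting is stated as distance 0 because `complete` takes predicates at level 0 and equality
      -- in X may live higher.
      Meets : Pred Carrier 0ℓ
      Meets s = 0# ≤ s × s ≤ D × ∃ λ v → 0# ≤ v × v ≤ l × d (pt γ v) (pt σ s) ≈ 0#

      meets-0 : Meets 0#
      meets-0 = ≤.refl , 0≤l σ , u , 0≤u , u≤l , M.≈⇒0 (M.EqC.sym (proj₁ (proj₂ leg)))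

      lub : ∃ (LeastUpperBound Meets)
      lub = complete Meets (0# , meets-0) (D , λ _ (_ , s≤D , _) → s≤D)

      S : Carrier
      S = proj₁ lub

      0≤S : 0# ≤ S
      0≤S = proj₁ (proj₂ lub) 0# meets-0

      S≤D : S ≤ D
      S≤D = proj₂ (proj₂ lub) D λ _ (_ , s≤D , _) → s≤D

      -- Shows that the supremum S is itself a meeting parameter. If the foot of σ S were at
      -- distance η > 0, a meeting point less than η before σ S would be a nearer point of γ.
      end-meets : ∀ {e} → 0# ≤ e → e ≤ l → Foot γ e (pt σ S) → pt γ e X.≈ pt σ S
      end-meets {e} 0≤e e≤l foot = M.0⇒≈ (≤.antisym (≮⇒≥ not-positive) M.nonNegative)
        where
        not-positive : ¬ (0# < d (pt γ e) (pt σ S))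
        not-positive 0<η = let
          (s , (0≤s , s≤D , v , 0≤v , v≤l , vs≈0) , S-η<s) = lub-approximation (proj₂ lub) 0<η
          s≤S = proj₁ (proj₂ lub) s (0≤s , s≤D , v , 0≤v , v≤l , vs≈0)
          in linarith 6 (λ η vS vs sS s S → η :≤ vS ⟹ vS :≤ vs :+ sS ⟹ vs :≈ :0 ⟹ sS :≈ S :- s ⟹
            S :- η :< s ⟹ :⊥)
            (foot 0≤v v≤l) (M.triangle _ (pt σ s) _) vs≈0 (isometric σ 0≤s s≤S S≤D) S-η<s

      last : pt σ S ∈ γ
      last = case foot-at-end γ (pt σ S) of λ where
        (inj₁ meets)        → meets
        (inj₂ (inj₁ foot₀)) → 0# , ≤.refl , 0≤l γ , end-meets ≤.refl (0≤l γ) foot₀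
        (inj₂ (inj₂ foot₁)) → l , 0≤l γ , ≤.refl , end-meets (0≤l γ) ≤.refl foot₁

      v    = proj₁ last
      0≤v  = proj₁ (proj₂ last)
      v≤l  = proj₁ (proj₂ (proj₂ last))
      γv≈S = proj₂ (proj₂ (proj₂ last))

      rest : d (pt γ v) y ≈ D - S
      rest = trans (d-resp γv≈S (M.EqC.sym σ-end)) (isometric σ 0≤S S≤D ≤.refl)

      first : d (pt γ u) (pt γ v) ≈ S
      first = trans (d-resp (M.EqC.sym (proj₁ (proj₂ leg))) γv≈S) (from-start σ 0≤S S≤D)

      S<D : S < D
      S<D = ≰⇒> λ D≤S → y∉γ (v , 0≤v , v≤l , M.0⇒≈ (≤.antisym
        (linarith 3 (λ e D S → e :≈ D :- S ⟹ D :≤ S ⟹ e :≤ :0) rest D≤S) M.nonNegative))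

      -- A point of the leg shortly after the last one on γ is closer to an
      -- interior point of γ than to its ends.
      interior-impossible : 0# < v → v < l → ⊥
      interior-impossible 0<v v<l = case foot-at-end γ y′ of λ where
          (inj₁ (w , 0≤w , w≤l , γw≈y′)) → linarith 2 (λ S r → S :+ r :≤ S ⟹ :0 :< r ⟹ :⊥)
            (proj₁ (proj₂ lub) (S + r) (≤.trans 0≤S S≤S+r , S+r≤D , w , 0≤w , w≤l , M.≈⇒0 γw≈y′)) 0<r
          -- A foot of y′ at an end would be within r of y′, hence within 2r of γ v, whereas γ v is
          -- at least 3r from both ends.
          (inj₂ (inj₁ foot₀)) →
            linarith 5 (λ 0y 0v vy v r → 0y :≤ vy ⟹ 0v :≤ 0y :+ vy ⟹ vy :≈ r ⟹ 0v :≈ v ⟹ 3 :× r :≤ v ⟹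
            :0 :< r ⟹ :⊥)
            (foot₀ 0≤v v≤l) (≤.trans (M.triangle _ y′ _) (≤.reflexive (+-congˡ (M.sym _ _)))) vy′≈r
              (from-start γ 0≤v v≤l) 3r≤v 0<r
          (inj₂ (inj₂ foot₁)) →
            linarith 6 (λ ly lv vy v l r → ly :≤ vy ⟹ lv :≤ ly :+ vy ⟹ vy :≈ r ⟹ lv :≈ l :- v ⟹
            3 :× r :≤ l :- v ⟹ :0 :< r ⟹ :⊥)
            (foot₁ 0≤v v≤l) (≤.trans (M.triangle _ y′ _) (≤.reflexive (+-congˡ (M.sym _ _)))) vy′≈r
              (isometric-sym γ 0≤v v≤l ≤.refl) 3r≤l-v 0<r
        where
        small : ∃ λ r → 0# < r × 3 · r ≤ v × 3 · r ≤ l - v × 3 · r ≤ D - S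
        small = let
          (e , 0<e , e≤v , e≤l-v) = smaller 0<v (linarith 2 (λ k l → k :< l ⟹ :0 :< l :- k) v<l)
          (f , 0<f , f≤e , f≤D-S) = smaller 0<e (linarith 2 (λ k l → k :< l ⟹ :0 :< l :- k) S<D)
          (r , 3r≈f)              = fraction 2 f
          in r , linarith 2 (λ s f → 3 :× s :≈ f ⟹ :0 :< f ⟹ :0 :< s) 3r≈f 0<f ,
             ≤.trans (≤.reflexive 3r≈f) (≤.trans f≤e e≤v) ,
               ≤.trans (≤.reflexive 3r≈f) (≤.trans f≤e e≤l-v) ,
             ≤.trans (≤.reflexive 3r≈f) f≤D-S

        r       = proj₁ small
        0<r     = proj₁ (proj₂ small)
        3r≤v    = proj₁ (proj₂ (proj₂ small))
        3r≤l-v  = proj₁ (proj₂ (proj₂ (proj₂ small)))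
        3r≤D-S  = proj₂ (proj₂ (proj₂ (proj₂ small)))
        y′      = pt σ (S + r)
        S≤S+r   = linarith 2 (λ S r → :0 :< r ⟹ S :≤ S :+ r) 0<r
        S+r≤D   = linarith 3 (λ S r D → :0 :< r ⟹ 3 :× r :≤ D :- S ⟹ S :+ r :≤ D) 0<r 3r≤D-S

        vy′≈r : d (pt γ v) y′ ≈ r
        vy′≈r = trans (d-resp γv≈S M.EqC.refl) (trans (isometric σ 0≤S S≤S+r S+r≤D)
          (linarith 2 (λ S r → (S :+ r) :- S :≈ r)))

      distinguish : v ≤ 0# ⊎ 0# < v → l ≤ v ⊎ v < l →
        u + d (pt γ 0#) y ≤ D ⊎ (l - u) + d (pt γ l) y ≤ D
      distinguish (inj₁ v≤0) _ = inj₁ (linarith 4 (λ u 0y D S → 0y :≈ D :- S ⟹ S :≈ u ⟹ u :+ 0y :≤ D)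
        (trans (d-resp γ0≈γv M.EqC.refl) rest)
        (trans (sym first) (trans (d-resp M.EqC.refl (M.EqC.sym γ0≈γv))
          (trans (M.sym _ _) (from-start γ 0≤u u≤l)))))
        where
        γ0≈γv = pt-cong γ ≤.refl (≤.antisym 0≤v v≤0) v≤l
      distinguish (inj₂ _) (inj₁ l≤v) =
        inj₂ (linarith 5 (λ u ly D S l → ly :≈ D :- S ⟹ S :≈ l :- u ⟹ (l :- u) :+ ly :≤ D)
        (trans (d-resp γl≈γv M.EqC.refl) rest)
        (trans (sym first) (trans (d-resp M.EqC.refl (M.EqC.sym γl≈γv)) (isometric γ 0≤u u≤l ≤.refl))))
        where
        γl≈γv = pt-cong γ (0≤l γ) (≤.antisym l≤v v≤l) v≤l
      distinguish (inj₂ 0<v) (inj₂ v<l) = ⊥-elim (interior-impossible 0<v v<l)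

    -- Two geodesics with common ends

    module Bigon {L u x} (γ₁ γ₂ : Segment L) (start : pt γ₁ 0# X.≈ pt γ₂ 0#) (end : pt γ₁ L X.≈ pt γ₂ L)
      (0≤u : 0# ≤ u) (u≤L : u ≤ L) (γ₁u≈x : pt γ₁ u X.≈ x) (x∉γ₂ : x ∉ γ₂) where

      private
        0<u : 0# < u
        0<u = ≰⇒> λ u≤0 → x∉γ₂ (0# , ≤.refl , 0≤l γ₂ , M.EqC.trans (M.EqC.sym start)
          (M.EqC.trans (pt-cong γ₁ ≤.refl (≤.antisym 0≤u u≤0) u≤L) γ₁u≈x))

        u<L : u < L
        u<L = ≰⇒> λ L≤u → x∉γ₂ (L , 0≤l γ₂ , ≤.refl , M.EqC.trans (M.EqC.sym end)
          (M.EqC.trans (pt-cong γ₁ (0≤l γ₁) (≤.antisym L≤u u≤L) u≤L) γ₁u≈x))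

      -- A common point has the same parameter t on both geodesics, so along γ₁ it is |t - u| from
      -- x. But x is off γ₂, so by `through-end` the distance would have to be at least t + u or (L
      -- - t) + (L - u).
      separate : ∀ {t} → 0# < t → t < L → pt γ₂ t ∉ γ₁
      separate {t} 0<t t<L (s , 0≤s , s≤L , γ₁s≈γ₂t) =
        case (through-end γ₂ x∉γ₂ (<⇒≤ 0<t) (<⇒≤ t<L) , ≤.total s u) of λ where
          (inj₁ h , inj₁ s≤u) →
            linarith 5 (λ t u 0x tx s → t :+ 0x :≤ tx ⟹ 0x :≈ u ⟹ tx :≈ u :- s ⟹ s :≈ t ⟹ :0 :< t ⟹ :⊥)
            h 0x (trans tx (isometric γ₁ 0≤s s≤u u≤L)) s≈t 0<t
          (inj₁ h , inj₂ u≤s) →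
            linarith 5 (λ t u 0x tx s → t :+ 0x :≤ tx ⟹ 0x :≈ u ⟹ tx :≈ s :- u ⟹ s :≈ t ⟹ :0 :< u ⟹ :⊥)
            h 0x (trans tx (isometric-sym γ₁ 0≤u u≤s s≤L)) s≈t 0<u
          (inj₂ h , inj₁ s≤u) →
            linarith 6 (λ t u Lx tx s L → (L :- t) :+ Lx :≤ tx ⟹ Lx :≈ L :- u ⟹ tx :≈ u :- s ⟹ s :≈ t ⟹
            u :< L ⟹ :⊥)
            h Lx (trans tx (isometric γ₁ 0≤s s≤u u≤L)) s≈t u<L
          (inj₂ h , inj₂ u≤s) →
            linarith 6 (λ t u Lx tx s L → (L :- t) :+ Lx :≤ tx ⟹ Lx :≈ L :- u ⟹ tx :≈ s :- u ⟹ s :≈ t ⟹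
            t :< L ⟹ :⊥)
            h Lx (trans tx (isometric-sym γ₁ 0≤u u≤s s≤L)) s≈t t<L
        where
        x≈γ₁u = M.EqC.sym γ₁u≈x

        s≈t : s ≈ t
        s≈t = trans (sym (from-start γ₁ 0≤s s≤L))
          (trans (d-resp start γ₁s≈γ₂t) (from-start γ₂ (<⇒≤ 0<t) (<⇒≤ t<L)))

        0x : d (pt γ₂ 0#) x ≈ u
        0x = trans (d-resp (M.EqC.sym start) x≈γ₁u) (from-start γ₁ 0≤u u≤L)

        Lx : d (pt γ₂ L) x ≈ L - u
        Lx = trans (d-resp (M.EqC.sym end) x≈γ₁u) (isometric-sym γ₁ 0≤u u≤L ≤.refl)

        tx : d (pt γ₂ t) x ≈ d (pt γ₁ s) (pt γ₁ u)
        tx = d-resp (M.EqC.sym γ₁s≈γ₂t) x≈γ₁u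

      module _ {s t} (0≤s : 0# ≤ s) (s≤L : s ≤ L) (0≤t : 0# ≤ t) (t≤L : t ≤ L) where

        cross-≤₀ : d (pt γ₁ s) (pt γ₂ t) ≤ s + t
        cross-≤₀ = linarith 5 (λ st s0 0t s t → st :≤ s0 :+ 0t ⟹ s0 :≈ s :- :0 ⟹ 0t :≈ t ⟹ st :≤ s :+ t)
          (M.triangle _ (pt γ₁ 0#) _) (isometric-sym γ₁ ≤.refl 0≤s s≤L)
          (trans (d-resp start M.EqC.refl) (from-start γ₂ 0≤t t≤L))

        cross-≤₁ : d (pt γ₁ s) (pt γ₂ t) ≤ (L - s) + (L - t)
        cross-≤₁ = linarith 6
          (λ st sL Lt s t L → st :≤ sL :+ Lt ⟹ sL :≈ L :- s ⟹ Lt :≈ L :- t ⟹ st :≤ (L :- s) :+ (L :- t))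
          (M.triangle _ (pt γ₁ L) _) (isometric γ₁ 0≤s s≤L ≤.refl)
          (trans (d-resp end M.EqC.refl) (isometric-sym γ₂ 0≤t t≤L ≤.refl))

        -- An interior point of γ₂ is off γ₁ by `separate`, so a geodesic to it leaves γ₁ through an
        -- end. An end of γ₂ lies on γ₁, where the distance is known. Together with the upper
        -- bounds, the distance is the shorter way round.
        cross-≥ : s + t ≤ d (pt γ₁ s) (pt γ₂ t) ⊎ (L - s) + (L - t) ≤ d (pt γ₁ s) (pt γ₂ t)
        cross-≥ = distinguish (≤-or-> t 0#) (≤-or-> L t)
          where
          distinguish : t ≤ 0# ⊎ 0# < t → L ≤ t ⊎ t < L →
            s + t ≤ d (pt γ₁ s) (pt γ₂ t) ⊎ (L - s) + (L - t) ≤ d (pt γ₁ s) (pt γ₂ t)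
          distinguish (inj₁ t≤0) _ =
            inj₁ (linarith 3 (λ st s t → st :≈ s :- :0 ⟹ t :≤ :0 ⟹ s :+ t :≤ st)
            (trans (d-resp M.EqC.refl
              (M.EqC.sym (M.EqC.trans start (pt-cong γ₂ ≤.refl (≤.antisym 0≤t t≤0) t≤L))))
              (isometric-sym γ₁ ≤.refl 0≤s s≤L)) t≤0)
          distinguish (inj₂ _) (inj₁ L≤t) =
            inj₂ (linarith 4 (λ st s t L → st :≈ L :- s ⟹ L :≤ t ⟹ (L :- s) :+ (L :- t) :≤ st)
            (trans (d-resp M.EqC.refl
              (M.EqC.sym (M.EqC.trans end (pt-cong γ₂ (0≤l γ₂) (≤.antisym L≤t t≤L) t≤L))))
              (isometric γ₁ 0≤s s≤L ≤.refl)) L≤t)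
          distinguish (inj₂ 0<t) (inj₂ t<L) = Sum.map
            (λ h → linarith 4 (λ s t 0t st → s :+ 0t :≤ st ⟹ 0t :≈ t ⟹ s :+ t :≤ st)
              h (trans (d-resp start M.EqC.refl) (from-start γ₂ 0≤t t≤L)))
            (λ h → linarith 5 (λ s t Lt st L → (L :- s) :+ Lt :≤ st ⟹ Lt :≈ L :- t ⟹
              (L :- s) :+ (L :- t) :≤ st)
              h (trans (d-resp end M.EqC.refl) (isometric-sym γ₂ 0≤t t≤L ≤.refl)))
            (through-end γ₁ (separate 0<t t<L) 0≤s s≤L)

      private
        halfway : ∃ λ h → 2 · h ≈ L
        halfway = fraction 1 L

        h    = proj₁ halfway
        2h≈L = proj₂ halfway
        0≤h  = linarith 2 (λ h L → 2 :× h :≈ L ⟹ :0 :≤ L ⟹ :0 :≤ h) 2h≈L (0≤l γ₁)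
        h≤L  = linarith 2 (λ h L → 2 :× h :≈ L ⟹ :0 :≤ L ⟹ h :≤ L) 2h≈L (0≤l γ₁)

        -- Both ways round between the two midpoints have length L, so each of them will be a
        -- geodesic, bending round a common end.
        L≤across : L ≤ d (pt γ₁ h) (pt γ₂ h)
        L≤across = case cross-≥ 0≤h h≤L 0≤h h≤L of λ where
          (inj₁ f) → linarith 3 (λ h L e → 2 :× h :≈ L ⟹ h :+ h :≤ e ⟹ L :≤ e) 2h≈L f
          (inj₂ f) → linarith 3 (λ h L e → 2 :× h :≈ L ⟹ (L :- h) :+ (L :- h) :≤ e ⟹ L :≤ e) 2h≈L f

        L-h≈h : L - h ≈ h
        L-h≈h = linarith 2 (λ h L → 2 :× h :≈ L ⟹ L :- h :≈ h) 2h≈L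

        -- The concatenation is a geodesic that misses w, so the foot of w on it is one of its ends;
        -- that end is at least as near to w as the point where the two pieces meet.
        bend : ∀ {k m n w} (γ : Segment k) (δ : Segment m) → k + m ≈ n → pt γ k X.≈ pt δ 0# →
          n ≤ d (pt γ 0#) (pt δ m) →
          w ∉ γ → w ∉ δ → d (pt γ 0#) w ≤ d (pt γ k) w ⊎ d (pt δ m) w ≤ d (pt γ k) w
        bend {k} {m} {n} {w} γ δ k+m≈n γk≈δ0 n≤d w∉γ w∉δ =
          let (σ , on-γ , on-δ) = concatenate γ δ k+m≈n γk≈δ0 n≤d
              k≤n    = linarith 3 (λ k m n → :0 :≤ m ⟹ k :+ m :≈ n ⟹ k :≤ n) (0≤l δ) k+m≈n
              σk≈γk  = on-γ (0≤l γ) ≤.refl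
              σ0≈γ0  = on-γ ≤.refl (0≤l γ)
              σn≈δm  = M.EqC.trans (M.EqC.sym
                (pt-cong σ (linarith 2 (λ k m → :0 :≤ k ⟹ :0 :≤ m ⟹ :0 :≤ k :+ m) (0≤l γ) (0≤l δ)) k+m≈n
                ≤.refl))
                         (on-δ (0≤l δ) ≤.refl)
          in case foot-at-end σ w of λ where
            (inj₁ w∈σ)         → ⊥-elim
              (Sum.[ w∉γ , w∉δ ]′ (∈-concatenation γ δ σ k+m≈n (on-γ , on-δ) w∈σ))
            (inj₂ (inj₁ foot)) → inj₁ (≤-resp-≈ (d-resp σ0≈γ0 M.EqC.refl) (d-resp σk≈γk M.EqC.refl)
              (foot (0≤l γ) k≤n))
            (inj₂ (inj₂ foot)) → inj₂ (≤-resp-≈ (d-resp σn≈δm M.EqC.refl) (d-resp σk≈γk M.EqC.refl)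
              (foot (0≤l γ) k≤n))

      covered : ∀ w → w ∈ γ₁ ⊎ w ∈ γ₂
      covered w = case (∈-or-∉ w γ₁ , ∈-or-∉ w γ₂) of λ where
          (inj₁ w∈γ₁ , _)        → inj₁ w∈γ₁
          (_ , inj₁ w∈γ₂)        → inj₂ w∈γ₂
          (inj₂ w∉γ₁ , inj₂ w∉γ₂) → ⊥-elim (uncovered w∉γ₁ w∉γ₂)
        where
        -- Take the common end nearer to w. Bending round it, `bend` gives a midpoint at least as
        -- near to w as this end. But `through-end` sends a geodesic from that midpoint to w through
        -- one of the common ends, making the midpoint further from w by h.
        uncovered : w ∉ γ₁ → w ∉ γ₂ → ⊥
        uncovered w∉γ₁ w∉γ₂ = case ≤.total α β of λ where
            (inj₁ α≤β) → case around-start of λ where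
              (inj₁ m₁≤α) → too-close α≤β ≤.refl (through-end γ₁ w∉γ₁ 0≤h h≤L) m₁≤α
              (inj₂ m₂≤α) → too-close α≤β ≤.refl through-γ₂ m₂≤α
            (inj₂ β≤α) → case around-end of λ where
              (inj₁ m₁≤β) → too-close ≤.refl β≤α (through-end γ₁ w∉γ₁ 0≤h h≤L) m₁≤β
              (inj₂ m₂≤β) → too-close ≤.refl β≤α through-γ₂ m₂≤β
          where
          α  = d (pt γ₁ 0#) w
          β  = d (pt γ₁ L) w
          m₁ = d (pt γ₁ h) w
          m₂ = d (pt γ₂ h) w

          0<h : 0# < h
          0<h = linarith 3 (λ h L u → 2 :× h :≈ L ⟹ :0 :< u ⟹ u :< L ⟹ :0 :< h) 2h≈L 0<u u<L

          through-γ₂ : h + α ≤ m₂ ⊎ (L - h) + β ≤ m₂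
          through-γ₂ = Sum.map
            (≤.trans (≤.reflexive (+-congˡ (d-resp start M.EqC.refl))))
            (≤.trans (≤.reflexive (+-congˡ (d-resp end M.EqC.refl))))
            (through-end γ₂ w∉γ₂ 0≤h h≤L)

          too-close : ∀ {b m} → b ≤ β → b ≤ α → h + α ≤ m ⊎ (L - h) + β ≤ m → m ≤ b → ⊥
          too-close b≤β b≤α (inj₁ f) m≤b =
            linarith 4 (λ h a b m → h :+ a :≤ m ⟹ m :≤ b ⟹ b :≤ a ⟹ :0 :< h ⟹ :⊥) f m≤b b≤α 0<h
          too-close b≤β b≤α (inj₂ f) m≤b =
            linarith 5 (λ h a b m L → (L :- h) :+ a :≤ m ⟹ m :≤ b ⟹ b :≤ a ⟹ 2 :× h :≈ L ⟹ :0 :< h ⟹ :⊥)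
            f m≤b b≤β 2h≈L 0<h

          γ₁[h-0]≈γ₁h : pt γ₁ (h - 0#) X.≈ pt γ₁ h
          γ₁[h-0]≈γ₁h = pt-cong γ₁ (linarith 1 (λ h → :0 :≤ h ⟹ :0 :≤ h :- :0) 0≤h)
            (linarith 1 (λ h → h :- :0 :≈ h)) h≤L

          γ₁[h-h]≈γ₁0 : pt γ₁ (h - h) X.≈ pt γ₁ 0#
          γ₁[h-h]≈γ₁0 = pt-cong γ₁ (linarith 1 (λ h → :0 :≤ h :- h)) (linarith 1 (λ h → h :- h :≈ :0))
            (0≤l γ₁)

          around-start : m₁ ≤ α ⊎ m₂ ≤ α
          around-start = Sum.map
            (≤-resp-≈ (d-resp γ₁[h-0]≈γ₁h M.EqC.refl) (d-resp γ₁[h-h]≈γ₁0 M.EqC.refl))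
            (≤-resp-≈ refl (d-resp γ₁[h-h]≈γ₁0 M.EqC.refl))
            (bend (backwardFrom γ₁ 0≤h h≤L) (prefix γ₂ 0≤h h≤L)
              (trans (linarith 1 (λ h → h :+ h :≈ 2 :× h)) 2h≈L)
              (M.EqC.trans γ₁[h-h]≈γ₁0 start)
              (≤-resp-≈ refl (d-resp (M.EqC.sym γ₁[h-0]≈γ₁h) M.EqC.refl) L≤across)
              (λ (t , 0≤t , t≤h , e) → w∉γ₁ (h - t , linarith 2 (λ h t → t :≤ h ⟹ :0 :≤ h :- t) t≤h ,
                linarith 3 (λ h t L → h :≤ L ⟹ :0 :≤ t ⟹ h :- t :≤ L) h≤L 0≤t , e))
              (λ (t , 0≤t , t≤h , e) → w∉γ₂ (t , 0≤t , ≤.trans t≤h h≤L , e)))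

          γ₁[h+0]≈γ₁h : pt γ₁ (h + 0#) X.≈ pt γ₁ h
          γ₁[h+0]≈γ₁h = pt-cong γ₁ (linarith 1 (λ h → :0 :≤ h ⟹ :0 :≤ h :+ :0) 0≤h)
            (linarith 1 (λ h → h :+ :0 :≈ h)) h≤L

          γ₁[h+[L-h]]≈γ₁L : pt γ₁ (h + (L - h)) X.≈ pt γ₁ L
          γ₁[h+[L-h]]≈γ₁L = pt-cong γ₁ (linarith 2 (λ h L → :0 :≤ L ⟹ :0 :≤ h :+ (L :- h)) (0≤l γ₁))
            (linarith 2 (λ h L → h :+ (L :- h) :≈ L)) ≤.refl

          γ₂[L-h]≈γ₂h : pt γ₂ (L - h) X.≈ pt γ₂ h
          γ₂[L-h]≈γ₂h = pt-cong γ₂ (linarith 2 (λ h L → h :≤ L ⟹ :0 :≤ L :- h) h≤L) L-h≈h h≤L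

          around-end : m₁ ≤ β ⊎ m₂ ≤ β
          around-end = Sum.map
            (≤-resp-≈ (d-resp γ₁[h+0]≈γ₁h M.EqC.refl) (d-resp γ₁[h+[L-h]]≈γ₁L M.EqC.refl))
            (≤-resp-≈ (d-resp γ₂[L-h]≈γ₂h M.EqC.refl) (d-resp γ₁[h+[L-h]]≈γ₁L M.EqC.refl))
            (bend (forwardFrom γ₁ 0≤h h≤L) (prefix (backwardFrom γ₂ (0≤l γ₂) ≤.refl) 0≤h h≤L)
              (linarith 2 (λ h L → (L :- h) :+ h :≈ L))
              (M.EqC.trans γ₁[h+[L-h]]≈γ₁L
                (M.EqC.trans end (pt-cong γ₂ (0≤l γ₂) (linarith 1 (λ L → L :≈ L :- :0))
                (linarith 1 (λ L → L :- :0 :≤ L)))))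
              (≤-resp-≈ refl (d-resp (M.EqC.sym γ₁[h+0]≈γ₁h) (M.EqC.sym γ₂[L-h]≈γ₂h)) L≤across)
              (λ (t , 0≤t , t≤ , e) →
                w∉γ₁ (h + t , linarith 2 (λ h t → :0 :≤ h ⟹ :0 :≤ t ⟹ :0 :≤ h :+ t) 0≤h 0≤t ,
                linarith 3 (λ h t L → t :≤ L :- h ⟹ h :+ t :≤ L) t≤ , e))
              (λ (t , 0≤t , t≤h , e) →
                w∉γ₂ (L - t , linarith 3 (λ h t L → t :≤ h ⟹ h :≤ L ⟹ :0 :≤ L :- t) t≤h h≤L ,
                linarith 2 (λ t L → :0 :≤ t ⟹ L :- t :≤ L) 0≤t , e)))

      private
        around : Carrier → X.Carrier
        around t with lem {t ≤ L}
        ... | yes _ = pt γ₁ t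
        ... | no  _ = pt γ₂ (2 · L - t)

        around-γ₁ : ∀ {t} → t ≤ L → around t X.≈ pt γ₁ t
        around-γ₁ {t} t≤L with lem {t ≤ L}
        ... | yes _   = M.EqC.refl
        ... | no  t≰L = ⊥-elim (t≰L t≤L)

        around-γ₂ : ∀ {t} → L ≤ t → around t X.≈ pt γ₂ (2 · L - t)
        around-γ₂ {t} L≤t with lem {t ≤ L}
        ... | no  _   = M.EqC.refl
        ... | yes t≤L = M.EqC.trans (pt-cong γ₁ (≤.trans (0≤l γ₁) L≤t) (≤.antisym t≤L L≤t) ≤.refl)
          (M.EqC.trans end
          (pt-cong γ₂ (0≤l γ₂) (linarith 2 (λ t L → t :≤ L ⟹ L :≤ t ⟹ L :≈ 2 :× L :- t) t≤L L≤t)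
            (linarith 2 (λ t L → L :≤ t ⟹ 2 :× L :- t :≤ L) L≤t)))

        around-distance : ∀ {s t} → 0# ≤ s → s ≤ t → t < 2 · L →
          d (around s) (around t) ≈ circular (2 · L) s t
        around-distance {s} {t} 0≤s s≤t t<2L = case (≤.total t L , ≤.total s L) of λ where
            (inj₁ t≤L , _) → short (linarith 3 (λ s t L → :0 :≤ s ⟹ t :≤ L ⟹ t :- s :≤ L) 0≤s t≤L)
              (trans (d-resp (around-γ₁ (≤.trans s≤t t≤L)) (around-γ₁ t≤L)) (isometric γ₁ 0≤s s≤t t≤L))
            (inj₂ L≤t , inj₂ L≤s) →
              short (linarith 3 (λ s t L → L :≤ s ⟹ t :< 2 :× L ⟹ t :- s :≤ L) L≤s t<2L)
              (trans (d-resp (around-γ₂ L≤s) (around-γ₂ L≤t)) (trans (isometric-sym γ₂ 0≤2L-t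
                (linarith 3 (λ s t L → s :≤ t ⟹ 2 :× L :- t :≤ 2 :× L :- s) s≤t)
                (linarith 2 (λ s L → L :≤ s ⟹ 2 :× L :- s :≤ L) L≤s))
                (linarith 3 (λ s t L → (2 :× L :- s) :- (2 :× L :- t) :≈ t :- s))))
            (inj₂ L≤t , inj₁ s≤L) → let
              2L-t≤L = linarith 2 (λ t L → L :≤ t ⟹ 2 :× L :- t :≤ L) L≤t
              in trans (d-resp (around-γ₁ s≤L) (around-γ₂ L≤t)) (through
                (cross-≤₀ 0≤s s≤L 0≤2L-t 2L-t≤L) (cross-≤₁ 0≤s s≤L 0≤2L-t 2L-t≤L)
                  (cross-≥ 0≤s s≤L 0≤2L-t 2L-t≤L)
                (circular-cases 0≤s s≤t t<2L))
          where
          0≤2L-t : 0# ≤ 2 · L - t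
          0≤2L-t = linarith 2 (λ t L → t :< 2 :× L ⟹ :0 :≤ 2 :× L :- t) t<2L

          short : ∀ {e} → t - s ≤ L → e ≈ t - s → e ≈ circular (2 · L) s t
          short t-s≤L e≈ = case circular-cases 0≤s s≤t t<2L of λ where
            (inj₁ (_ , f)) → trans e≈ (sym f)
            (inj₂ (g , f)) → linarith 5
              (λ s t L e c → t :- s :≤ L ⟹ 2 :× L :≤ 2 :× (t :- s) ⟹ e :≈ t :- s ⟹
              c :≈ 2 :× L :- (t :- s) ⟹ e :≈ c) t-s≤L g e≈ f

          -- The bounds make e the shorter way round, and `circular` takes the same minimum. In the
          -- first and the last case the two choices differ, which happens only when both ways have
          -- equal length.
          through : ∀ {e c} → e ≤ s + (2 · L - t) → e ≤ (L - s) + (L - (2 · L - t)) →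
            s + (2 · L - t) ≤ e ⊎ (L - s) + (L - (2 · L - t)) ≤ e →
            (2 · (t - s) ≤ 2 · L × c ≈ t - s) ⊎ (2 · L ≤ 2 · (t - s) × c ≈ 2 · L - (t - s)) → e ≈ c
          through e≤₀ e≤₁ (inj₁ ≤e) (inj₁ (g , f)) =
            linarith 5 (λ s t L e c → e :≤ (L :- s) :+ (L :- (2 :× L :- t)) ⟹
            s :+ (2 :× L :- t) :≤ e ⟹ 2 :× (t :- s) :≤ 2 :× L ⟹ c :≈ t :- s ⟹ e :≈ c) e≤₁ ≤e g f
          through e≤₀ e≤₁ (inj₂ ≤e) (inj₁ (g , f)) =
            linarith 5 (λ s t L e c → e :≤ (L :- s) :+ (L :- (2 :× L :- t)) ⟹
            (L :- s) :+ (L :- (2 :× L :- t)) :≤ e ⟹ c :≈ t :- s ⟹ e :≈ c) e≤₁ ≤e f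
          through e≤₀ e≤₁ (inj₁ ≤e) (inj₂ (g , f)) = linarith 5 (λ s t L e c → e :≤ s :+ (2 :× L :- t) ⟹
            s :+ (2 :× L :- t) :≤ e ⟹ c :≈ 2 :× L :- (t :- s) ⟹ e :≈ c) e≤₀ ≤e f
          through e≤₀ e≤₁ (inj₂ ≤e) (inj₂ (g , f)) = linarith 5 (λ s t L e c → e :≤ s :+ (2 :× L :- t) ⟹
            (L :- s) :+ (L :- (2 :× L :- t)) :≤ e ⟹ 2 :× L :≤ 2 :× (t :- s) ⟹ c :≈ 2 :× L :- (t :- s) ⟹
              e :≈ c) e≤₀ ≤e g f

        0<L : 0# < L
        0<L = linarith 2 (λ u L → :0 :< u ⟹ u :< L ⟹ :0 :< L) 0<u u<L

        reached : ∀ p → ∃ λ t → 0# ≤ t × t < 2 · L × around t X.≈ p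
        reached p = case covered p of λ where
            (inj₁ (t , 0≤t , t≤L , e)) → on-γ₁ 0≤t t≤L e
            (inj₂ (t , 0≤t , t≤L , e)) → case ≤-or-> t 0# of λ where
              -- The start of γ₂ would get the parameter 2L, outside [0, 2L); as the start of γ₁ it
              -- has the parameter 0.
              (inj₁ t≤0) → on-γ₁ ≤.refl (0≤l γ₁)
                (M.EqC.trans start (M.EqC.trans (pt-cong γ₂ ≤.refl (≤.antisym 0≤t t≤0) t≤L) e))
              (inj₂ 0<t) → 2 · L - t ,
                linarith 2 (λ t L → t :≤ L ⟹ :0 :≤ L ⟹ :0 :≤ 2 :× L :- t) t≤L (0≤l γ₁) ,
                linarith 2 (λ t L → :0 :< t ⟹ 2 :× L :- t :< 2 :× L) 0<t ,
                M.EqC.trans (around-γ₂ (linarith 2 (λ t L → t :≤ L ⟹ L :≤ 2 :× L :- t) t≤L))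
                  (M.EqC.trans (pt-cong γ₂
                    (linarith 2 (λ t L → :0 :≤ t ⟹ :0 :≤ 2 :× L :- (2 :× L :- t)) 0≤t)
                    (linarith 2 (λ t L → 2 :× L :- (2 :× L :- t) :≈ t)) t≤L) e)
          where
          on-γ₁ : ∀ {t} → 0# ≤ t → t ≤ L → pt γ₁ t X.≈ p → ∃ λ t → 0# ≤ t × t < 2 · L × around t X.≈ p
          on-γ₁ {t} 0≤t t≤L e = t , 0≤t , linarith 2 (λ t L → t :≤ L ⟹ :0 :< L ⟹ t :< 2 :× L) t≤L 0<L ,
            M.EqC.trans (around-γ₁ t≤L) e

      bigonCoordinates : CircularCoordinates X
      bigonCoordinates = parametrised
        (linarith 1 (λ L → :0 :< L ⟹ :0 :< 2 :× L) 0<L) around around-distance reached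

    -- The midpoint of the perimeter opposite to z is joined to z by two
    -- geodesics, one through x and one through y.
    module StrictTriangle {x y z} (xy<xz+yz : d x y < d x z + d y z) (xz<xy+yz : d x z < d x y + d y z)
      (yz<xy+xz : d y z < d x y + d x z) where

      private
        side = geodesic x y
        γ  = proj₁ side
        γ0 = proj₁ (proj₂ side)
        γ1 = proj₂ (proj₂ side)
        xz = geodesic x z
        yz = geodesic y z

        halfPerimeter : ∃ λ L → 2 · L ≈ d x y + d x z + d y z
        halfPerimeter = fraction 1 _

        L = proj₁ halfPerimeter

        L-spec : 2 · L ≈ d x y + d x z + d y z
        L-spec = proj₂ halfPerimeter

        -- The place of c on γ, chosen so that the ways from c to z through x and through y both
        -- have length L.
        u : Carrier
        u = L - d x z

        0<u : 0# < u
        0<u = linarith 4 (λ L xy xz yz → 2 :× L :≈ xy :+ xz :+ yz ⟹ xz :< xy :+ yz ⟹ :0 :< L :- xz)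
          L-spec xz<xy+yz

        u<xy : u < d x y
        u<xy = linarith 4 (λ L xy xz yz → 2 :× L :≈ xy :+ xz :+ yz ⟹ yz :< xy :+ xz ⟹ L :- xz :< xy)
          L-spec yz<xy+xz

        z∉γ : z ∉ γ
        z∉γ (v , 0≤v , v≤l , γv≈z) =
          linarith 4 (λ xy xz yz v → xy :< xz :+ yz ⟹ xz :≈ v ⟹ yz :≈ xy :- v ⟹ :⊥)
          xy<xz+yz (trans (d-resp (M.EqC.sym γ0) (M.EqC.sym γv≈z)) (from-start γ 0≤v v≤l))
          (trans (d-resp (M.EqC.sym γ1) (M.EqC.sym γv≈z)) (isometric-sym γ 0≤v v≤l ≤.refl))

        c = pt γ u

        -- Any geodesic from c to z leaves γ through x or y, and both these ways have length L. This
        -- is what makes them geodesics.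
        L≤cz : L ≤ d c z
        L≤cz = case through-end γ z∉γ (<⇒≤ 0<u) (<⇒≤ u<xy) of λ where
          (inj₁ h) → linarith 4 (λ L xz 0z cz → (L :- xz) :+ 0z :≤ cz ⟹ 0z :≈ xz ⟹ L :≤ cz) h
            (d-resp γ0 M.EqC.refl)
          (inj₂ h) → linarith 6
            (λ L xy xz yz 1z cz → (xy :- (L :- xz)) :+ 1z :≤ cz ⟹ 1z :≈ yz ⟹ 2 :× L :≈ xy :+ xz :+ yz ⟹
            L :≤ cz)
            h (d-resp γ1 M.EqC.refl) L-spec

        u-0≈u : u - 0# ≈ u
        u-0≈u = linarith 1 λ u → u :- :0 :≈ u

        u+0≈u : u + 0# ≈ u
        u+0≈u = linarith 1 λ u → u :+ :0 :≈ u

        γ[u-0]≈c : pt γ (u - 0#) X.≈ c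
        γ[u-0]≈c = pt-cong γ (≤-resp-≈ refl (sym u-0≈u) (<⇒≤ 0<u)) u-0≈u (<⇒≤ u<xy)

        γ[u+0]≈c : pt γ (u + 0#) X.≈ c
        γ[u+0]≈c = pt-cong γ (≤-resp-≈ refl (sym u+0≈u) (<⇒≤ 0<u)) u+0≈u (<⇒≤ u<xy)

        γ[u-u]≈x : pt γ (u - u) X.≈ x
        γ[u-u]≈x = M.EqC.trans
          (pt-cong γ (linarith 1 λ u → :0 :≤ u :- u) (linarith 1 λ u → u :- u :≈ :0) (0≤l γ)) γ0

        γ[u+[xy-u]]≈y : pt γ (u + (d x y - u)) X.≈ y
        γ[u+[xy-u]]≈y = M.EqC.trans
          (pt-cong γ (linarith 2 (λ u l → :0 :≤ l ⟹ :0 :≤ u :+ (l :- u)) (0≤l γ))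
          (linarith 2 λ u l → u :+ (l :- u) :≈ l) ≤.refl) γ1

        to-x : Segment u
        to-x = backwardFrom γ (<⇒≤ 0<u) (<⇒≤ u<xy)

        to-y : Segment (d x y - u)
        to-y = forwardFrom γ (<⇒≤ 0<u) (<⇒≤ u<xy)

        lengths₁ : u + d x z ≈ L
        lengths₁ = linarith 2 λ L xz → (L :- xz) :+ xz :≈ L

        lengths₂ : (d x y - u) + d y z ≈ L
        lengths₂ = linarith 4
          (λ L xy xz yz → 2 :× L :≈ xy :+ xz :+ yz ⟹ (xy :- (L :- xz)) :+ yz :≈ L) L-spec

        via-x : ∃ λ (γ₁ : Segment L) → Concatenation to-x (proj₁ xz) γ₁
        via-x = concatenate to-x (proj₁ xz) lengths₁
          (M.EqC.trans γ[u-u]≈x (M.EqC.sym (proj₁ (proj₂ xz))))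
          (≤-resp-≈ refl (d-resp (M.EqC.sym γ[u-0]≈c) (M.EqC.sym (proj₂ (proj₂ xz)))) L≤cz)

        via-y : ∃ λ (γ₂ : Segment L) → Concatenation to-y (proj₁ yz) γ₂
        via-y = concatenate to-y (proj₁ yz) lengths₂
          (M.EqC.trans γ[u+[xy-u]]≈y (M.EqC.sym (proj₁ (proj₂ yz))))
          (≤-resp-≈ refl (d-resp (M.EqC.sym γ[u+0]≈c) (M.EqC.sym (proj₂ (proj₂ yz)))) L≤cz)

        γ₁ = proj₁ via-x
        γ₂ = proj₁ via-y

        ends-at-z : ∀ {p k} (δ : Segment k)
          (side : ∃ λ (σ : Segment (d p z)) → pt σ 0# X.≈ p × pt σ (d p z) X.≈ z)
          (σ : Segment L) → k + d p z ≈ L → Concatenation δ (proj₁ side) σ → pt σ L X.≈ z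
        ends-at-z {p} {k} δ (τ , _ , τ-end) σ sum (_ , on-τ) = M.EqC.trans
          (M.EqC.sym (pt-cong σ
            (linarith 2 (λ k l → :0 :≤ k ⟹ :0 :≤ l ⟹ :0 :≤ k :+ l) (0≤l δ) (0≤l τ)) sum ≤.refl))
          (M.EqC.trans (on-τ (0≤l τ) ≤.refl) τ-end)

        start : pt γ₁ 0# X.≈ pt γ₂ 0#
        start = M.EqC.trans (M.EqC.trans (proj₁ (proj₂ via-x) ≤.refl (0≤l to-x)) γ[u-0]≈c)
          (M.EqC.sym (M.EqC.trans (proj₁ (proj₂ via-y) ≤.refl (0≤l to-y)) γ[u+0]≈c))

        end : pt γ₁ L X.≈ pt γ₂ L
        end = M.EqC.trans (ends-at-z to-x xz γ₁ lengths₁ (proj₂ via-x))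
          (M.EqC.sym (ends-at-z to-y yz γ₂ lengths₂ (proj₂ via-y)))

        -- On γ, the part of γ₂ between c and y starts at u > 0, away from x. On the geodesic from y
        -- to z, x would turn a strict triangle inequality into an equality.
        x∉γ₂ : x ∉ γ₂
        x∉γ₂ x∈γ₂ = case ∈-concatenation to-y (proj₁ yz) γ₂ lengths₂ (proj₂ via-y) x∈γ₂ of λ where
          (inj₁ (t , 0≤t , t≤ , e)) →
            linarith 3 (λ xx u t → xx :≈ u :+ t ⟹ xx :≈ :0 ⟹ :0 :< u ⟹ :0 :≤ t ⟹ :⊥)
            (trans (d-resp (M.EqC.sym γ0) (M.EqC.sym e))
              (from-start γ (linarith 2 (λ u t → :0 :< u ⟹ :0 :≤ t ⟹ :0 :≤ u :+ t) 0<u 0≤t)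
              (linarith 3 (λ u t l → t :≤ l :- u ⟹ u :+ t :≤ l) t≤)))
            (M.≈⇒0 (M.EqC.refl {x})) 0<u 0≤t
          (inj₂ (t , 0≤t , t≤ , e)) →
            linarith 5 (λ xy xz yz yx t → yz :< xy :+ xz ⟹ yx :≈ t ⟹ xz :≈ yz :- t ⟹ xy :≈ yx ⟹ :⊥)
            yz<xy+xz (trans (d-resp (M.EqC.sym (proj₁ (proj₂ yz))) (M.EqC.sym e))
              (from-start (proj₁ yz) 0≤t t≤))
            (trans (d-resp (M.EqC.sym e) (M.EqC.sym (proj₂ (proj₂ yz))))
              (isometric (proj₁ yz) 0≤t t≤ ≤.refl)) (M.sym _ _)

      triangleCoordinates : CircularCoordinates X
      triangleCoordinates = Bigon.bigonCoordinates γ₁ γ₂ start end (<⇒≤ 0<u)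
        (linarith 2 (λ L xz → :0 :≤ xz ⟹ L :- xz :≤ L) M.nonNegative)
        (M.EqC.trans (proj₁ (proj₂ via-x) (<⇒≤ 0<u) ≤.refl) γ[u-u]≈x) x∉γ₂

-- Copying finite configurations between spaces

module Configurations (ℝ : CompleteOrderedField) (lem : ExcludedMiddle 0ℓ) where

  open Analysis ℝ lem

  private
    variable
      a b ℓ ℓ′ : Level

  Realises : (X : DistanceSpace ℝ a ℓ) (Y : DistanceSpace ℝ b ℓ′) {V : Set} → Carrier → Carrier →
    (V → DistanceSpace.Carrier X) → (V → DistanceSpace.Carrier Y) → Set
  Realises X Y δ ε ρ σ = ∀ u v → u ≢ v → X.d (ρ u) (ρ v) ≤ δ ⇔ Y.d (σ u) (σ v) ≤ ε
    where
    module X = DistanceSpace X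
    module Y = DistanceSpace Y

  module _ (X : DistanceSpace ℝ a ℓ) (Y : DistanceSpace ℝ b ℓ′) where
    private
      module X = DistanceSpace X
      module Y = DistanceSpace Y

    -- The configuration is turned into a graph and represented anew in the other space. Edges
    -- demand distinct vertices, as the graph has to be irreflexive even though each point is within
    -- δ of itself.
    transfer : (∀ p q → X.d p q ≈ X.d q p) → (∀ {G} → UBG ℝ X G → UBG ℝ Y G) →
      ∀ {V n} → V ↔ Fin n → ∀ {δ} → 0# < δ → (ρ : V → X.Carrier) →
      ∃ λ ε → 0# < ε × ∃ λ (σ : V → Y.Carrier) → Realises X Y δ ε ρ σ
    transfer d-sym X⊆Y {V} {n} V↔n {δ} 0<δ ρ =
      let (ε , 0<ε , σ , σ-edge) = X⊆Y {G} (δ , 0<δ , ρ , λ u v u≢v → mk⇔ proj₂ (u≢v ,_)) in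
      ε , 0<ε , σ , λ u v u≢v → mk⇔ (λ h → Equivalence.to (σ-edge u v u≢v) (u≢v , h))
                                     (λ h → proj₂ (Equivalence.from (σ-edge u v u≢v) h))
      where
      G : FiniteGraph
      G = record
        { Vertex      = V
        ; finite      = n , V↔n
        ; Edge        = λ u v → u ≢ v × X.d (ρ u) (ρ v) ≤ δ
        ; symmetric   = λ (u≢v , h) → u≢v ∘ ≡.sym , ≤-resp-≈ (d-sym _ _) refl h
        ; irreflexive = λ u≡v (u≢v , _) → u≢v u≡v
        }

-- Nets and hexagons on the circle

module CircleConfigurations (ℝ : CompleteOrderedField) (lem : ExcludedMiddle 0ℓ) where

  open ArcLength ℝ lem
  open Coordinates ℝ lem
  open CircleCoordinates ℝ lem
  open Net ℝ (S¹ ℝ lem)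
  private
    module S = DistanceSpace (S¹ ℝ lem)

  circle-d : ∀ p q → S.d p q ≡ min (arc p q) (arc q p)
  circle-d p q = ≡.sym (≡.cong₂ min (arc≡arcLength p q) (arc≡arcLength q p))

  circle-d-sym : ∀ p q → S.d p q ≈ S.d q p
  circle-d-sym p q = ⊓-comm _ _

  circle-d-cong : ∀ {p p′ q q′} → p ≈ₚ p′ → q ≈ₚ q′ → S.d p q ≈ S.d p′ q′
  circle-d-cong {p} {p′} {q} {q′} e f = ≡.subst₂ _≈_ (≡.sym (circle-d p q)) (≡.sym (circle-d p′ q′))
    (⊓-cong (arc-cong {p} {p′} {q} {q′} e f) (arc-cong {q} {q′} {p} {p′} f e))

  -- Keeps the direction of the short arc, which the minimum in the metric of `S¹` forgets.
  Near : Carrier → Point → Point → Set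
  Near δ p q = arc p q ≤ δ ⊎ arc q p ≤ δ

  d⇒Near : ∀ {δ} p q → S.d p q ≤ δ → Near δ p q
  d⇒Near {δ} p q h = Sum.map
    (λ (_ , m≈) → ≤-resp-≈ m≈ refl h′) (λ (_ , m≈) → ≤-resp-≈ m≈ refl h′)
      (min-cases (arc p q) (arc q p))
    where
    h′ = ≡.subst (_≤ δ) (circle-d p q) h

  Near⇒d : ∀ {δ} p q → Near δ p q → S.d p q ≤ δ
  Near⇒d {δ} p q near =
    ≡.subst (_≤ δ) (≡.sym (circle-d p q)) (smaller-of (min-cases (arc p q) (arc q p)) near)
    where
    smaller-of : ∀ {m} → (arc p q ≤ arc q p × m ≈ arc p q) ⊎ (arc q p ≤ arc p q × m ≈ arc q p) →
      Near δ p q → m ≤ δ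
    smaller-of (inj₁ (_ , e)) (inj₁ h) = ≤-resp-≈ (sym e) refl h
    smaller-of (inj₁ (g , e)) (inj₂ h) = ≤-resp-≈ (sym e) refl (≤.trans g h)
    smaller-of (inj₂ (g , e)) (inj₁ h) = ≤-resp-≈ (sym e) refl (≤.trans g h)
    smaller-of (inj₂ (_ , e)) (inj₂ h) = ≤-resp-≈ (sym e) refl h

  module _ {δ} (0<δ : 0# < δ) where

    near-refl : ∀ {p q} → p ≈ₚ q → Near δ p q
    near-refl {p} {q} p≈q = inj₁ (≤-resp-≈ (sym (arc-zero {p} {q} p≈q)) refl (<⇒≤ 0<δ))

    ahead-near : ∀ p q r → arc p q ≤ δ → arc p r ≤ δ → Near δ q r
    ahead-near p q r pq≤δ pr≤δ = Sum.map
      (λ e → linarith 4 (λ pr pq qr δ → pr :≈ pq :+ qr ⟹ :0 :≤ pq ⟹ pr :≤ δ ⟹ qr :≤ δ) e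
        (arc-nonneg p q) pr≤δ)
      (λ e → linarith 4 (λ pr pq rq δ → pq :≈ pr :+ rq ⟹ :0 :≤ pr ⟹ pq :≤ δ ⟹ rq :≤ δ) e
        (arc-nonneg p r) pq≤δ)
      (arc-order p q r)

    -- `arc-order` compares arcs that begin at p, so arcs ending there are replaced by their
    -- complements in 2π; points equal to p have no such complement and are treated first.
    behind-near : ∀ p q r → arc q p ≤ δ → arc r p ≤ δ → Near δ q r
    behind-near p q r qp≤δ rp≤δ with lem {p ≈ₚ q} | lem {p ≈ₚ r}
    ... | yes p≈q | _ = inj₂ (≤-resp-≈ (arc-cong {r} {r} {p} {q} (≈ₚ-refl {r}) p≈q) refl rp≤δ)
    ... | no _ | yes p≈r = inj₁ (≤-resp-≈ (arc-cong {q} {q} {p} {r} (≈ₚ-refl {q}) p≈r) refl qp≤δ)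
    ... | no p≉q | no p≉r = Sum.map
      (λ e → linarith 7 (λ pq qp pr rp qr c δ → pq :+ qp :≈ c ⟹ pr :+ rp :≈ c ⟹ pr :≈ pq :+ qr ⟹
        qp :≤ δ ⟹ :0 :≤ rp ⟹ qr :≤ δ)
        (perimeter-2π p q p≉q) (perimeter-2π p r p≉r) e qp≤δ (arc-nonneg r p))
      (λ e → linarith 7 (λ pq qp pr rp rq c δ → pq :+ qp :≈ c ⟹ pr :+ rp :≈ c ⟹ pq :≈ pr :+ rq ⟹
        rp :≤ δ ⟹ :0 :≤ qp ⟹ rq :≤ δ)
        (perimeter-2π p q p≉q) (perimeter-2π p r p≉r) e rp≤δ (arc-nonneg q p))
      (arc-order p q r)

    all-near : 2π ≤ 2 · δ → ∀ p q → Near δ p q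
    all-near 2π≤2δ p q with lem {p ≈ₚ q}
    ... | yes p≈q = near-refl {p} {q} p≈q
    ... | no  p≉q = Sum.map
      (λ h → linarith 4 (λ pq qp c δ → pq :≤ qp ⟹ pq :+ qp :≈ c ⟹ c :≤ 2 :× δ ⟹ pq :≤ δ) h
        (perimeter-2π p q p≉q) 2π≤2δ)
      (λ h → linarith 4 (λ pq qp c δ → qp :≤ pq ⟹ pq :+ qp :≈ c ⟹ c :≤ 2 :× δ ⟹ qp :≤ δ) h
        (perimeter-2π p q p≉q) 2π≤2δ)
      (≤.total (arc p q) (arc q p))

  -- The pendant vertex at a corner leaves it on one side, forcing the other
  -- corners to the opposite side.  Two of the three corners choose the same
  -- side, so that each of them follows the other within δ.
  circle-netFree : NetFree
  circle-netFree {δ} a b 0<δ (triangle , near , far) =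
    pigeonhole (side zero) (side (suc zero)) (side (suc (suc zero)))
    where
    Follows Precedes : Fin 3 → Set
    Follows  i = ∀ j → i ≢ j → arc (a j) (a i) ≤ δ
    Precedes i = ∀ j → i ≢ j → arc (a i) (a j) ≤ δ

    not-near : ∀ {i j} → i ≢ j → ¬ Near δ (b i) (a j)
    not-near {i} {j} i≢j h = far i j i≢j (Near⇒d (b i) (a j) h)

    side : ∀ i → Follows i ⊎ Precedes i
    side i = Sum.map
      (λ ab≤δ j i≢j → Sum.[
        (λ aa≤δ → ⊥-elim (not-near i≢j (ahead-near 0<δ (a i) (b i) (a j) ab≤δ aa≤δ))) , id ]′
        (d⇒Near (a i) (a j) (triangle i j i≢j)))
      (λ ba≤δ j i≢j → Sum.[ id ,
        (λ aa≤δ → ⊥-elim (not-near i≢j (behind-near 0<δ (a i) (b i) (a j) ba≤δ aa≤δ))) ]′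
        (d⇒Near (a i) (a j) (triangle i j i≢j)))
      (d⇒Near (a i) (b i) (near i))

    -- The two arcs make up the perimeter, so 2π is at most 2δ and all points of the circle are near
    -- each other. If the corners coincide, the pendant point of one is near the other.
    both : ∀ i j → i ≢ j → arc (a i) (a j) ≤ δ → arc (a j) (a i) ≤ δ → ⊥
    both i j i≢j h k with lem {a i ≈ₚ a j}
    ... | yes e = not-near i≢j (Sum.map
      (≤-resp-≈ (arc-cong {b i} {b i} {a i} {a j} (≈ₚ-refl {b i}) e) refl)
      (≤-resp-≈ (arc-cong {a i} {a j} {b i} {b i} e (≈ₚ-refl {b i})) refl)
      (Sum.swap (d⇒Near (a i) (b i) (near i))))
    ... | no ne = not-near i≢j
      (all-near 0<δ (linarith 4 (λ p q c δ → p :+ q :≈ c ⟹ p :≤ δ ⟹ q :≤ δ ⟹ c :≤ 2 :× δ)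
      (perimeter-2π (a i) (a j) ne) h k) (b i) (a j))

    follows : ∀ i j → i ≢ j → Follows i → Follows j → ⊥
    follows i j i≢j f g = both i j i≢j (g i (i≢j ∘ ≡.sym)) (f j i≢j)

    precedes : ∀ i j → i ≢ j → Precedes i → Precedes j → ⊥
    precedes i j i≢j f g = both i j i≢j (f j i≢j) (g i (i≢j ∘ ≡.sym))

    pigeonhole : Follows zero ⊎ Precedes zero → Follows (suc zero) ⊎ Precedes (suc zero) →
      Follows (suc (suc zero)) ⊎ Precedes (suc (suc zero)) → ⊥
    pigeonhole (inj₁ f) (inj₁ g) _        = follows _ _ (λ ()) f g
    pigeonhole (inj₁ f) _        (inj₁ g) = follows _ _ (λ ()) f g
    pigeonhole _        (inj₁ f) (inj₁ g) = follows _ _ (λ ()) f g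
    pigeonhole (inj₂ f) (inj₂ g) _        = precedes _ _ (λ ()) f g
    pigeonhole (inj₂ f) _        (inj₂ g) = precedes _ _ (λ ()) f g
    pigeonhole _        (inj₂ f) (inj₂ g) = precedes _ _ (λ ()) f g

  -- Alternate vertices v of a hexagon, with m j a common neighbour of the two corners other than v
  -- j.
  IsHexagon : Carrier → (Fin 3 → Point) → (Fin 3 → Point) → Set
  IsHexagon δ v m = (∀ i j → i ≢ j → ¬ (S.d (v i) (v j) ≤ δ)) × (∀ i j → i ≢ j → S.d (v i) (m j) ≤ δ)

  circle-hexagon : ∃ λ δ → 0# < δ × ∃ λ v → ∃ λ m → IsHexagon δ v m
  circle-hexagon = s , 0<s , v , m , far , near
    where
    open CircularCoordinates circleCoordinates hiding (0<c)

    s : Carrier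
    s = proj₁ (fraction 5 2π)

    6s≈2π : 6 · s ≈ 2π
    6s≈2π = proj₂ (fraction 5 2π)

    0<s : 0# < s
    0<s = linarith 2 (λ s c → 6 :× s :≈ c ⟹ :0 :< c ⟹ :0 :< s) 6s≈2π 0<2π

    at : ∀ {t} → 0# ≤ t → t < 2π → Point
    at 0≤t t<2π = proj₁ (coord-surjective 0≤t t<2π)

    -- m j is diametrically opposite to v j, hence next to the other two corners.
    v m : Fin 3 → Point
    v zero             = at {0# } ≤.refl 0<2π
    v (suc zero)       = at {2 · s} (linarith 1 (λ s → :0 :< s ⟹ :0 :≤ 2 :× s) 0<s)
      (linarith 2 (λ s c → 6 :× s :≈ c ⟹ :0 :< s ⟹ 2 :× s :< c) 6s≈2π 0<s)
    v (suc (suc zero)) = at {4 · s} (linarith 1 (λ s → :0 :< s ⟹ :0 :≤ 4 :× s) 0<s)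
      (linarith 2 (λ s c → 6 :× s :≈ c ⟹ :0 :< s ⟹ 4 :× s :< c) 6s≈2π 0<s)
    m zero             = at {3 · s} (linarith 1 (λ s → :0 :< s ⟹ :0 :≤ 3 :× s) 0<s)
      (linarith 2 (λ s c → 6 :× s :≈ c ⟹ :0 :< s ⟹ 3 :× s :< c) 6s≈2π 0<s)
    m (suc zero)       = at {5 · s} (linarith 1 (λ s → :0 :< s ⟹ :0 :≤ 5 :× s) 0<s)
      (linarith 2 (λ s c → 6 :× s :≈ c ⟹ :0 :< s ⟹ 5 :× s :< c) 6s≈2π 0<s)
    m (suc (suc zero)) = at {1 · s} (linarith 1 (λ s → :0 :< s ⟹ :0 :≤ 1 :× s) 0<s)
      (linarith 2 (λ s c → 6 :× s :≈ c ⟹ :0 :< s ⟹ 1 :× s :< c) 6s≈2π 0<s)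

    coord-at : ∀ {t} (0≤t : 0# ≤ t) (t<2π : t < 2π) → coord (at 0≤t t<2π) ≈ t
    coord-at 0≤t t<2π = proj₂ (coord-surjective 0≤t t<2π)

    module _ {t u} {0≤t : 0# ≤ t} {t<2π : t < 2π} {0≤u : 0# ≤ u} {u<2π : u < 2π} where

      at-cases : t ≤ u →
        (2 · (u - t) ≤ 2π × S.d (at 0≤t t<2π) (at 0≤u u<2π) ≈ u - t) ⊎
        (2π ≤ 2 · (u - t) × S.d (at 0≤t t<2π) (at 0≤u u<2π) ≈ 2π - (u - t))
      at-cases t≤u = Sum.map
        (λ (h , f) →
          linarith 5 (λ t u t′ u′ c → 2 :× (u′ :- t′) :≤ c ⟹ t′ :≈ t ⟹ u′ :≈ u ⟹ 2 :× (u :- t) :≤ c) h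
            t′≈t u′≈u ,
          linarith 6 (λ e g t u t′ u′ → e :≈ g ⟹ g :≈ u′ :- t′ ⟹ t′ :≈ t ⟹ u′ :≈ u ⟹ e :≈ u :- t)
            (d-coord p q) f t′≈t u′≈u)
        (λ (h , f) →
          linarith 5 (λ t u t′ u′ c → c :≤ 2 :× (u′ :- t′) ⟹ t′ :≈ t ⟹ u′ :≈ u ⟹ c :≤ 2 :× (u :- t)) h
            t′≈t u′≈u ,
          linarith 7 (λ e g t u t′ u′ c → e :≈ g ⟹ g :≈ c :- (u′ :- t′) ⟹ t′ :≈ t ⟹ u′ :≈ u ⟹
            e :≈ c :- (u :- t))
            (d-coord p q) f t′≈t u′≈u)
        (circular-cases (0≤coord p) (≤-resp-≈ (sym t′≈t) (sym u′≈u) t≤u) (coord<c q))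
        where
        p = at 0≤t t<2π
        q = at 0≤u u<2π
        t′≈t = coord-at 0≤t t<2π
        u′≈u = coord-at 0≤u u<2π

      apart : t + 2 · s ≤ u → u ≤ t + 4 · s → ¬ (S.d (at 0≤t t<2π) (at 0≤u u<2π) ≤ s)
      apart h k d≤s = case at-cases
        (linarith 3 (λ t u s → t :+ 2 :× s :≤ u ⟹ :0 :< s ⟹ t :≤ u) h 0<s) of λ where
        (inj₁ (_ , e)) → linarith 4
          (λ d t u s → d :≈ u :- t ⟹ t :+ 2 :× s :≤ u ⟹ d :≤ s ⟹ :0 :< s ⟹ :⊥) e h d≤s 0<s
        (inj₂ (_ , e)) → linarith 5
          (λ d t u s c → d :≈ c :- (u :- t) ⟹ u :≤ t :+ 4 :× s ⟹ 6 :× s :≈ c ⟹ d :≤ s ⟹ :0 :< s ⟹ :⊥)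
          e k 6s≈2π d≤s 0<s

      adjacent : t ≤ u → u ≤ t + s → S.d (at 0≤t t<2π) (at 0≤u u<2π) ≤ s
      adjacent t≤u u≤t+s = case at-cases t≤u of λ where
        (inj₁ (_ , e)) → linarith 4 (λ d t u s → d :≈ u :- t ⟹ u :≤ t :+ s ⟹ d :≤ s) e u≤t+s
        (inj₂ (h , _)) → ⊥-elim
          (linarith 4 (λ t u s c → c :≤ 2 :× (u :- t) ⟹ u :≤ t :+ s ⟹ 6 :× s :≈ c ⟹ :0 :< s ⟹ :⊥)
          h u≤t+s 6s≈2π 0<s)

      -- For the side of the hexagon that crosses the point where the coordinate jumps from 2π to 0.
      adjacent-around : t + 5 · s ≤ u → S.d (at 0≤t t<2π) (at 0≤u u<2π) ≤ s
      adjacent-around h = case at-cases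
        (linarith 3 (λ t u s → t :+ 5 :× s :≤ u ⟹ :0 :< s ⟹ t :≤ u) h 0<s) of λ where
        (inj₁ (k , _)) → ⊥-elim
          (linarith 4 (λ t u s c → 2 :× (u :- t) :≤ c ⟹ t :+ 5 :× s :≤ u ⟹ 6 :× s :≈ c ⟹ :0 :< s ⟹ :⊥)
          k h 6s≈2π 0<s)
        (inj₂ (_ , e)) → linarith 5
          (λ d t u s c → d :≈ c :- (u :- t) ⟹ t :+ 5 :× s :≤ u ⟹ 6 :× s :≈ c ⟹ d :≤ s) e h 6s≈2π

    swap : ∀ {p q} → S.d p q ≤ s → S.d q p ≤ s
    swap {p} {q} = ≤-resp-≈ (circle-d-sym p q) refl

    v₀v₁ : ¬ (S.d (v zero) (v (suc zero)) ≤ s)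
    v₀v₁ = apart (linarith 1 λ s → :0 :+ 2 :× s :≤ 2 :× s)
      (linarith 1 (λ s → :0 :< s ⟹ 2 :× s :≤ :0 :+ 4 :× s) 0<s)

    v₀v₂ : ¬ (S.d (v zero) (v (suc (suc zero))) ≤ s)
    v₀v₂ = apart (linarith 1 (λ s → :0 :< s ⟹ :0 :+ 2 :× s :≤ 4 :× s) 0<s)
      (linarith 1 λ s → 4 :× s :≤ :0 :+ 4 :× s)

    v₁v₂ : ¬ (S.d (v (suc zero)) (v (suc (suc zero))) ≤ s)
    v₁v₂ = apart (linarith 1 λ s → 2 :× s :+ 2 :× s :≤ 4 :× s)
      (linarith 1 (λ s → :0 :< s ⟹ 4 :× s :≤ 2 :× s :+ 4 :× s) 0<s)

    far : ∀ i j → i ≢ j → ¬ (S.d (v i) (v j) ≤ s)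
    far zero             zero             0≢0 = ⊥-elim (0≢0 ≡.refl)
    far zero             (suc zero)       _   = v₀v₁
    far zero             (suc (suc zero)) _   = v₀v₂
    far (suc zero)       zero             _   = v₀v₁ ∘ swap
    far (suc zero)       (suc zero)       1≢1 = ⊥-elim (1≢1 ≡.refl)
    far (suc zero)       (suc (suc zero)) _   = v₁v₂
    far (suc (suc zero)) zero             _   = v₀v₂ ∘ swap
    far (suc (suc zero)) (suc zero)       _   = v₁v₂ ∘ swap
    far (suc (suc zero)) (suc (suc zero)) 2≢2 = ⊥-elim (2≢2 ≡.refl)

    near : ∀ i j → i ≢ j → S.d (v i) (m j) ≤ s
    near zero             zero             0≢0 = ⊥-elim (0≢0 ≡.refl)
    near zero             (suc zero)       _   =
      adjacent-around (linarith 1 λ s → :0 :+ 5 :× s :≤ 5 :× s)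
    near zero             (suc (suc zero)) _   =
      adjacent (linarith 1 (λ s → :0 :< s ⟹ :0 :≤ 1 :× s) 0<s)
      (linarith 1 λ s → 1 :× s :≤ :0 :+ s)
    near (suc zero)       zero             _   =
      adjacent (linarith 1 (λ s → :0 :< s ⟹ 2 :× s :≤ 3 :× s) 0<s)
      (linarith 1 λ s → 3 :× s :≤ 2 :× s :+ s)
    near (suc zero)       (suc zero)       1≢1 = ⊥-elim (1≢1 ≡.refl)
    near (suc zero)       (suc (suc zero)) _   =
      swap (adjacent (linarith 1 (λ s → :0 :< s ⟹ 1 :× s :≤ 2 :× s) 0<s)
      (linarith 1 λ s → 2 :× s :≤ 1 :× s :+ s))
    near (suc (suc zero)) zero             _   =
      swap (adjacent (linarith 1 (λ s → :0 :< s ⟹ 3 :× s :≤ 4 :× s) 0<s)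
      (linarith 1 λ s → 4 :× s :≤ 3 :× s :+ s))
    near (suc (suc zero)) (suc zero)       _   =
      adjacent (linarith 1 (λ s → :0 :< s ⟹ 4 :× s :≤ 5 :× s) 0<s)
      (linarith 1 λ s → 5 :× s :≤ 4 :× s :+ s)
    near (suc (suc zero)) (suc (suc zero)) 2≢2 = ⊥-elim (2≢2 ≡.refl)

-- Similarity of circles and the invariance of unit ball graphs

module Similarity (ℝ : CompleteOrderedField) (lem : ExcludedMiddle 0ℓ) where

  open Analysis ℝ lem
  open Coordinates ℝ lem

  module _ {r} (0<r : 0# < r) where

    private
      scale-≤ : ∀ {s t} → s ≤ t → r * s ≤ r * t
      scale-≤ s≤t = linarith 3 (λ r s t → :0 :≤ r :* (t :- s) ⟹ r :* s :≤ r :* t)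
        (*-nonNeg (<⇒≤ 0<r) (linarith 2 (λ s t → s :≤ t ⟹ :0 :≤ t :- s) s≤t))

      scale-< : ∀ {s t} → s < t → r * s < r * t
      scale-< s<t = linarith 3 (λ r s t → :0 :< r :* (t :- s) ⟹ r :* s :< r :* t)
        (*-pos 0<r (linarith 2 (λ s t → s :< t ⟹ :0 :< t :- s) s<t))

      circular-scale-≤ : ∀ {c s t} → 0# ≤ s → s ≤ t → t < c →
        circular (r * c) (r * s) (r * t) ≈ r * circular c s t
      circular-scale-≤ {c} {s} {t} 0≤s s≤t t<c = compare
        (circular-cases (*-nonNeg (<⇒≤ 0<r) 0≤s)
          (scale-≤ s≤t) (scale-< t<c))
        (circular-cases 0≤s s≤t t<c)
        where
        compare : ∀ {e f} → (2 · (r * t - r * s) ≤ r * c × e ≈ r * t - r * s) ⊎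
          (r * c ≤ 2 · (r * t - r * s) × e ≈ r * c - (r * t - r * s)) →
          (2 · (t - s) ≤ c × f ≈ t - s) ⊎ (c ≤ 2 · (t - s) × f ≈ c - (t - s)) → e ≈ r * f
        compare (inj₁ (_ , e≈)) (inj₁ (_ , f≈)) =
          trans e≈ (trans (linarith 3 λ r s t → r :* t :- r :* s :≈ r :* (t :- s)) (*-congˡ (sym f≈)))
        compare (inj₂ (_ , e≈)) (inj₂ (_ , f≈)) =
          trans e≈ (trans (linarith 4 λ r s t c → r :* c :- (r :* t :- r :* s) :≈ r :* (c :- (t :- s)))
          (*-congˡ (sym f≈)))
        -- Different branches are possible only at a tie, where they give the same value.
        compare (inj₁ (h , e≈)) (inj₂ (k , f≈)) = trans e≈ (trans
          (linarith 4 (λ r s t c → r :* c :≤ r :* (2 :× (t :- s)) ⟹ 2 :× (r :* t :- r :* s) :≤ r :* c ⟹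
            r :* t :- r :* s :≈ r :* (c :- (t :- s)))
            (scale-≤ k) h) (*-congˡ (sym f≈)))
        compare (inj₂ (h , e≈)) (inj₁ (k , f≈)) = trans e≈ (trans
          (linarith 4 (λ r s t c → r :* (2 :× (t :- s)) :≤ r :* c ⟹ r :* c :≤ 2 :× (r :* t :- r :* s) ⟹
            r :* c :- (r :* t :- r :* s) :≈ r :* (t :- s))
            (scale-≤ k) h) (*-congˡ (sym f≈)))

    circular-scale : ∀ {c s t} → 0# ≤ s → s < c → 0# ≤ t → t < c →
      circular (r * c) (r * s) (r * t) ≈ r * circular c s t
    circular-scale {c} {s} {t} 0≤s s<c 0≤t t<c = Sum.[
        (λ s≤t → circular-scale-≤ 0≤s s≤t t<c)
      , (λ t≤s → trans (circular-sym _ _ _)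
        (trans (circular-scale-≤ 0≤t t≤s s<c) (*-congˡ (circular-sym _ _ _)))) ]′ (≤.total s t)

  ∣∣-cong : ∀ {s t} → s ≈ t → ∣ s ∣ ≈ ∣ t ∣
  ∣∣-cong s≈t = ⊔-cong s≈t (-‿cong s≈t)

  circular-cong : ∀ {c c′ s s′ t t′} → c ≈ c′ → s ≈ s′ → t ≈ t′ → circular c s t ≈ circular c′ s′ t′
  circular-cong c≈ s≈ t≈ = ⊓-cong ∣≈∣ (+-cong c≈ (-‿cong ∣≈∣))
    where
    ∣≈∣ = ∣∣-cong (+-cong s≈ (-‿cong t≈))

  module _ {a b ℓ ℓ′} {X : DistanceSpace ℝ a ℓ} {Y : DistanceSpace ℝ b ℓ′}
    (A : CircularCoordinates X) (B : CircularCoordinates Y) where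

    private
      module X = DistanceSpace X
      module Y = DistanceSpace Y
      module A = CircularCoordinates A
      module B = CircularCoordinates B

      ratio : ∃ λ r → r * A.circumference ≈ B.circumference
      ratio = quotient B.circumference A.0<c

      r    = proj₁ ratio
      rA≈B = proj₂ ratio

      0<r : 0# < r
      0<r = quotient-pos A.0<c B.0<c rA≈B

      image : ∀ p → ∃ λ q → B.coord q ≈ r * A.coord p
      image p = B.coord-surjective (*-nonNeg (<⇒≤ 0<r) (A.0≤coord p))
        (linarith 4 (λ r s a b → r :* a :≈ b ⟹ :0 :< r :* (a :- s) ⟹ r :* s :< b) rA≈B
          (*-pos 0<r (linarith 2 (λ s a → s :< a ⟹ :0 :< a :- s) (A.coord<c p))))

      f : X.Carrier → Y.Carrier
      f p = proj₁ (image p)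

      coord-f : ∀ p → B.coord (f p) ≈ r * A.coord p
      coord-f p = proj₂ (image p)

      preimage : ∀ q → ∃ λ p → r * A.coord p ≈ B.coord q
      preimage q = let
        (t , tr≈coord) = quotient (B.coord q) 0<r
        0≤t = *-cancel-pos-≤ 0<r
          (linarith 3 (λ t r b → t :* r :≈ b ⟹ :0 :≤ b ⟹ :0 :* r :≤ t :* r) tr≈coord (B.0≤coord q))
        t<A = ≰⇒> λ A≤t → linarith 5
          (λ t r b A B → t :* r :≈ b ⟹ b :< B ⟹ r :* A :≈ B ⟹ :0 :≤ r :* (t :- A) ⟹ :⊥)
          tr≈coord (B.coord<c q) rA≈B
            (*-nonNeg (<⇒≤ 0<r) (linarith 2 (λ A t → A :≤ t ⟹ :0 :≤ t :- A) A≤t))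
        (p , coord≈t) = A.coord-surjective 0≤t t<A
        in p , trans (*-congˡ coord≈t) (trans (*-comm _ _) tr≈coord)

      r-cancel : ∀ {s t} → r * s ≈ r * t → s ≈ t
      r-cancel e = ≤.antisym
        (*-cancel-pos-≤ 0<r (linarith 3 (λ r s t → r :* s :≈ r :* t ⟹ s :* r :≤ t :* r) e))
        (*-cancel-pos-≤ 0<r (linarith 3 (λ r s t → r :* s :≈ r :* t ⟹ t :* r :≤ s :* r) e))

    -- Coordinates are multiplied by the ratio of the circumferences; `circular` is homogeneous, so
    -- distances are multiplied by it too.
    similar : Similar ℝ X Y
    similar = bijection , r , 0<r , λ p q → trans (B.d-coord (f p) (f q)) (trans
        (circular-cong (sym rA≈B) (coord-f p) (coord-f q)) (trans
        (circular-scale 0<r (A.0≤coord p) (A.coord<c p) (A.0≤coord q) (A.coord<c q))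
          (*-congˡ (sym (A.d-coord p q)))))
      where
      bijection : Bijection X.setoid Y.setoid
      bijection = record
        { to        = f
        ; cong      = λ {p} {q} p≈q →
          B.coord-injective (trans (coord-f p) (trans (*-congˡ (A.coord-cong p≈q)) (sym (coord-f q))))
        ; bijective =
            (λ {p} {q} fp≈fq → A.coord-injective
              (r-cancel (trans (sym (coord-f p)) (trans (B.coord-cong fp≈fq) (coord-f q))))) ,
            λ q → let (p , rp≈q) = preimage q in
              p , λ {p′} p′≈p → B.coord-injective
                (trans (coord-f p′) (trans (*-congˡ (A.coord-cong p′≈p)) rp≈q))
        }

  module _ {a b ℓ ℓ′} {X : DistanceSpace ℝ a ℓ} {Y : DistanceSpace ℝ b ℓ′} where

    private
      module X = DistanceSpace X
      module Y = DistanceSpace Y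

    -- A representation is composed with the bijection or its inverse, and its threshold is
    -- multiplied or divided by r. Since `to (to⁻ q)` is merely equivalent to q, the distance of Y
    -- has to respect equivalence.
    similar⇒UBG≐ : (∀ {p p′ q q′} → p Y.≈ p′ → q Y.≈ q′ → Y.d p q ≈ Y.d p′ q′) → Similar ℝ X Y →
      UBG ℝ X ≐ UBG ℝ Y
    similar⇒UBG≐ d-cong (bijection , r , 0<r , scaled) =
      (λ (δ , 0<δ , ρ , edge) → r * δ , *-pos 0<r 0<δ , to ∘ ρ , λ u v u≢v → mk⇔
        (λ e → forth (scaled _ _) (Equivalence.to (edge u v u≢v) e))
        (λ h → Equivalence.from (edge u v u≢v) (back (scaled _ _) h))) ,
      (λ (δ , 0<δ , ρ , edge) → let (ε , εr≈δ) = quotient δ 0<r in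
        ε , quotient-pos 0<r 0<δ εr≈δ , to⁻ ∘ ρ , λ u v u≢v → mk⇔
        (λ e → back (to⁻-scaled _ _)
          (≤-resp-≈ refl (trans (sym εr≈δ) (*-comm _ _)) (Equivalence.to (edge u v u≢v) e)))
        (λ h → Equivalence.from (edge u v u≢v)
          (≤-resp-≈ refl (trans (*-comm _ _) εr≈δ) (forth (to⁻-scaled _ _) h))))
      where
      open Bijection bijection using (to; to⁻; strictlySurjective)
      module Eq = Setoid Y.setoid

      forth : ∀ {d e δ} → e ≈ r * d → d ≤ δ → e ≤ r * δ
      forth e≈ d≤δ = linarith 4 (λ r d e δ → e :≈ r :* d ⟹ :0 :≤ r :* (δ :- d) ⟹ e :≤ r :* δ)
        e≈ (*-nonNeg (<⇒≤ 0<r) (linarith 2 (λ d δ → d :≤ δ ⟹ :0 :≤ δ :- d) d≤δ))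

      back : ∀ {d e δ} → e ≈ r * d → e ≤ r * δ → d ≤ δ
      back e≈ e≤ = *-cancel-pos-≤ 0<r
        (linarith 4 (λ r d e δ → e :≈ r :* d ⟹ e :≤ r :* δ ⟹ d :* r :≤ δ :* r) e≈ e≤)

      to-to⁻ : ∀ q → to (to⁻ q) Y.≈ q
      to-to⁻ q = proj₂ (strictlySurjective q)

      to⁻-scaled : ∀ p q → Y.d p q ≈ r * X.d (to⁻ p) (to⁻ q)
      to⁻-scaled p q = trans (d-cong (Eq.sym (to-to⁻ p)) (Eq.sym (to-to⁻ q))) (scaled _ _)

-- From equality of the collections to similarity, and back

module Characterisation (ℝ : CompleteOrderedField) (lem : ExcludedMiddle 0ℓ)
  {a ℓ : Level} (X : DistanceSpace ℝ a ℓ) (isGeodesic : IsGeodesicSpace ℝ X) where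

  open Analysis ℝ lem
  open Coordinates ℝ lem
  open CircleCoordinates ℝ lem using (circleCoordinates)
  open CircleConfigurations ℝ lem
  open Configurations ℝ lem
  open GeodesicSpace ℝ lem X isGeodesic
  open Net ℝ X using (NetFree)

  private
    module X = DistanceSpace X
    module M = IsGeneralMetric (proj₁ isGeodesic)

    six : (Fin 3 ⊎ Fin 3) ↔ Fin 6
    six = ↔-sym Fin.+↔⊎

  -- The six points of a net in X would be copied to a net on the circle, with the corners on the
  -- left of the sum and the pendant points on the right.
  netFree : (∀ {G} → UBG ℝ X G → UBG ℝ (S¹ ℝ lem) G) → NetFree
  netFree X⊆S {δ} a b 0<δ (triangle , near , far) =
    let (ε , 0<ε , σ , realised) =
          transfer X (S¹ ℝ lem) M.sym (λ {G} → X⊆S {G}) six 0<δ Sum.[ a , b ]′ in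
    circle-netFree (σ ∘ inj₁) (σ ∘ inj₂) 0<ε
      ( (λ i j i≢j → Equivalence.to (realised (inj₁ i) (inj₁ j) (i≢j ∘ inj₁-injective))
        (triangle i j i≢j))
      , (λ i → Equivalence.to (realised (inj₁ i) (inj₂ i) λ ()) (near i))
      , (λ i j i≢j → far i j i≢j ∘ Equivalence.from (realised (inj₂ i) (inj₁ j) λ ())))

  -- The corners have distances in (ε, 2ε], as any two have a common neighbour.
  module Hexagon (X-netFree : NetFree) {ε} (v m : Fin 3 → X.Carrier)
    (far : ∀ i j → i ≢ j → ¬ (X.d (v i) (v j) ≤ ε)) (near : ∀ i j → i ≢ j → X.d (v i) (m j) ≤ ε) where

    two-steps : ∀ i j k → i ≢ k → j ≢ k → X.d (v i) (v j) ≤ 2 · ε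
    two-steps i j k i≢k j≢k =
      linarith 4 (λ ij ik kj ε → ij :≤ ik :+ kj ⟹ ik :≤ ε ⟹ kj :≤ ε ⟹ ij :≤ 2 :× ε)
      (M.triangle (v i) (m k) (v j)) (near i k i≢k) (≤-resp-≈ (M.sym (v j) (m k)) refl (near j k j≢k))

    strict : ∀ {e f g} → e ≤ 2 · ε → ¬ (f ≤ ε) → ¬ (g ≤ ε) → e < f + g
    strict e≤2ε f≰ε g≰ε =
      linarith 4 (λ ε e f g → e :≤ 2 :× ε ⟹ ε :< f ⟹ ε :< g ⟹ e :< f :+ g) e≤2ε (≰⇒> f≰ε) (≰⇒> g≰ε)

    hexagonCoordinates : CircularCoordinates X
    hexagonCoordinates = StrictTriangle.triangleCoordinates X-netFree {v zero} {v (suc zero)}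
      {v (suc (suc zero))}
      (strict (two-steps zero (suc zero) (suc (suc zero)) (λ ()) (λ ())) v₀v₂ v₁v₂)
      (strict (two-steps zero (suc (suc zero)) (suc zero) (λ ()) (λ ())) v₀v₁ v₁v₂)
      (strict (two-steps (suc zero) (suc (suc zero)) zero (λ ()) (λ ())) v₀v₁ v₀v₂)
      where
      v₀v₁ = far zero (suc zero) λ ()
      v₀v₂ = far zero (suc (suc zero)) λ ()
      v₁v₂ = far (suc zero) (suc (suc zero)) λ ()

  -- The two inclusions do opposite work: one brings the hexagon into X, so that X is not too small,
  -- and the other keeps nets out of X, so that it does not branch.
  coordinates : UBG ℝ X ≐ UBG ℝ (S¹ ℝ lem) → CircularCoordinates X
  coordinates (X⊆S , S⊆X) = from-hexagon circle-hexagon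
    where
    from-hexagon : (∃ λ δ → 0# < δ × ∃ λ v → ∃ λ m → IsHexagon δ v m) → CircularCoordinates X
    from-hexagon (δ , 0<δ , v , m , far , near) =
      from-image (transfer (S¹ ℝ lem) X circle-d-sym (λ {G} → S⊆X {G}) six 0<δ Sum.[ v , m ]′)
      where
      from-image : (∃ λ ε → 0# < ε × ∃ λ σ → Realises (S¹ ℝ lem) X δ ε Sum.[ v , m ]′ σ) →
        CircularCoordinates X
      from-image (ε , _ , σ , realised) =
        Hexagon.hexagonCoordinates (netFree λ {G} → X⊆S {G}) (σ ∘ inj₁) (σ ∘ inj₂)
        (λ i j i≢j → far i j i≢j ∘ Equivalence.from (realised (inj₁ i) (inj₁ j) (i≢j ∘ inj₁-injective)))
        (λ i j i≢j → Equivalence.to (realised (inj₁ i) (inj₂ j) λ ()) (near i j i≢j))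

  UBG≐⇔similar : (UBG ℝ X ≐ UBG ℝ (S¹ ℝ lem)) ⇔ Similar ℝ X (S¹ ℝ lem)
  UBG≐⇔similar = mk⇔
    (λ h → Similarity.similar ℝ lem (coordinates h) circleCoordinates)
    (Similarity.similar⇒UBG≐ ℝ lem {Y = S¹ ℝ lem}
      (λ {p} {p′} {q} {q′} → circle-d-cong {p} {p′} {q} {q′}))

corollary1p14 : ∀ {a ℓ : Level} (lem : ∀ ℓ′ → ExcludedMiddle ℓ′)
    (ℝ : CompleteOrderedField)
    (X : DistanceSpace ℝ a ℓ) → IsGeodesicSpace ℝ X →
    (UBG ℝ X ≐ UBG ℝ (S¹ ℝ (lem 0ℓ))) ⇔ Similar ℝ X (S¹ ℝ (lem 0ℓ))
corollary1p14 lem ℝ X isGeodesic = Characterisation.UBG≐⇔similar ℝ (lem 0ℓ) X isGeodesic
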